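{- Let $k\ge 3$, let $\mathbf F$ be a $k$-CNF formula on $n$ variables, $W\in[n]$ and $s\in\mathbb N$. Let $\delta=\frac{4(k-1)}{(k-2)^2}$. There exist randomized algorithms that take $\mathbf F,s,W$ as input, run in time $O^*\left(s^3\cdot 2^{n(1-\frac{1}{k\ln 2})}\right)$, and output with probability $1-o(1)$: 1. (first algorithm) a set $S^*\subseteq\Omega_{\mathbf F,\ge(1-\delta)W}$ of size $s$ such that $\mathrm{minPD}(S^*)\ge\frac12(1-\delta)\,\mathrm{OptMin}(\mathbf F,s,\ge W)$, if $\mathbf F$ is satisfiable and $|\Omega_{\mathbf F,\ge W}|\ge s$; 2. (second algorithm) a set $S^*\subseteq\Omega_{\mathbf F,\le(1+\delta)W}$ of size $s$ such that $\mathrm{minPD}(S^*)\ge\frac12(1-\delta)\,\mathrm{OptMin}(\mathbf F,s,\le W)$, if $\mathbf F$ is satisfiable and $|\Omega_{\mathbf F,\le W}|\ge s$.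
   Context: $\Omega_{\mathbf F,\ge W}$ and $\Omega_{\mathbf F,\le W}$ denote the sets of satisfying assignments in $\{0,1\}^n$ of $\mathbf F$ of Hamming weight at least $W$, respectively at most $W$ (for real $W$). $d_H$ is Hamming distance; for a set $S$, $\mathrm{minPD}(S)=\min_{z_1\ne z_2\in S}d_H(z_1,z_2)$. $\mathrm{OptMin}(\mathbf F,s,\ge W)=\max_{S\subseteq\Omega_{\mathbf F,\ge W},|S|=s}\mathrm{minPD}(S)$ and $\mathrm{OptMin}(\mathbf F,s,\le W)=\max_{S\subseteq\Omega_{\mathbf F,\le W},|S|=s}\mathrm{minPD}(S)$. A $k$-CNF formula is a conjunction of clauses, each a disjunction of at most $k$ literals; formulas have $n^{O(1)}$ clauses. $k$ is a constant and $O^*$ hides factors polynomial in $n$; $o(1)$ is as $n\to\infty$. -}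

module Defs where

open import Data.Bool.Base using (Bool; true; false; _xor_; if_then_else_)
import Data.Bool.Properties as Bool
open import Data.Fin.Base using (Fin; toℕ)
open import Data.Fin.Subset using (Subset; ∣_∣)
import Data.Integer.Base as ℤ
open import Data.List.Base as List
  using (List; []; _∷_; _++_; length; filter; cartesianProduct; foldr; tabulate)
open import Data.List.Effectful using (module TraversableA)
open import Data.List.Extrema.Nat using (max; min)
open import Data.List.Membership.Propositional using (_∈_)
import Data.List.Membership.DecPropositional as DecMembership
open import Data.List.Relation.Unary.All as All using (All; []; _∷_)
open import Data.List.Relation.Unary.Any as Any using (Any)
open import Data.List.Relation.Unary.Unique.Propositional using (Unique)
import Data.List.Relation.Unary.Unique.DecPropositional as DecUnique
open import Data.Maybe.Base as Maybe using (Maybe; just; nothing)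
import Data.Maybe.Effectful as Maybe
import Data.Maybe.Relation.Unary.Any as MaybeAny
open import Data.Nat.Base as ℕ
  using (ℕ; zero; suc; _≤_; _*_; _∸_; _^_; NonZero; >-nonZero)
import Data.Nat.Properties as ℕ
open import Data.Product.Base using (∃; _×_; _,_; uncurry; map₂)
open import Data.Rational.Base as ℚ using (ℚ; 0ℚ; 1ℚ)
import Data.Rational.Properties as ℚ
open import Data.Sum.Base using (_⊎_; inj₁; inj₂; [_,_]′)
open import Data.Vec.Base using ([]; _∷_; lookup; zipWith)
open import Data.Vec.Properties using (≡-dec)
open import Relation.Binary.Definitions using (DecidableEquality)
open import Relation.Binary.PropositionalEquality using (_≡_)
open import Relation.Nullary.Decidable using (Dec; yes; no; ¬?; map′; _×-dec_)
open import Relation.Unary using (Pred; Decidable)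
open import Level using (0ℓ)

fromℕ : ℕ → ℚ
fromℕ m = (ℤ.+ m) ℚ./ 1

------------------------------------------------------------------------
-- CNF formulas and sets of satisfying assignments

-- (true , i) is the literal xᵢ, (false , i) its negation.
Literal : ℕ → Set
Literal n = Bool × Fin n

Clause : ℕ → Set
Clause n = List (Literal n)

CNF : ℕ → Set
CNF n = List (Clause n)

IsKCNF : ℕ → ∀ {n} → CNF n → Set
IsKCNF k = All (λ C → length C ≤ k)

-- Subset n is Vec Bool n; the Hamming weight of z is ∣ z ∣.
Assignment : ℕ → Set
Assignment n = Subset n

_≟ᴬ_ : ∀ {n} → DecidableEquality (Assignment n)
_≟ᴬ_ = ≡-dec Bool._≟_

_⊨_ : ∀ {n} → Assignment n → CNF n → Set
z ⊨ F = All (Any (λ (b , i) → lookup z i ≡ b)) F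

_⊨?_ : ∀ {n} (z : Assignment n) (F : CNF n) → Dec (z ⊨ F)
z ⊨? F = All.all? (Any.any? (λ (b , i) → lookup z i Bool.≟ b)) F

Satisfiable : ∀ {n} → CNF n → Set
Satisfiable F = ∃ λ z → z ⊨ F

assignments : ∀ n → List (Assignment n)
assignments zero    = [] ∷ []
assignments (suc n) =
  List.map (true ∷_) (assignments n) ++ List.map (false ∷_) (assignments n)

-- A finite set of assignments is a list without repetitions.
Ω≥ Ω≤ : ∀ {n} → CNF n → ℚ → List (Assignment n)
Ω≥ {n} F w =
  filter (λ z → (z ⊨? F) ×-dec (w ℚ.≤? fromℕ ∣ z ∣)) (assignments n)
Ω≤ {n} F w =
  filter (λ z → (z ⊨? F) ×-dec (fromℕ ∣ z ∣ ℚ.≤? w)) (assignments n)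

------------------------------------------------------------------------
-- Dispersion

dH : ∀ {n} → Assignment n → Assignment n → ℕ
dH z z′ = ∣ zipWith _xor_ z z′ ∣

-- The starting value n of the minimum is an upper bound on every distance,
-- so it matters only when S has fewer than two elements; the minimum over
-- the empty set of pairs is thus the top element n of {0,…,n}.
minPD : ∀ {n} → List (Assignment n) → ℕ
minPD {n} S =
  min n (List.map (uncurry dH)
          (filter (λ (z , z′) → ¬? (z ≟ᴬ z′)) (cartesianProduct S S)))

-- For a list without repetitions: all its subsets, each listed once.
subsets : ∀ {A : Set} → List A → List (List A)
subsets []       = [] ∷ []
subsets (x ∷ xs) = List.map (x ∷_) (subsets xs) ++ subsets xs

-- OptMin(F, s, ≥ W) is OptMin (Ω≥ F W) s, and similarly for ≤.
-- The starting value 0 matters only when Ω has fewer than s elements.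
OptMin : ∀ {n} → List (Assignment n) → ℕ → ℕ
OptMin Ω s =
  max 0 (List.map minPD (filter (λ S → length S ℕ.≟ s) (subsets Ω)))

record Dispersed {n} (Ω : List (Assignment n)) (s : ℕ) (q : ℚ)
                 (S : List (Assignment n)) : Set where
  constructor dispersed
  field
    distinct : Unique S
    size     : length S ≡ s
    inside   : All (_∈ Ω) S
    far      : q ℚ.≤ fromℕ (minPD S)

dispersed? : ∀ {n} (Ω : List (Assignment n)) s q → Decidable (Dispersed Ω s q)
dispersed? Ω s q S =
  map′ (λ (u , l , i , f) → dispersed u l i f)
       (λ (dispersed u l i f) → u , l , i , f)
       (DecUnique.unique? _≟ᴬ_ S ×-dec (length S ℕ.≟ s)
         ×-dec All.all? (λ z → DecMembership._∈?_ _≟ᴬ_ z Ω) S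
         ×-dec (q ℚ.≤? fromℕ (minPD S)))

δ : (k : ℕ) → 3 ≤ k → ℚ
δ k 3≤k = (ℤ.+ (4 * (k ∸ 1))) ℚ./ ((k ∸ 2) ^ 2)
  where instance
  nz : NonZero ((k ∸ 2) ^ 2)
  nz = ℕ.m^n≢0 (k ∸ 2) 2 {{>-nonZero (ℕ.m<n⇒0<n∸m 3≤k)}}

------------------------------------------------------------------------
-- The exponential bound

expTerm : ℚ → ℕ → ℚ
expTerm x zero    = 1ℚ
expTerm x (suc j) = expTerm x j ℚ.* x ℚ.* ((ℤ.+ 1) ℚ./ suc j)

-- Σ_{j < m} xʲ / j!
expSum : ℚ → ℕ → ℚ
expSum x zero    = 0ℚ
expSum x (suc m) = expSum x m ℚ.+ expTerm x m

-- t ≤ B · e⁻ˣ for t, x ≥ 0: the partial sums increase to eˣ, so t · eˣ ≤ B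
-- iff it holds with every partial sum in place of eˣ.
_≤_·exp⁻_ : ℚ → ℚ → ℚ → Set
t ≤ B ·exp⁻ x = ∀ m → t ℚ.* expSum x m ℚ.≤ B

------------------------------------------------------------------------
-- Randomized algorithms
--
-- A typed first-order call-by-value language over immutable pointer
-- structures (pure Lisp) with unbounded loops and uniform draws from
-- constant-size ranges.  Numbers admit only successor and zero test /
-- predecessor.  Every operation takes one time step: values are shared, so
-- each is a bounded number of instructions of a RAM, on words of
-- O(log (input values + running time)) bits.

data Ty : Set where
  bool nat  : Ty
  list      : Ty → Ty
  _⊗_ _⊕_   : Ty → Ty → Ty

infixr 6 _⊗_
infixr 5 _⊕_

⟦_⟧ : Ty → Set
⟦ bool ⟧   = Bool
⟦ nat ⟧    = ℕ
⟦ list A ⟧ = List ⟦ A ⟧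
⟦ A ⊗ B ⟧  = ⟦ A ⟧ × ⟦ B ⟧
⟦ A ⊕ B ⟧  = ⟦ A ⟧ ⊎ ⟦ B ⟧

Ctx : Set
Ctx = List Ty

data Term (Γ : Ctx) : Ty → Set where
  var       : ∀ {A} → A ∈ Γ → Term Γ A
  let′      : ∀ {A B} → Term Γ A → Term (A ∷ Γ) B → Term Γ B
  bit       : Bool → Term Γ bool
  if′       : ∀ {A} → Term Γ bool → Term Γ A → Term Γ A → Term Γ A
  zero′     : Term Γ nat
  suc′      : Term Γ nat → Term Γ nat
  case-nat  : ∀ {A} → Term Γ nat → Term Γ A → Term (nat ∷ Γ) A → Term Γ A
  nil       : ∀ {A} → Term Γ (list A)
  cons      : ∀ {A} → Term Γ A → Term Γ (list A) → Term Γ (list A)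
  case-list : ∀ {A B} → Term Γ (list A) →
              Term Γ B → Term (A ∷ list A ∷ Γ) B → Term Γ B
  pair      : ∀ {A B} → Term Γ A → Term Γ B → Term Γ (A ⊗ B)
  split     : ∀ {A B C} → Term Γ (A ⊗ B) → Term (A ∷ B ∷ Γ) C → Term Γ C
  inl       : ∀ {A B} → Term Γ A → Term Γ (A ⊕ B)
  inr       : ∀ {A B} → Term Γ B → Term Γ (A ⊕ B)
  case-sum  : ∀ {A B C} → Term Γ (A ⊕ B) →
              Term (A ∷ Γ) C → Term (B ∷ Γ) C → Term Γ C
  -- loop e b: start from state e; iterate b while it yields inl of a new
  -- state, stop with result v when it yields inr v.
  loop      : ∀ {A B} → Term Γ A → Term (A ∷ Γ) (A ⊕ B) → Term Γ B
  -- draw m: uniform in {0,…,m}.  The number m is part of the program text,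
  -- so it cannot depend on the input; draw 1 is a fair coin.
  draw      : ℕ → Term Γ nat

data Run (X : Set) : Set where
  halt   : X → Run X
  cutoff : Run X
  tick   : Run X → Run X
  choose : ∀ m → (Fin (suc m) → Run X) → Run X

_>>=_ : ∀ {X Y} → Run X → (X → Run Y) → Run Y
halt x     >>= g = g x
cutoff     >>= g = cutoff
tick r     >>= g = tick (r >>= g)
choose m f >>= g = choose m (λ i → f i >>= g)

Env : Ctx → Set
Env = All ⟦_⟧

natCase : ∀ {Y : Set} → Y → (ℕ → Y) → ℕ → Y
natCase y g zero    = y
natCase y g (suc a) = g a

listCase : ∀ {X Y : Set} → Y → (X → List X → Y) → List X → Y
listCase y g []       = y
listCase y g (x ∷ xs) = g x xs

-- The fuel only cuts off loops after that many iterations, so that the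
-- function is total.  A cut-off branch neither halts nor succeeds below, and
-- a branch that halts is unaffected by more fuel.
iterate : ∀ {X Y : Set} → ℕ → (X → Run (X ⊎ Y)) → X → Run Y
iterate zero    g x = cutoff
iterate (suc f) g x = g x >>= [ iterate f g , halt ]′

eval : ∀ {Γ A} → ℕ → Term Γ A → Env Γ → Run ⟦ A ⟧
eval f (var x) ρ = tick (halt (All.lookup ρ x))
eval f (let′ t u) ρ = tick (eval f t ρ >>= λ a → eval f u (a ∷ ρ))
eval f (bit b) ρ = tick (halt b)
eval f (if′ t u v) ρ =
  tick (eval f t ρ >>= λ b → if b then eval f u ρ else eval f v ρ)
eval f zero′ ρ = tick (halt 0)
eval f (suc′ t) ρ = tick (eval f t ρ >>= λ a → halt (suc a))
eval f (case-nat t u v) ρ =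
  tick (eval f t ρ >>= natCase (eval f u ρ) (λ a → eval f v (a ∷ ρ)))
eval f nil ρ = tick (halt [])
eval f (cons t u) ρ =
  tick (eval f t ρ >>= λ a → eval f u ρ >>= λ as → halt (a ∷ as))
eval f (case-list t u v) ρ =
  tick (eval f t ρ >>=
        listCase (eval f u ρ) (λ a as → eval f v (a ∷ as ∷ ρ)))
eval f (pair t u) ρ =
  tick (eval f t ρ >>= λ a → eval f u ρ >>= λ b → halt (a , b))
eval f (split t u) ρ =
  tick (eval f t ρ >>= λ (a , b) → eval f u (a ∷ b ∷ ρ))
eval f (inl t) ρ = tick (eval f t ρ >>= λ a → halt (inj₁ a))
eval f (inr t) ρ = tick (eval f t ρ >>= λ b → halt (inj₂ b))
eval f (case-sum t u v) ρ =
  tick (eval f t ρ >>=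
        [ (λ a → eval f u (a ∷ ρ)) , (λ b → eval f v (b ∷ ρ)) ]′)
eval f (loop t u) ρ =
  tick (eval f t ρ >>= iterate f (λ a → eval f u (a ∷ ρ)))
eval f (draw m) ρ = tick (choose m (λ i → halt (toℕ i)))

-- Every branch halts within the given number of steps.
data HaltsWithin {X : Set} : ℕ → Run X → Set where
  halt   : ∀ {t x} → HaltsWithin t (halt x)
  tick   : ∀ {t r} → HaltsWithin t r → HaltsWithin (suc t) (tick r)
  choose : ∀ {t m f} → (∀ i → HaltsWithin t (f i)) →
           HaltsWithin t (choose m f)

indicator : {P : Set} → Dec P → ℚ
indicator (yes _) = 1ℚ
indicator (no  _) = 0ℚ

-- The probability of halting with a result that satisfies P.
Pr : ∀ {X} {P : Pred X 0ℓ} → Decidable P → Run X → ℚ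
Pr P? (halt x)     = indicator (P? x)
Pr P? cutoff       = 0ℚ
Pr P? (tick r)     = Pr P? r
Pr P? (choose m f) =
  ((ℤ.+ 1) ℚ./ suc m) ℚ.* foldr ℚ._+_ 0ℚ (tabulate (λ i → Pr P? (f i)))

------------------------------------------------------------------------
-- Algorithms for the dispersion problem

-- Inputs: the number of variables, the clauses, s and W.
Algorithm : Set
Algorithm =
  Term (nat ∷ list (list (bool ⊗ nat)) ∷ nat ∷ nat ∷ []) (list (list bool))

-- Admissible inputs; d bounds the polynomial number of clauses.
-- s = 0 is excluded: the running time bound would be 0.
record Input (k d n : ℕ) : Set where
  field
    F       : CNF n
    s W     : ℕ
    isKCNF  : IsKCNF k F
    clauses : length F ≤ d * n ^ d
    1≤s     : 1 ≤ s
    1≤W     : 1 ≤ W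
    W≤n     : W ≤ n

execute : ∀ {k d n} → ℕ → Algorithm → Input k d n → Run (List (List Bool))
execute {n = n} fuel 𝒜 I =
  eval fuel 𝒜 (n ∷ List.map (List.map (map₂ toℕ)) F ∷ s ∷ W ∷ [])
  where open Input I

toAssignment : ∀ n → List Bool → Maybe (Assignment n)
toAssignment zero    []       = just []
toAssignment (suc n) (b ∷ bs) = Maybe.map (b ∷_) (toAssignment n bs)
toAssignment _       _        = nothing

toAssignments : ∀ n → List (List Bool) → Maybe (List (Assignment n))
toAssignments n = TraversableA.mapA Maybe.applicative (toAssignment n)

-- Worst-case time O*(s³ · 2^(n (1 - 1/(k ln 2)))); recall
-- 2^(n (1 - 1/(k ln 2))) = 2ⁿ · e^(-n/k).
RunsInTime : (k : ℕ) .{{_ : NonZero k}} → Algorithm → Set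
RunsInTime k 𝒜 =
  ∀ d → ∃ λ c → ∀ n (I : Input k d n) → let open Input I in
  ∃ λ fuel → ∃ λ t → HaltsWithin t (execute fuel 𝒜 I) ×
    (fromℕ t ≤ fromℕ (c * n ^ c * (s ^ 3 * 2 ^ n)) ·exp⁻ ((ℤ.+ n) ℚ./ k))

-- With probability 1 - o(1), uniformly in the input, the output is a set
-- S* ⊆ Ω F (w · W) of size s with minPD S* ≥ q · OptMin (Ω F W) s, provided
-- that F is satisfiable and Ω F W has at least s elements.
Approximates : (k : ℕ) → (∀ {n} → CNF n → ℚ → List (Assignment n)) →
               (w q : ℚ) → Algorithm → Set
Approximates k Ω w q 𝒜 =
  ∀ d (ε : ℚ) → 0ℚ ℚ.< ε → ∃ λ N → ∀ n → N ≤ n → (I : Input k d n) →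
  let open Input I
      target = Ω F (w ℚ.* fromℕ W)
      bound  = q ℚ.* fromℕ (OptMin (Ω F (fromℕ W)) s)
  in
  Satisfiable F → s ≤ length (Ω F (fromℕ W)) →
  ∃ λ fuel →
    1ℚ ℚ.- ε ℚ.≤
      Pr (λ out → MaybeAny.dec (dispersed? target s bound) (toAssignments n out))
         (execute fuel 𝒜 I)

module Submission where

-- The set is built greedily: as long as S has fewer than s elements, some
-- element z* of an optimal set is at distance at least OptMin / 2 from all of S.
-- Let e be the distance of z* to the nearest centre, the centres being 0 and the
-- elements of S.  It suffices to find, with probability at least
-- (k / (2 (k - 1)))ⁿ up to a polynomial, a solution within distance δ e of z*
-- that is not in S.
--
-- If δ e < n / k, then flipping every bit of the nearest centre with probability
-- 1/5 produces z* itself often enough.  Otherwise Schöning's walk is started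
-- from a uniformly random y.  From distance d it finds a solution without ever
-- leaving the ball of radius n / k around z* with probability of order
-- (k - 1)^(-d), by a potential argument.  With weights (k - 1)^(-d) the distance
-- of y to z* is binomial with mean n / k, so that by Markov's inequality the
-- starting points with d ≤ n / k make up a polynomial fraction of the total
-- weight ((1 + 1/(k - 1)) / 2)ⁿ = (k / (2 (k - 1)))ⁿ.
--
-- All of this happens in the subcube of the points that agree with a centre
-- exactly as long as z* does, where the centre has the longest common prefix
-- with z*; it contains no element of S.  Finally (1 - 1/k)ⁿ ≤ e^(-n/k).

-- The two cases meet at `e = (k - 2)² n / (4 k (k - 1))`, where `δ e = n / k`: beyond it, the whole
-- ball that the walk may explore is within the permitted error. Below it, flip rate 1/5 finds `z*`
-- with probability at least `(4/5)ⁿ 4⁻ᵉ`. This rate is not optimal, but its powers of 2 keep the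
-- comparison elementary, and there is room: at the threshold for large `k`, `4⁻ᵉ` is about
-- `2^(-n/2)`, and `(4/5) / √2 > 1/2`.
--
-- The origin is a centre because its distance from `z*` is the weight of `z*`: one error bound then
-- serves for distances and weights.
--
-- The obstacle is distinctness. For `k ≤ 6`, `δ ≥ 1` makes the distance requirement void, but `s`
-- distinct solutions are still due, and elements of `S` may lie in the ball. Discarding them
-- afterwards would not do, since the walk is only known to find some solution there. Confining it
-- to a subcube without elements of `S` excludes them beforehand.
--
-- The three factors `s` in the time come from the rounds, the centres and the comparison of a
-- candidate with `S`.

open import Defs
open import Algebra.Bundles using (CommutativeRing)
import Algebra.Properties.CommutativeSemiring.Exp as Exp
open import Data.Bool.Base using (Bool; true; false; if_then_else_; not; _xor_)
import Data.Bool.Properties as Bool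
open import Data.Fin.Base as Fin using (Fin; zero; suc; toℕ)
open import Data.Fin.Properties using (toℕ<n; pigeonhole)
open import Data.Fin.Subset using (∣_∣)
open import Data.Fin.Subset.Properties using (∣p∣≤n)
open import Data.Integer.Base as ℤ using (ℤ)
import Data.Integer.Properties as ℤ
open import Data.List.Base as List using (List; []; _∷_; length; foldr; tabulate)
open import Data.List.Extrema.Nat using (argmin-sel; argmax-sel; min≤⊤; min≤xs)
open import Data.List.Membership.Propositional using (_∈_; find; lose)
open import Data.List.Membership.Propositional.Properties
  using ( ∈-lookup; ∈-filter⁺; ∈-filter⁻; ∈-cartesianProduct⁺; ∈-cartesianProduct⁻
        ; ∈-++⁺ˡ; ∈-++⁺ʳ; ∈-++⁻; ∈-map⁺; ∈-map⁻)
open import Data.List.Properties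
  using (map-id; ++-identityʳ; length-map; length-++; length-filter; length-take)
open import Data.List.Relation.Unary.All as All using (All; []; _∷_)
open import Data.List.Relation.Unary.AllPairs as AllPairs using (AllPairs; []; _∷_)
open import Data.List.Relation.Unary.Any as Any using (Any; here; there)
open import Data.List.Relation.Unary.Any.Properties using (lookup-index)
open import Data.List.Relation.Unary.Unique.Propositional using (Unique)
import Data.List.Relation.Unary.Unique.Propositional.Properties as Unique
open import Data.Maybe.Base as Maybe using (just)
import Data.Maybe.Relation.Unary.Any as MaybeAny
open import Data.Nat.Base as ℕ
  using (ℕ; zero; suc; _+_; _*_; _^_; _∸_; _⊓_; _⊔_; _≤_; _<_; z≤n; s≤s)
open import Data.Nat.DivMod using (_/_; _%_; m/n*n≤m; m≡m%n+[m/n]*n; m%n<n)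
open import Data.Nat.ListAction using (sum)
import Data.Nat.Properties as ℕ
import Data.Nat.Tactic.RingSolver as ℕ-Solver
open import Data.Product.Base using (∃; Σ; _×_; _,_; proj₁; proj₂; map₂; uncurry)
open import Data.Rational.Base as ℚ using (ℚ; 0ℚ; 1ℚ; ½; toℚᵘ; _-_; -_)
import Data.Rational.Properties as ℚ
open import Data.Rational.Unnormalised.Base as ℚᵘ using (mkℚᵘ)
import Data.Rational.Unnormalised.Properties as ℚᵘ
open import Data.Sum.Base using (_⊎_; inj₁; inj₂)
open import Data.Unit.Base using (⊤; tt)
open import Data.Vec.Base as Vec using (Vec; []; _∷_; lookup; toList)
open import Data.Vec.Properties using (length-toList)
open import Function.Base using (_∘_; id; case_of_)
open import Level using (0ℓ)
open import Relation.Binary.PropositionalEquality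
  using (_≡_; _≢_; refl; sym; trans; cong; cong₂; subst; subst₂; module ≡-Reasoning)
open import Relation.Nullary.Decidable using (Dec; yes; no; ¬?; dec⇒maybe; _×-dec_; _⊎-dec_)
open import Relation.Nullary.Negation using (¬_; contradiction)
open import Relation.Unary using (Pred; Decidable)
open import Tactic.RingSolver using (solve-∀)
open import Tactic.RingSolver.Core.AlmostCommutativeRing
  using (AlmostCommutativeRing; fromCommutativeRing)

-- Rational arithmetic

ringℚ : AlmostCommutativeRing 0ℓ 0ℓ
ringℚ = fromCommutativeRing ℚ.+-*-commutativeRing (λ x → dec⇒maybe (0ℚ ℚ.≟ x))

open Exp (CommutativeRing.commutativeSemiring ℚ.+-*-commutativeRing)
  public using (^-homo-*; ^-assocʳ; ^-distrib-*) renaming (_^_ to _^ℚ_)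

toℚᵘ-fromℕ : ∀ m → toℚᵘ (fromℕ m) ℚᵘ.≃ mkℚᵘ (ℤ.+ m) 0
toℚᵘ-fromℕ m = ℚ.toℚᵘ-fromℚᵘ (mkℚᵘ (ℤ.+ m) 0)

fromℕ-+ : ∀ a b → fromℕ (a + b) ≡ fromℕ a ℚ.+ fromℕ b
fromℕ-+ a b = ℚ.toℚᵘ-injective (begin-equality
  toℚᵘ (fromℕ (a + b)) ≃⟨ toℚᵘ-fromℕ (a + b) ⟩
  mkℚᵘ (ℤ.+ (a + b)) 0 ≃⟨ ℚᵘ.*≡* (cong (ℤ._* ℤ.+ 1)
    (trans (ℤ.pos-+ a b) (sym (cong₂ ℤ._+_ (ℤ.*-identityʳ (ℤ.+ a)) (ℤ.*-identityʳ (ℤ.+ b)))))) ⟩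
  mkℚᵘ (ℤ.+ a) 0 ℚᵘ.+ mkℚᵘ (ℤ.+ b) 0 ≃⟨ ℚᵘ.+-cong (toℚᵘ-fromℕ a) (toℚᵘ-fromℕ b) ⟨
  toℚᵘ (fromℕ a) ℚᵘ.+ toℚᵘ (fromℕ b) ≃⟨ ℚ.toℚᵘ-homo-+ (fromℕ a) (fromℕ b) ⟨
  toℚᵘ (fromℕ a ℚ.+ fromℕ b) ∎)
  where open ℚᵘ.≤-Reasoning

fromℕ-* : ∀ a b → fromℕ (a * b) ≡ fromℕ a ℚ.* fromℕ b
fromℕ-* a b = ℚ.toℚᵘ-injective (begin-equality
  toℚᵘ (fromℕ (a * b)) ≃⟨ toℚᵘ-fromℕ (a * b) ⟩
  mkℚᵘ (ℤ.+ (a * b)) 0 ≃⟨ ℚᵘ.*≡* (cong (ℤ._* ℤ.+ 1) (ℤ.pos-* a b)) ⟩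
  mkℚᵘ (ℤ.+ a) 0 ℚᵘ.* mkℚᵘ (ℤ.+ b) 0 ≃⟨ ℚᵘ.*-cong (toℚᵘ-fromℕ a) (toℚᵘ-fromℕ b) ⟨
  toℚᵘ (fromℕ a) ℚᵘ.* toℚᵘ (fromℕ b) ≃⟨ ℚ.toℚᵘ-homo-* (fromℕ a) (fromℕ b) ⟨
  toℚᵘ (fromℕ a ℚ.* fromℕ b) ∎)
  where open ℚᵘ.≤-Reasoning

fromℕ-mono-≤ : ∀ {a b} → a ≤ b → fromℕ a ℚ.≤ fromℕ b
fromℕ-mono-≤ {a} {b} a≤b = ℚ.toℚᵘ-cancel-≤ (begin
  toℚᵘ (fromℕ a) ≃⟨ toℚᵘ-fromℕ a ⟩
  mkℚᵘ (ℤ.+ a) 0 ≤⟨ ℚᵘ.*≤* (ℤ.*-monoʳ-≤-nonNeg (ℤ.+ 1) (ℤ.+≤+ a≤b)) ⟩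
  mkℚᵘ (ℤ.+ b) 0 ≃⟨ toℚᵘ-fromℕ b ⟨
  toℚᵘ (fromℕ b) ∎)
  where open ℚᵘ.≤-Reasoning

fromℕ-cancel-≤ : ∀ {a b} → fromℕ a ℚ.≤ fromℕ b → a ≤ b
fromℕ-cancel-≤ {a} {b} le = ℕ.≮⇒≥ λ b<a →
  ℚ.<-irrefl refl (ℚ.<-≤-trans (strict b<a) le)
  where
  strict : ∀ {a b} → b < a → fromℕ b ℚ.< fromℕ a
  strict {a} {b} b<a = ℚ.toℚᵘ-cancel-< (begin-strict
    toℚᵘ (fromℕ b) ≃⟨ toℚᵘ-fromℕ b ⟩
    mkℚᵘ (ℤ.+ b) 0 <⟨ ℚᵘ.*<* (ℤ.*-monoʳ-<-pos (ℤ.+ 1) (ℤ.+<+ b<a)) ⟩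
    mkℚᵘ (ℤ.+ a) 0 ≃⟨ toℚᵘ-fromℕ a ⟨
    toℚᵘ (fromℕ a) ∎)
    where open ℚᵘ.≤-Reasoning

0≤fromℕ : ∀ a → 0ℚ ℚ.≤ fromℕ a
0≤fromℕ a = fromℕ-mono-≤ {0} {a} z≤n

fromℕ-^ : ∀ a m → fromℕ (a ^ m) ≡ fromℕ a ^ℚ m
fromℕ-^ a zero    = refl
fromℕ-^ a (suc m) = trans (fromℕ-* a (a ^ m)) (cong (fromℕ a ℚ.*_) (fromℕ-^ a m))

/-*-fromℕ : ∀ a b .{{_ : ℕ.NonZero b}} → ((ℤ.+ a) ℚ./ b) ℚ.* fromℕ b ≡ fromℕ a
/-*-fromℕ a b@(suc b-1) = ℚ.toℚᵘ-injective (begin-equality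
  toℚᵘ (((ℤ.+ a) ℚ./ b) ℚ.* fromℕ b) ≃⟨ ℚ.toℚᵘ-homo-* ((ℤ.+ a) ℚ./ b) (fromℕ b) ⟩
  toℚᵘ ((ℤ.+ a) ℚ./ b) ℚᵘ.* toℚᵘ (fromℕ b) ≃⟨ ℚᵘ.*-cong (ℚ.toℚᵘ-fromℚᵘ (mkℚᵘ (ℤ.+ a) b-1)) (toℚᵘ-fromℕ b) ⟩
  mkℚᵘ (ℤ.+ a) b-1 ℚᵘ.* mkℚᵘ (ℤ.+ b) 0 ≃⟨ ℚᵘ.*≡* (trans (ℤ.*-identityʳ (ℤ.+ a ℤ.* ℤ.+ b))
    (cong (λ x → ℤ.+ a ℤ.* ℤ.+ x) (sym (ℕ.*-identityʳ b)))) ⟩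
  mkℚᵘ (ℤ.+ a) 0 ≃⟨ toℚᵘ-fromℕ a ⟨
  toℚᵘ (fromℕ a) ∎)
  where open ℚᵘ.≤-Reasoning

0≤/ : ∀ a b .{{_ : ℕ.NonZero b}} → 0ℚ ℚ.≤ (ℤ.+ a) ℚ./ b
0≤/ a b = ℚ.nonNegative⁻¹ _ {{ℚ.normalize-nonNeg a b}}

*-monoˡ-≤ : ∀ {r p q} → 0ℚ ℚ.≤ r → p ℚ.≤ q → r ℚ.* p ℚ.≤ r ℚ.* q
*-monoˡ-≤ {r} 0≤r = ℚ.*-monoˡ-≤-nonNeg r {{ℚ.nonNegative 0≤r}}

*-monoʳ-≤ : ∀ {r p q} → 0ℚ ℚ.≤ r → p ℚ.≤ q → p ℚ.* r ℚ.≤ q ℚ.* r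
*-monoʳ-≤ {r} 0≤r = ℚ.*-monoʳ-≤-nonNeg r {{ℚ.nonNegative 0≤r}}

0≤* : ∀ {p q} → 0ℚ ℚ.≤ p → 0ℚ ℚ.≤ q → 0ℚ ℚ.≤ p ℚ.* q
0≤* {p} 0≤p 0≤q = ℚ.≤-trans (ℚ.≤-reflexive (sym (ℚ.*-zeroʳ p))) (*-monoˡ-≤ 0≤p 0≤q)

0≤+ : ∀ {p q} → 0ℚ ℚ.≤ p → 0ℚ ℚ.≤ q → 0ℚ ℚ.≤ p ℚ.+ q
0≤+ = ℚ.+-mono-≤

*-mono-≤ : ∀ {p q r s} → 0ℚ ℚ.≤ p → 0ℚ ℚ.≤ s → p ℚ.≤ q → r ℚ.≤ s → p ℚ.* r ℚ.≤ q ℚ.* s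
*-mono-≤ 0≤p 0≤s p≤q r≤s = ℚ.≤-trans (*-monoˡ-≤ 0≤p r≤s) (*-monoʳ-≤ 0≤s p≤q)

*-cancelˡ-≤ : ∀ {r p q} → 0ℚ ℚ.< r → r ℚ.* p ℚ.≤ r ℚ.* q → p ℚ.≤ q
*-cancelˡ-≤ {r} 0<r = ℚ.*-cancelˡ-≤-pos r {{ℚ.positive 0<r}}

*-cancelʳ-≤ : ∀ {r p q} → 0ℚ ℚ.< r → p ℚ.* r ℚ.≤ q ℚ.* r → p ℚ.≤ q
*-cancelʳ-≤ {r} 0<r = ℚ.*-cancelʳ-≤-pos r {{ℚ.positive 0<r}}

*-cancelʳ-≡ : ∀ {r p q} → 0ℚ ℚ.< r → p ℚ.* r ≡ q ℚ.* r → p ≡ q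
*-cancelʳ-≡ 0<r eq = ℚ.≤-antisym (*-cancelʳ-≤ 0<r (ℚ.≤-reflexive eq)) (*-cancelʳ-≤ 0<r (ℚ.≤-reflexive (sym eq)))

p≤p+r : ∀ p {r} → 0ℚ ℚ.≤ r → p ℚ.≤ p ℚ.+ r
p≤p+r p 0≤r = ℚ.≤-trans (ℚ.≤-reflexive (sym (ℚ.+-identityʳ p))) (ℚ.+-monoʳ-≤ p 0≤r)

≤-from-diff : ∀ {p q} r → 0ℚ ℚ.≤ r → p ℚ.+ r ≡ q → p ℚ.≤ q
≤-from-diff {p} r 0≤r eq = ℚ.≤-trans (p≤p+r p 0≤r) (ℚ.≤-reflexive eq)

p≤q⇒0≤q-p : ∀ {p q} → p ℚ.≤ q → 0ℚ ℚ.≤ q - p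
p≤q⇒0≤q-p {p} {q} p≤q = ℚ.≤-trans (ℚ.≤-reflexive (sym (ℚ.+-inverseʳ p))) (ℚ.+-monoˡ-≤ (- p) p≤q)

0≤^ : ∀ {x} m → 0ℚ ℚ.≤ x → 0ℚ ℚ.≤ x ^ℚ m
0≤^ zero    0≤x = 0≤fromℕ 1
0≤^ (suc m) 0≤x = 0≤* 0≤x (0≤^ m 0≤x)

^-mono-≤ : ∀ {x y} m → 0ℚ ℚ.≤ x → x ℚ.≤ y → x ^ℚ m ℚ.≤ y ^ℚ m
^-mono-≤ zero    0≤x x≤y = ℚ.≤-refl
^-mono-≤ (suc m) 0≤x x≤y =
  *-mono-≤ 0≤x (0≤^ m (ℚ.≤-trans 0≤x x≤y)) x≤y (^-mono-≤ m 0≤x x≤y)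

1^ : ∀ m → 1ℚ ^ℚ m ≡ 1ℚ
1^ zero    = refl
1^ (suc m) = trans (ℚ.*-identityˡ (1ℚ ^ℚ m)) (1^ m)

^≤1 : ∀ {x} m → 0ℚ ℚ.≤ x → x ℚ.≤ 1ℚ → x ^ℚ m ℚ.≤ 1ℚ
^≤1 m 0≤x x≤1 = ℚ.≤-trans (^-mono-≤ m 0≤x x≤1) (ℚ.≤-reflexive (1^ m))

^-anti-≤ : ∀ {x a b} → 0ℚ ℚ.≤ x → x ℚ.≤ 1ℚ → a ≤ b → x ^ℚ b ℚ.≤ x ^ℚ a
^-anti-≤ {x} {a} {b} 0≤x x≤1 a≤b = begin
  x ^ℚ b ≡⟨ cong (x ^ℚ_) (ℕ.m+[n∸m]≡n a≤b) ⟨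
  x ^ℚ (a + (b ∸ a)) ≡⟨ ^-homo-* x a (b ∸ a) ⟩
  x ^ℚ a ℚ.* x ^ℚ (b ∸ a) ≤⟨ *-monoˡ-≤ (0≤^ a 0≤x) (^≤1 (b ∸ a) 0≤x x≤1) ⟩
  x ^ℚ a ℚ.* 1ℚ ≡⟨ ℚ.*-identityʳ (x ^ℚ a) ⟩
  x ^ℚ a ∎
  where open ℚ.≤-Reasoning

-- Since (1-x)(1+x+mx) = 1+mx-(m+1)x².
bernoulli : ∀ {x} m → 0ℚ ℚ.≤ x → x ℚ.≤ 1ℚ →
            (1ℚ - x) ^ℚ m ℚ.* (1ℚ ℚ.+ fromℕ m ℚ.* x) ℚ.≤ 1ℚ
bernoulli {x} zero    0≤x x≤1 = ℚ.≤-reflexive (trans (ℚ.*-identityˡ _) (trans (cong (1ℚ ℚ.+_) (ℚ.*-zeroˡ x)) (ℚ.+-identityʳ 1ℚ)))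
bernoulli {x} (suc m) 0≤x x≤1 = begin
  (1ℚ - x) ℚ.* P ℚ.* (1ℚ ℚ.+ fromℕ (suc m) ℚ.* x)
    ≡⟨ cong (λ y → (1ℚ - x) ℚ.* P ℚ.* (1ℚ ℚ.+ y ℚ.* x)) (fromℕ-+ 1 m) ⟩
  (1ℚ - x) ℚ.* P ℚ.* (1ℚ ℚ.+ (1ℚ ℚ.+ M) ℚ.* x)
    ≤⟨ ≤-from-diff (P ℚ.* ((1ℚ ℚ.+ M) ℚ.* (x ℚ.* x))) (0≤* 0≤P (0≤* (0≤+ (0≤fromℕ 1) (0≤fromℕ m)) (0≤* 0≤x 0≤x))) (ring x P M) ⟩
  P ℚ.* (1ℚ ℚ.+ M ℚ.* x)
    ≤⟨ bernoulli m 0≤x x≤1 ⟩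
  1ℚ ∎
  where
  open ℚ.≤-Reasoning
  M = fromℕ m
  P = (1ℚ - x) ^ℚ m
  0≤P : 0ℚ ℚ.≤ P
  0≤P = 0≤^ m (p≤q⇒0≤q-p x≤1)
  ring : ∀ x P M → (1ℚ - x) ℚ.* P ℚ.* (1ℚ ℚ.+ (1ℚ ℚ.+ M) ℚ.* x) ℚ.+ P ℚ.* ((1ℚ ℚ.+ M) ℚ.* (x ℚ.* x))
         ≡ P ℚ.* (1ℚ ℚ.+ M ℚ.* x)
  ring = solve-∀ ringℚ

-- Distributions

∑ : ∀ {m} → (Fin m → ℚ) → ℚ
∑ g = foldr ℚ._+_ 0ℚ (tabulate g)

∑-cong : ∀ {m} {g h : Fin m → ℚ} → (∀ i → g i ≡ h i) → ∑ g ≡ ∑ h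
∑-cong {zero}  eq = refl
∑-cong {suc m} eq = cong₂ ℚ._+_ (eq zero) (∑-cong (eq ∘ suc))

∑-mono : ∀ {m} {g h : Fin m → ℚ} → (∀ i → g i ℚ.≤ h i) → ∑ g ℚ.≤ ∑ h
∑-mono {zero}  le = ℚ.≤-refl
∑-mono {suc m} le = ℚ.+-mono-≤ (le zero) (∑-mono (le ∘ suc))

∑-const : ∀ m c → ∑ {m} (λ _ → c) ≡ fromℕ m ℚ.* c
∑-const zero    c = sym (ℚ.*-zeroˡ c)
∑-const (suc m) c = begin
  c ℚ.+ ∑ {m} (λ _ → c) ≡⟨ cong (c ℚ.+_) (∑-const m c) ⟩
  c ℚ.+ fromℕ m ℚ.* c ≡⟨ ring c (fromℕ m) ⟩
  (1ℚ ℚ.+ fromℕ m) ℚ.* c ≡⟨ cong (ℚ._* c) (fromℕ-+ 1 m) ⟨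
  fromℕ (suc m) ℚ.* c ∎
  where
  open ≡-Reasoning
  ring : ∀ c M → c ℚ.+ M ℚ.* c ≡ (1ℚ ℚ.+ M) ℚ.* c
  ring = solve-∀ ringℚ

∑-+ : ∀ {m} (g h : Fin m → ℚ) → ∑ (λ i → g i ℚ.+ h i) ≡ ∑ g ℚ.+ ∑ h
∑-+ {zero}  g h = sym (ℚ.+-identityʳ 0ℚ)
∑-+ {suc m} g h = trans (cong (g zero ℚ.+ h zero ℚ.+_) (∑-+ (g ∘ suc) (h ∘ suc)))
                        (ring (g zero) (h zero) (∑ (g ∘ suc)) (∑ (h ∘ suc)))
  where
  ring : ∀ a b c d → a ℚ.+ b ℚ.+ (c ℚ.+ d) ≡ (a ℚ.+ c) ℚ.+ (b ℚ.+ d)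
  ring = solve-∀ ringℚ

-- The shape of one step of the walk: among the literals of a clause, index `j` is known to help,
-- and every other one is charged the worst case `y`.
∑-single : ∀ {m} (g : Fin (suc m) → ℚ) j {x y} → x ℚ.≤ g j → (∀ i → i ≢ j → y ℚ.≤ g i) →
           x ℚ.+ fromℕ m ℚ.* y ℚ.≤ ∑ g
∑-single {m} g zero {x} {y} x≤ y≤ = begin
  x ℚ.+ fromℕ m ℚ.* y ≡⟨ cong (x ℚ.+_) (∑-const m y) ⟨
  x ℚ.+ ∑ {m} (λ _ → y) ≤⟨ ℚ.+-mono-≤ x≤ (∑-mono (λ i → y≤ (suc i) λ ())) ⟩
  ∑ g ∎
  where open ℚ.≤-Reasoning
∑-single {suc m} g (suc j) {x} {y} x≤ y≤ = begin
  x ℚ.+ fromℕ (suc m) ℚ.* y ≡⟨ cong (λ c → x ℚ.+ c ℚ.* y) (fromℕ-+ 1 m) ⟩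
  x ℚ.+ (1ℚ ℚ.+ fromℕ m) ℚ.* y ≡⟨ ring x (fromℕ m) y ⟩
  y ℚ.+ (x ℚ.+ fromℕ m ℚ.* y) ≤⟨ ℚ.+-mono-≤ (y≤ zero λ ())
    (∑-single (g ∘ suc) j x≤ (λ i i≢j → y≤ (suc i) (i≢j ∘ suc-inj))) ⟩
  ∑ g ∎
  where
  open ℚ.≤-Reasoning
  suc-inj : ∀ {n} {i j : Fin n} → suc i ≡ suc j → i ≡ j
  suc-inj refl = refl
  ring : ∀ x M y → x ℚ.+ (1ℚ ℚ.+ M) ℚ.* y ≡ y ℚ.+ (x ℚ.+ M ℚ.* y)
  ring = solve-∀ ringℚ

-- A `Run` without ticks and cut-offs: probabilities are estimated here, free of time and fuel, and
-- transferred to runs by `Sim`.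
data Dist (X : Set) : Set where
  pure : X → Dist X
  draw : ∀ m → (Fin (suc m) → Dist X) → Dist X

bind : ∀ {X Y} → Dist X → (X → Dist Y) → Dist Y
bind (pure x)   g = g x
bind (draw m f) g = draw m (λ i → bind (f i) g)

mapᴰ : ∀ {X Y} → (X → Y) → Dist X → Dist Y
mapᴰ g d = bind d (pure ∘ g)

inv : ℕ → ℚ
inv m = (ℤ.+ 1) ℚ./ suc m

inv-* : ∀ m → inv m ℚ.* fromℕ (suc m) ≡ 1ℚ
inv-* m = /-*-fromℕ 1 (suc m)

0≤inv : ∀ m → 0ℚ ℚ.≤ inv m
0≤inv m = 0≤/ 1 (suc m)

E : ∀ {X} → (X → ℚ) → Dist X → ℚ
E φ (pure x)   = φ x
E φ (draw m f) = inv m ℚ.* ∑ (λ i → E φ (f i))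

E-cong : ∀ {X} {φ ψ : X → ℚ} → (∀ x → φ x ≡ ψ x) → ∀ d → E φ d ≡ E ψ d
E-cong eq (pure x)   = eq x
E-cong eq (draw m f) = cong (inv m ℚ.*_) (∑-cong (λ i → E-cong eq (f i)))

E-mono : ∀ {X} {φ ψ : X → ℚ} → (∀ x → φ x ℚ.≤ ψ x) → ∀ d → E φ d ℚ.≤ E ψ d
E-mono le (pure x)   = le x
E-mono le (draw m f) = *-monoˡ-≤ (0≤inv m) (∑-mono (λ i → E-mono le (f i)))

E-bind : ∀ {X Y} (φ : Y → ℚ) (d : Dist X) (g : X → Dist Y) →
         E φ (bind d g) ≡ E (λ x → E φ (g x)) d
E-bind φ (pure x)   g = refl
E-bind φ (draw m f) g = cong (inv m ℚ.*_) (∑-cong (λ i → E-bind φ (f i) g))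

avg-const : ∀ m c → inv m ℚ.* (fromℕ (suc m) ℚ.* c) ≡ c
avg-const m c = trans (sym (ℚ.*-assoc (inv m) (fromℕ (suc m)) c))
                      (trans (cong (ℚ._* c) (inv-* m)) (ℚ.*-identityˡ c))

E-const : ∀ {X} c (d : Dist X) → E (λ _ → c) d ≡ c
E-const c (pure x)   = refl
E-const c (draw m f) = trans (cong (inv m ℚ.*_) (trans (∑-cong (λ i → E-const c (f i))) (∑-const (suc m) c)))
                             (avg-const m c)

E-+ : ∀ {X} (φ ψ : X → ℚ) d → E (λ x → φ x ℚ.+ ψ x) d ≡ E φ d ℚ.+ E ψ d
E-+ φ ψ (pure x)   = refl
E-+ φ ψ (draw m f) = trans
  (cong (inv m ℚ.*_) (trans (∑-cong (λ i → E-+ φ ψ (f i))) (∑-+ (λ i → E φ (f i)) (λ i → E ψ (f i)))))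
  (ℚ.*-distribˡ-+ (inv m) (∑ (λ i → E φ (f i))) (∑ (λ i → E ψ (f i))))

E-≥ : ∀ {X} {φ : X → ℚ} {c} → (∀ x → c ℚ.≤ φ x) → ∀ d → c ℚ.≤ E φ d
E-≥ {c = c} le d = ℚ.≤-trans (ℚ.≤-reflexive (sym (E-const c d))) (E-mono le d)

-- The event P has probability at least p under d, stated for random
-- variables that dominate g times its indicator.
Hits : ∀ {X} → Dist X → (X → Set) → ℚ → Set
Hits {X} d P p = ∀ (φ : X → ℚ) g → 0ℚ ℚ.≤ g → (∀ x → 0ℚ ℚ.≤ φ x) → (∀ x → P x → g ℚ.≤ φ x) →
                 p ℚ.* g ℚ.≤ E φ d

-- Every branch of r has at most t ticks, and without its ticks r is d; rep
-- translates the results.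
data Sim {X Y : Set} (rep : Y → X) : ℕ → Run X → Dist Y → Set where
  halt   : ∀ {t x y} → x ≡ rep y → Sim rep t (halt x) (pure y)
  tick   : ∀ {t r d} → Sim rep t r d → Sim rep (suc t) (tick r) d
  choose : ∀ {t m f g} → (∀ i → Sim rep t (f i) (g i)) → Sim rep t (choose m f) (draw m g)

Sim-weaken : ∀ {X Y t u} {rep : Y → X} {r d} → t ≤ u → Sim rep t r d → Sim rep u r d
Sim-weaken le         (halt eq)  = halt eq
Sim-weaken (s≤s le) (tick s)   = tick (Sim-weaken le s)
Sim-weaken le         (choose s) = choose (λ i → Sim-weaken le (s i))

Sim-bind : ∀ {X Y X′ Y′ : Set} {rep : Y → X} {rep′ : Y′ → X′} {t u r d}
           {f : X → Run X′} {g : Y → Dist Y′} →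
           Sim rep t r d → (∀ y → Sim rep′ u (f (rep y)) (g y)) →
           Sim rep′ (t + u) (r >>= f) (bind d g)
Sim-bind {t = t} {u} (halt {y = y} refl) k = Sim-weaken (ℕ.m≤n+m u t) (k y)
Sim-bind (tick s)    k = tick (Sim-bind s k)
Sim-bind (choose s)  k = choose (λ i → Sim-bind (s i) k)

Sim-halts : ∀ {X Y t} {rep : Y → X} {r d} → Sim rep t r d → HaltsWithin t r
Sim-halts (halt eq)  = halt
Sim-halts (tick s)   = tick (Sim-halts s)
Sim-halts (choose s) = choose (λ i → Sim-halts (s i))

Sim-Pr : ∀ {X Y t} {rep : Y → X} {r d} {P : Pred X 0ℓ} (P? : Decidable P) → Sim rep t r d →
         Pr P? r ≡ E (λ y → indicator (P? (rep y))) d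
Sim-Pr P? (halt refl)        = refl
Sim-Pr P? (tick s)           = Sim-Pr P? s
Sim-Pr P? (choose {m = m} s) = cong (inv m ℚ.*_) (∑-cong (λ i → Sim-Pr P? (s i)))

0≤indicator : ∀ {P : Set} (P? : Dec P) → 0ℚ ℚ.≤ indicator P?
0≤indicator (yes _) = 0≤fromℕ 1
0≤indicator (no  _) = ℚ.≤-refl

indicator-yes : ∀ {P : Set} (P? : Dec P) → P → indicator P? ≡ 1ℚ
indicator-yes (yes _) p = refl
indicator-yes (no ¬p) p = contradiction p ¬p

-- Running times of programs

-- Unlike in `Sim-bind`, the continuation only has to be simulated at the one value `v`, so that
-- facts about `v` remain available.
Sim-det : ∀ {X X′ Z : Set} {rep : Z → X′} {t u} {r : Run X} {v : X} {h : X → Run X′} {d} →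
          Sim id t r (pure v) → Sim rep u (h v) d → Sim rep (t + u) (r >>= h) d
Sim-det {t = t} {u} (halt refl) s = Sim-weaken (ℕ.m≤n+m u t) s
Sim-det (tick s′) s = tick (Sim-det s′ s)

Sim-post : ∀ {X Y Z : Set} {rep : Y → X} {t r d} (F : X → Z) → Sim rep t r d →
           Sim (F ∘ rep) t (r >>= (halt ∘ F)) d
Sim-post F (halt eq)  = halt (cong F eq)
Sim-post F (tick s)   = tick (Sim-post F s)
Sim-post F (choose s) = choose (λ i → Sim-post F (s i))

-- The base is at least 8 so that one further power absorbs the overhead of a syntax node, and two
-- absorb a loop of at most `B` iterations.
cost : ℕ → ℕ → ℕ → ℕ
cost B σ e = suc σ * (8 + B) ^ e

Sim-post-det : ∀ {X Z : Set} {t} {r : Run X} {v : X} (F : X → Z) → Sim id t r (pure v) →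
               Sim id t (r >>= (halt ∘ F)) (pure (F v))
Sim-post-det F (halt refl) = halt refl
Sim-post-det F (tick s)    = tick (Sim-post-det F s)

Sim-cost : ∀ {X Y t u} {rep : Y → X} {r d} → t ≡ u → Sim rep t r d → Sim rep u r d
Sim-cost refl s = s

-- Two trees with the same draws and corresponding results. This relates a loop with an accumulator
-- to the structural recursion that the analysis wants; comparing branch by branch avoids
-- extensionality.
data Image {X Y : Set} (rep : Y → X) : Dist X → Dist Y → Set where
  pure : ∀ {x y} → x ≡ rep y → Image rep (pure x) (pure y)
  draw : ∀ {m f g} → (∀ i → Image rep (f i) (g i)) → Image rep (draw m f) (draw m g)

Image-bind-pure : ∀ {X} (d : Dist X) → Image id (bind d pure) d
Image-bind-pure (pure x)   = pure refl
Image-bind-pure (draw m f) = draw (λ i → Image-bind-pure (f i))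

Image-map : ∀ {X Y Z : Set} {rep : Y → X} {rep′ : Z → X} {f : Z → Y} {d d′} → (∀ z → rep (f z) ≡ rep′ z) →
            Image rep′ d d′ → Image rep d (mapᴰ f d′)
Image-map eq (pure {y = z} refl) = pure (sym (eq z))
Image-map eq (draw h)    = draw (λ i → Image-map eq (h i))

Sim-image : ∀ {X Y Z : Set} {rep : Y → X} {rep′ : Z → Y} {t r d d′} → Sim rep t r d → Image rep′ d d′ →
            Sim (rep ∘ rep′) t r d′
Sim-image (halt refl) (pure refl) = halt refl
Sim-image (tick s)    h           = tick (Sim-image s h)
Sim-image (choose s)  (draw h)    = choose (λ i → Sim-image (s i) (h i))

-- On ρ, the term t samples d within cost B σ e steps, which also serves as
-- fuel.  B bounds the polynomially sized data; the factor suc σ pays for the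
-- loops of superpolynomial length.
record Spec (B σ e : ℕ) {Γ A} (t : Term Γ A) (ρ : Env Γ) {Y : Set} (rep : Y → ⟦ A ⟧) (d : Dist Y) : Set where
  constructor spec
  field run : ∀ f → cost B σ e ≤ f → Sim rep (cost B σ e) (eval f t ρ) d
open Spec public

Det : (B σ e : ℕ) → ∀ {Γ A} → Term Γ A → Env Γ → ⟦ A ⟧ → Set
Det B σ e t ρ v = Spec B σ e t ρ id (pure v)

module _ {B : ℕ} where

  cost-mono : ∀ {σ σ′ e e′} → σ ≤ σ′ → e ≤ e′ → cost B σ e ≤ cost B σ′ e′
  cost-mono le le′ = ℕ.*-mono-≤ (s≤s le) (ℕ.^-monoʳ-≤ (8 + B) le′)

  1≤cost : ∀ σ e → 1 ≤ cost B σ e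
  1≤cost σ e = ℕ.*-mono-≤ {1} {suc σ} (s≤s z≤n) (ℕ.^-monoʳ-≤ (8 + B) {0} {e} z≤n)

  cost-suc : ∀ σ e → cost B σ (suc e) ≡ (8 + B) * cost B σ e
  cost-suc σ e = eq (suc σ) (8 + B) ((8 + B) ^ e)
    where
    eq : ∀ s b p → s * (b * p) ≡ b * (s * p)
    eq = ℕ-Solver.solve-∀

  multiple≤cost : ∀ {c} σ e → c ≤ 8 → c * cost B σ e ≤ cost B σ (suc e)
  multiple≤cost {c} σ e c≤8 = begin
    c * cost B σ e ≤⟨ ℕ.*-monoˡ-≤ (cost B σ e) (ℕ.≤-trans c≤8 (ℕ.m≤m+n 8 B)) ⟩
    (8 + B) * cost B σ e ≡⟨ cost-suc σ e ⟨
    cost B σ (suc e) ∎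
    where open ℕ.≤-Reasoning

  node≤ : ∀ σ e₁ e₂ e₃ → suc (cost B σ e₁ + (cost B σ e₂ + cost B σ e₃)) ≤ cost B σ (suc (e₁ ⊔ (e₂ ⊔ e₃)))
  node≤ σ e₁ e₂ e₃ = begin
    suc (cost B σ e₁ + (cost B σ e₂ + cost B σ e₃))
      ≤⟨ ℕ.+-mono-≤ (1≤cost σ e) (ℕ.+-mono-≤ (cost-mono (ℕ.≤-refl {σ}) (ℕ.m≤m⊔n e₁ (e₂ ⊔ e₃)))
          (ℕ.+-mono-≤ (cost-mono (ℕ.≤-refl {σ}) (ℕ.≤-trans (ℕ.m≤m⊔n e₂ e₃) (ℕ.m≤n⊔m e₁ (e₂ ⊔ e₃))))
                      (cost-mono (ℕ.≤-refl {σ}) (ℕ.≤-trans (ℕ.m≤n⊔m e₂ e₃) (ℕ.m≤n⊔m e₁ (e₂ ⊔ e₃)))))) ⟩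
    cost B σ e + (cost B σ e + (cost B σ e + cost B σ e))
      ≡⟨ eq (cost B σ e) ⟩
    4 * cost B σ e
      ≤⟨ multiple≤cost σ e (ℕ.m≤m+n 4 4) ⟩
    cost B σ (suc e) ∎
    where
    open ℕ.≤-Reasoning
    e = e₁ ⊔ (e₂ ⊔ e₃)
    eq : ∀ x → x + (x + (x + x)) ≡ 4 * x
    eq = ℕ-Solver.solve-∀

  module _ {σ : ℕ} {Γ : Ctx} {ρ : Env Γ} where

    Spec-weaken : ∀ {A Y} {rep : Y → ⟦ A ⟧} {σ′ e e′ t d} → σ′ ≤ σ → e ≤ e′ →
                  Spec B σ′ e t ρ rep d → Spec B σ e′ t ρ rep d
    Spec-weaken le le′ s .run f b =
      Sim-weaken (cost-mono le le′) (s .run f (ℕ.≤-trans (cost-mono le le′) b))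

    Spec-rep : ∀ {A Y v e t} {rep : Y → ⟦ A ⟧} {y} → v ≡ rep y → Det B σ e t ρ v → Spec B σ e t ρ rep (pure y)
    Spec-rep eq s .run f b with s .run f b
    ... | s′ = go eq s′
      where
      go : ∀ {X Y : Set} {t} {r : Run X} {v : X} {rep : Y → X} {y} → v ≡ rep y → Sim id t r (pure v) → Sim rep t r (pure y)
      go eq (halt refl) = halt eq
      go eq (tick s)    = tick (go eq s)

    Det-≡ : ∀ {A v v′ e} {t : Term Γ A} → v ≡ v′ → Det B σ e t ρ v → Det B σ e t ρ v′
    Det-≡ refl s = s

    Spec-≡ : ∀ {A Y e} {t : Term Γ A} {rep : Y → ⟦ A ⟧} {d d′} → d ≡ d′ → Spec B σ e t ρ rep d → Spec B σ e t ρ rep d′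
    Spec-≡ refl s = s

    Spec-image : ∀ {A Y Z e} {t : Term Γ A} {rep : Y → ⟦ A ⟧} {rep′ : Z → Y} {d d′} → Spec B σ e t ρ rep d →
                 Image rep′ d d′ → Spec B σ e t ρ (rep ∘ rep′) d′
    Spec-image s h .run f b = Sim-image (s .run f b) h

    leaf : ∀ {A Y} {rep : Y → ⟦ A ⟧} {t d} → (∀ f → Sim rep 1 (eval f t ρ) d) → Spec B σ 0 t ρ rep d
    leaf s .run f b = Sim-weaken (1≤cost σ 0) (s f)

    -- Exponents grow with the nesting of the syntax. The specifications below mostly leave them to
    -- unification; the one of the whole program is written out.
    node : ∀ {A Y} {rep : Y → ⟦ A ⟧} {t d} e₁ e₂ e₃ →
           (∀ f → cost B σ e₁ ≤ f → cost B σ e₂ ≤ f → cost B σ e₃ ≤ f →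
              Sim rep (suc (cost B σ e₁ + (cost B σ e₂ + cost B σ e₃))) (eval f t ρ) d) →
           Spec B σ (suc (e₁ ⊔ (e₂ ⊔ e₃))) t ρ rep d
    node e₁ e₂ e₃ s .run f b = Sim-weaken (node≤ σ e₁ e₂ e₃)
      (s f (≤f (ℕ.m≤m⊔n e₁ (e₂ ⊔ e₃)))
           (≤f (ℕ.≤-trans (ℕ.m≤m⊔n e₂ e₃) (ℕ.m≤n⊔m e₁ (e₂ ⊔ e₃))))
           (≤f (ℕ.≤-trans (ℕ.m≤n⊔m e₂ e₃) (ℕ.m≤n⊔m e₁ (e₂ ⊔ e₃)))))
      where
      ≤f : ∀ {e} → e ≤ e₁ ⊔ (e₂ ⊔ e₃) → cost B σ e ≤ f
      ≤f le = ℕ.≤-trans (cost-mono (ℕ.≤-refl {σ}) (ℕ.m≤n⇒m≤1+n le)) b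

    var-spec : ∀ {A} {x : A ∈ Γ} → Det B σ 0 (var x) ρ (All.lookup ρ x)
    var-spec = leaf λ f → tick (halt refl)

    bit-spec : ∀ {b} → Det B σ 0 (bit b) ρ b
    bit-spec = leaf λ f → tick (halt refl)

    zero-spec : Det B σ 0 zero′ ρ 0
    zero-spec = leaf λ f → tick (halt refl)

    nil-spec : ∀ {A} → Det B σ 0 (nil {A = A}) ρ []
    nil-spec = leaf λ f → tick (halt refl)

    draw-spec : ∀ {m} → Spec B σ 0 (draw m) ρ toℕ (draw m pure)
    draw-spec = leaf λ f → tick (choose λ i → halt refl)

    let-bind : ∀ {A C Y Z e₁ e₂} {t : Term Γ A} {u : Term (A ∷ Γ) C} {rep : Y → ⟦ A ⟧} {rep′ : Z → ⟦ C ⟧} {d g} →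
               Spec B σ e₁ t ρ rep d → (∀ y → Spec B σ e₂ u (rep y ∷ ρ) rep′ (g y)) →
               Spec B σ (suc (e₁ ⊔ (e₂ ⊔ e₂))) (let′ t u) ρ rep′ (bind d g)
    let-bind {e₁ = e₁} {e₂} s k = node e₁ e₂ e₂ λ f b₁ b₂ _ →
      tick (Sim-bind (s .run f b₁) λ y → Sim-weaken (ℕ.m≤m+n _ _) (k y .run f b₂))

    let-spec : ∀ {A C Z e₁ e₂} {t : Term Γ A} {u : Term (A ∷ Γ) C} {rep′ : Z → ⟦ C ⟧} {v d} →
               Det B σ e₁ t ρ v → Spec B σ e₂ u (v ∷ ρ) rep′ d →
               Spec B σ (suc (e₁ ⊔ (e₂ ⊔ e₂))) (let′ t u) ρ rep′ d
    let-spec {e₁ = e₁} {e₂} s k = node e₁ e₂ e₂ λ f b₁ b₂ _ →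
      tick (Sim-det (s .run f b₁) (Sim-weaken (ℕ.m≤m+n _ _) (k .run f b₂)))

    if-spec : ∀ {A Y e₁ e₂ e₃ t} {u v : Term Γ A} {rep : Y → ⟦ A ⟧} {b d} → Det B σ e₁ t ρ b →
              (b ≡ true → Spec B σ e₂ u ρ rep d) → (b ≡ false → Spec B σ e₃ v ρ rep d) →
              Spec B σ (suc (e₁ ⊔ (e₂ ⊔ e₃))) (if′ t u v) ρ rep d
    if-spec {e₁ = e₁} {e₂} {e₃} {b = true} s k₁ k₂ = node e₁ e₂ e₃ λ f b₁ b₂ _ →
      tick (Sim-det (s .run f b₁) (Sim-weaken (ℕ.m≤m+n _ _) (k₁ refl .run f b₂)))
    if-spec {e₁ = e₁} {e₂} {e₃} {b = false} s k₁ k₂ = node e₁ e₂ e₃ λ f b₁ _ b₃ →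
      tick (Sim-det (s .run f b₁) (Sim-weaken (ℕ.m≤n+m (cost B σ e₃) (cost B σ e₂)) (k₂ refl .run f b₃)))

    case-nat-spec : ∀ {A Y e₁ e₂ e₃ t} {u : Term Γ A} {v : Term (nat ∷ Γ) A} {rep : Y → ⟦ A ⟧} {a d} →
      Det B σ e₁ t ρ a → (a ≡ 0 → Spec B σ e₂ u ρ rep d) → (∀ a′ → a ≡ suc a′ → Spec B σ e₃ v (a′ ∷ ρ) rep d) →
      Spec B σ (suc (e₁ ⊔ (e₂ ⊔ e₃))) (case-nat t u v) ρ rep d
    case-nat-spec {e₁ = e₁} {e₂} {e₃} {a = zero} s k₁ k₂ = node e₁ e₂ e₃ λ f b₁ b₂ _ →
      tick (Sim-det (s .run f b₁) (Sim-weaken (ℕ.m≤m+n _ _) (k₁ refl .run f b₂)))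
    case-nat-spec {e₁ = e₁} {e₂} {e₃} {a = suc a} s k₁ k₂ = node e₁ e₂ e₃ λ f b₁ _ b₃ →
      tick (Sim-det (s .run f b₁) (Sim-weaken (ℕ.m≤n+m (cost B σ e₃) (cost B σ e₂)) (k₂ a refl .run f b₃)))

    case-list-spec : ∀ {A C Y e₁ e₂ e₃ t} {u : Term Γ C} {v : Term (A ∷ list A ∷ Γ) C} {rep : Y → ⟦ C ⟧} {as d} →
      Det B σ e₁ t ρ as → (as ≡ [] → Spec B σ e₂ u ρ rep d) →
      (∀ a as′ → as ≡ a ∷ as′ → Spec B σ e₃ v (a ∷ as′ ∷ ρ) rep d) →
      Spec B σ (suc (e₁ ⊔ (e₂ ⊔ e₃))) (case-list t u v) ρ rep d
    case-list-spec {e₁ = e₁} {e₂} {e₃} {as = []} s k₁ k₂ = node e₁ e₂ e₃ λ f b₁ b₂ _ →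
      tick (Sim-det (s .run f b₁) (Sim-weaken (ℕ.m≤m+n _ _) (k₁ refl .run f b₂)))
    case-list-spec {e₁ = e₁} {e₂} {e₃} {as = a ∷ as} s k₁ k₂ = node e₁ e₂ e₃ λ f b₁ _ b₃ →
      tick (Sim-det (s .run f b₁) (Sim-weaken (ℕ.m≤n+m (cost B σ e₃) (cost B σ e₂)) (k₂ a as refl .run f b₃)))

    case-nat-elim : ∀ {A Y e₁ e₂ e₃ t} {u : Term Γ A} {v : Term (nat ∷ Γ) A} {rep : Y → ⟦ A ⟧} {a} (d : ℕ → Dist Y) →
      Det B σ e₁ t ρ a → Spec B σ e₂ u ρ rep (d 0) → (∀ a′ → Spec B σ e₃ v (a′ ∷ ρ) rep (d (suc a′))) →
      Spec B σ (suc (e₁ ⊔ (e₂ ⊔ e₃))) (case-nat t u v) ρ rep (d a)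
    case-nat-elim {e₂ = e₂} {e₃} {a = zero}  d s k₁ k₂ = case-nat-spec {e₂ = e₂} {e₃} s (λ _ → k₁) (λ _ ())
    case-nat-elim {e₂ = e₂} {e₃} {a = suc a} d s k₁ k₂ = case-nat-spec {e₂ = e₂} {e₃} s (λ ()) (λ where _ refl → k₂ a)

    case-list-elim : ∀ {A C} {X Y : Set} {e₁ e₂ e₃ t} {u : Term Γ C} {v : Term (A ∷ list A ∷ Γ) C} {repX : X → ⟦ A ⟧}
      {rep : Y → ⟦ C ⟧} {xs} (d : List X → Dist Y) →
      Det B σ e₁ t ρ (List.map repX xs) → Spec B σ e₂ u ρ rep (d []) →
      (∀ x xs′ → Spec B σ e₃ v (repX x ∷ List.map repX xs′ ∷ ρ) rep (d (x ∷ xs′))) →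
      Spec B σ (suc (e₁ ⊔ (e₂ ⊔ e₃))) (case-list t u v) ρ rep (d xs)
    case-list-elim {e₂ = e₂} {e₃} {xs = []}     d s k₁ k₂ = case-list-spec {e₂ = e₂} {e₃} s (λ _ → k₁) (λ _ _ ())
    case-list-elim {e₂ = e₂} {e₃} {xs = x ∷ xs} d s k₁ k₂ = case-list-spec {e₂ = e₂} {e₃} s (λ ()) (λ where _ _ refl → k₂ x xs)

    case-nat-bind : ∀ {A Y e₁ e₂ e₃ t m} {u : Term Γ A} {v : Term (nat ∷ Γ) A} {rep : Y → ⟦ A ⟧} {g : Fin (suc m) → Dist Y} →
      Spec B σ e₁ t ρ toℕ (draw m pure) → Spec B σ e₂ u ρ rep (g zero) →
      (∀ i → Spec B σ e₃ v (toℕ i ∷ ρ) rep (g (suc i))) →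
      Spec B σ (suc (e₁ ⊔ (e₂ ⊔ e₃))) (case-nat t u v) ρ rep (draw m g)
    case-nat-bind {e₁ = e₁} {e₂} {e₃} s k₁ k₂ = node e₁ e₂ e₃ λ f b₁ b₂ b₃ →
      tick (Sim-bind (s .run f b₁) λ where
        zero    → Sim-weaken (ℕ.m≤m+n _ _) (k₁ .run f b₂)
        (suc i) → Sim-weaken (ℕ.m≤n+m (cost B σ e₃) (cost B σ e₂)) (k₂ i .run f b₃))

    split-spec : ∀ {A C D Y e₁ e₂ t} {u : Term (A ∷ C ∷ Γ) D} {rep : Y → ⟦ D ⟧} {a c d} →
      Det B σ e₁ t ρ (a , c) → Spec B σ e₂ u (a ∷ c ∷ ρ) rep d →
      Spec B σ (suc (e₁ ⊔ (e₂ ⊔ e₂))) (split t u) ρ rep d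
    split-spec {e₁ = e₁} {e₂} s k = node e₁ e₂ e₂ λ f b₁ b₂ _ →
      tick (Sim-det (s .run f b₁) (Sim-weaken (ℕ.m≤m+n _ _) (k .run f b₂)))

    split-bind : ∀ {A C D Y Z e₁ e₂ t} {u : Term (A ∷ C ∷ Γ) D} {rep : Y → ⟦ A ⟧ × ⟦ C ⟧} {rep′ : Z → ⟦ D ⟧} {d g} →
      Spec B σ e₁ t ρ rep d → (∀ y → Spec B σ e₂ u (proj₁ (rep y) ∷ proj₂ (rep y) ∷ ρ) rep′ (g y)) →
      Spec B σ (suc (e₁ ⊔ (e₂ ⊔ e₂))) (split t u) ρ rep′ (bind d g)
    split-bind {e₁ = e₁} {e₂} s k = node e₁ e₂ e₂ λ f b₁ b₂ _ →
      tick (Sim-bind (s .run f b₁) λ y → Sim-weaken (ℕ.m≤m+n _ _) (k y .run f b₂))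

    suc-spec : ∀ {e t a} → Det B σ e t ρ a → Det B σ (suc (e ⊔ (e ⊔ e))) (suc′ t) ρ (suc a)
    suc-spec {e} s = node e e e λ f b _ _ → tick (Sim-weaken (ℕ.m≤m+n _ _) (Sim-post-det suc (s .run f b)))

    cons-spec : ∀ {A e₁ e₂ t u} {a : ⟦ A ⟧} {as} → Det B σ e₁ t ρ a → Det B σ e₂ u ρ as →
                Det B σ (suc (e₁ ⊔ (e₂ ⊔ e₂))) (cons t u) ρ (a ∷ as)
    cons-spec {e₁ = e₁} {e₂} s s′ = node e₁ e₂ e₂ λ f b₁ b₂ _ →
      tick (Sim-det (s .run f b₁) (Sim-weaken (ℕ.m≤m+n _ _) (Sim-post-det (_ ∷_) (s′ .run f b₂))))

    pair-spec : ∀ {A C e₁ e₂ t u} {a : ⟦ A ⟧} {c : ⟦ C ⟧} → Det B σ e₁ t ρ a → Det B σ e₂ u ρ c →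
                Det B σ (suc (e₁ ⊔ (e₂ ⊔ e₂))) (pair t u) ρ (a , c)
    pair-spec {e₁ = e₁} {e₂} s s′ = node e₁ e₂ e₂ λ f b₁ b₂ _ →
      tick (Sim-det (s .run f b₁) (Sim-weaken (ℕ.m≤m+n _ _) (Sim-post-det (_ ,_) (s′ .run f b₂))))

-- The body of for-list sees the element, the remaining list (twice) and the
-- accumulator; that of for-nat the predecessor (twice) and the accumulator.
for-list : ∀ {Γ A C} → Term Γ (list A) → Term Γ C → Term (A ∷ list A ∷ list A ∷ C ∷ (list A ⊗ C) ∷ Γ) C → Term Γ C
for-list xs init body =
  loop (pair xs init)
       (split (var (here refl))
         (case-list (var (here refl)) (inr (var (there (here refl))))
           (inl (pair (var (there (here refl))) body))))

for-nat : ∀ {Γ C} → Term Γ nat → Term Γ C → Term (nat ∷ nat ∷ C ∷ (nat ⊗ C) ∷ Γ) C → Term Γ C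
for-nat m init body =
  loop (pair m init)
       (split (var (here refl))
         (case-nat (var (here refl)) (inr (var (there (here refl))))
           (inl (pair (var (here refl)) body))))

forᴸ : ∀ {X Y : Set} → (X → Y → Dist Y) → List X → Y → Dist Y
forᴸ step []       y = pure y
forᴸ step (x ∷ xs) y = bind (step x y) (forᴸ step xs)

-- The type of the state may depend on the number of remaining iterations, so that the state can
-- carry an invariant such as `length S + j ≡ s`.
forᴺ : ∀ {Y : ℕ → Set} → (∀ j → Y (suc j) → Dist (Y j)) → ∀ m → Y m → Dist (Y 0)
forᴺ step zero    y = pure y
forᴺ step (suc m) y = bind (step m y) (forᴺ step m)

module _ {B : ℕ} where

  -- An iteration spends 7 steps around the body, and the final round, which only exits, 6. The new
  -- parameter is the number whose successor is `suc ν * suc σ`: a long loop multiplies the factor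
  -- by `suc ν`, while for `ν = 0` the two additional powers of `8 + B` pay for all iterations.
  loop≤ : ∀ σ m ν e₁ e₂ e₃ → 10 + 8 * m ≤ suc ν * (8 + B) ^ 2 →
          suc (suc (cost B σ e₁ + cost B σ e₂) + (m * (7 + cost B σ e₃) + 6)) ≤
          cost B (σ + ν * suc σ) (2 + (e₁ ⊔ (e₂ ⊔ e₃)))
  loop≤ σ m ν e₁ e₂ e₃ m≤ = begin
    suc (suc (cost B σ e₁ + cost B σ e₂) + (m * (7 + cost B σ e₃) + 6))
      ≤⟨ ℕ.+-mono-≤ 1≤c (ℕ.+-mono-≤ (ℕ.+-mono-≤ 1≤c (ℕ.+-mono-≤ c₁ c₂))
           (ℕ.+-mono-≤ (ℕ.*-monoʳ-≤ m (ℕ.+-mono-≤ (ℕ.*-monoʳ-≤ 7 1≤c) c₃)) (ℕ.*-monoʳ-≤ 6 1≤c))) ⟩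
    c + (c + (c + c) + (m * (7 * c + c) + 6 * c))
      ≡⟨ eq₁ c m ⟩
    (10 + 8 * m) * c
      ≤⟨ ℕ.*-monoˡ-≤ c m≤ ⟩
    suc ν * (8 + B) ^ 2 * c
      ≡⟨ eq₂ ν σ (8 + B) ((8 + B) ^ e) ⟩
    cost B (σ + ν * suc σ) (2 + e) ∎
    where
    open ℕ.≤-Reasoning
    e = e₁ ⊔ (e₂ ⊔ e₃)
    c = cost B σ e
    1≤c : 1 ≤ c
    1≤c = 1≤cost σ e
    c₁ : cost B σ e₁ ≤ c
    c₁ = cost-mono (ℕ.≤-refl {σ}) (ℕ.m≤m⊔n e₁ (e₂ ⊔ e₃))
    c₂ : cost B σ e₂ ≤ c
    c₂ = cost-mono (ℕ.≤-refl {σ}) (ℕ.≤-trans (ℕ.m≤m⊔n e₂ e₃) (ℕ.m≤n⊔m e₁ (e₂ ⊔ e₃)))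
    c₃ : cost B σ e₃ ≤ c
    c₃ = cost-mono (ℕ.≤-refl {σ}) (ℕ.≤-trans (ℕ.m≤n⊔m e₂ e₃) (ℕ.m≤n⊔m e₁ (e₂ ⊔ e₃)))
    eq₁ : ∀ c m → c + (c + (c + c) + (m * (7 * c + c) + 6 * c)) ≡ (10 + 8 * m) * c
    eq₁ = ℕ-Solver.solve-∀
    eq₂ : ∀ ν σ b p → suc ν * (b * (b * 1)) * (suc σ * p) ≡ suc (σ + ν * suc σ) * (b * (b * p))
    eq₂ = ℕ-Solver.solve-∀

  poly-loop : ∀ m → m ≤ B → 10 + 8 * m ≤ 1 * (8 + B) ^ 2
  poly-loop m m≤B = begin
    10 + 8 * m ≤⟨ ℕ.+-monoʳ-≤ 10 (ℕ.*-monoʳ-≤ 8 m≤B) ⟩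
    10 + 8 * B ≤⟨ ℕ.m≤m+n _ (54 + 8 * B + B * B) ⟩
    10 + 8 * B + (54 + 8 * B + B * B) ≡⟨ eq B ⟩
    1 * (8 + B) ^ 2 ∎
    where
    open ℕ.≤-Reasoning
    eq : ∀ B → 10 + 8 * B + (54 + 8 * B + B * B) ≡ 1 * ((8 + B) * ((8 + B) * 1))
    eq = ℕ-Solver.solve-∀

  long-loop : ∀ {m ν} → m ≤ ν → 10 + 8 * m ≤ suc ν * (8 + B) ^ 2
  long-loop {m} {ν} m≤ν = begin
    10 + 8 * m ≤⟨ ℕ.+-monoʳ-≤ 10 (ℕ.*-mono-≤ (ℕ.m≤m+n 8 2) m≤ν) ⟩
    10 + 10 * ν ≡⟨ eq ν ⟩
    suc ν * 10 ≤⟨ ℕ.*-monoʳ-≤ (suc ν) (ℕ.≤-trans (ℕ.m≤m+n 10 54) (ℕ.^-monoˡ-≤ 2 (ℕ.m≤m+n 8 B))) ⟩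
    suc ν * (8 + B) ^ 2 ∎
    where
    open ℕ.≤-Reasoning
    eq : ∀ ν → 10 + 10 * ν ≡ suc ν * 10
    eq = ℕ-Solver.solve-∀

  -- The time bound is also the fuel, and a loop with `m` iterations evaluates its body term `m + 1`
  -- times.
  m<loop : ∀ m c d → m < suc (d + (m * (7 + c) + 6))
  m<loop m c d = s≤s (begin
    m ≤⟨ ℕ.m≤m*n m (7 + c) ⟩
    m * (7 + c) ≤⟨ ℕ.m≤m+n _ 6 ⟩
    m * (7 + c) + 6 ≤⟨ ℕ.m≤n+m _ d ⟩
    d + (m * (7 + c) + 6) ∎)
    where open ℕ.≤-Reasoning

  module _ {σ : ℕ} {Γ : Ctx} {ρ : Env Γ} where

    for-list-spec′ :
      ∀ {A C} {X Y : Set} {repX : X → ⟦ A ⟧} {rep : Y → ⟦ C ⟧} {ν e₁ e₂ e₃ ts init body} {xs : List X} {y₀ : Y} {step} →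
      10 + 8 * length xs ≤ suc ν * (8 + B) ^ 2 →
      Det B σ e₁ ts ρ (List.map repX xs) → Det B σ e₂ init ρ (rep y₀) →
      (∀ x rest rest′ y st → x ∈ xs → Spec B σ e₃ body (repX x ∷ rest ∷ rest′ ∷ rep y ∷ st ∷ ρ) rep (step x y)) →
      Spec B (σ + ν * suc σ) (2 + (e₁ ⊔ (e₂ ⊔ e₃))) (for-list ts init body) ρ rep (forᴸ step xs y₀)
    for-list-spec′ {A} {C} {X} {Y} {repX} {rep} {ν} {e₁} {e₂} {e₃} {ts} {init} {body} {xs} {y₀} {step} ok sₓ s₀ s .run f b =
      Sim-weaken le (tick (Sim-det (tick (Sim-det (sₓ .run f b₁) (Sim-post-det (_ ,_) (s₀ .run f b₂)))) (go f xs y₀ m<f id)))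
      where
      le = loop≤ σ (length xs) ν e₁ e₂ e₃ ok
      c₁₂ = suc (cost B σ e₁ + cost B σ e₂)
      m<f : length xs < f
      m<f = ℕ.≤-trans (m<loop (length xs) (cost B σ e₃) c₁₂) (ℕ.≤-trans le b)
      σ≤ : σ ≤ σ + ν * suc σ
      σ≤ = ℕ.m≤m+n σ (ν * suc σ)
      ≤f : ∀ {e} → e ≤ e₁ ⊔ (e₂ ⊔ e₃) → cost B σ e ≤ f
      ≤f le′ = ℕ.≤-trans (cost-mono σ≤ (ℕ.≤-trans le′ (ℕ.m≤n+m (e₁ ⊔ (e₂ ⊔ e₃)) 2))) b
      b₁ = ≤f (ℕ.m≤m⊔n e₁ (e₂ ⊔ e₃))
      b₂ = ≤f (ℕ.≤-trans (ℕ.m≤m⊔n e₂ e₃) (ℕ.m≤n⊔m e₁ (e₂ ⊔ e₃)))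
      b₃ = ≤f (ℕ.≤-trans (ℕ.m≤n⊔m e₂ e₃) (ℕ.m≤n⊔m e₁ (e₂ ⊔ e₃)))
      g : ⟦ list A ⊗ C ⟧ → Run (⟦ list A ⊗ C ⟧ ⊎ ⟦ C ⟧)
      g a = eval f (split (var (here refl))
         (case-list (var (here refl)) (inr (var (there (here refl))))
           (inl (pair (var (there (here refl))) body)))) (a ∷ ρ)
      go : ∀ n xs′ y → length xs′ < n → (∀ {x} → x ∈ xs′ → x ∈ xs) →
           Sim rep (length xs′ * (7 + cost B σ e₃) + 6) (iterate n g (List.map repX xs′ , rep y)) (forᴸ step xs′ y)
      go (suc n) []       y _         _  = tick (tick (tick (tick (tick (tick (halt refl))))))
      go (suc n) (x ∷ xs) y (s≤s l) xs⊆ =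
        tick (tick (tick (tick (tick (tick (tick
          (Sim-cost (sym (ℕ.+-assoc (cost B σ e₃) (length xs * (7 + cost B σ e₃)) 6))
            (Sim-bind (Sim-post inj₁ (Sim-post (List.map repX xs ,_) (s x _ _ y _ (xs⊆ (here refl)) .run f b₃)))
                      (λ y′ → go n xs y′ l (xs⊆ ∘ there))))))))))

    for-nat-spec′ :
      ∀ {C} {Y : ℕ → Set} {rep : ∀ {j} → Y j → ⟦ C ⟧} {ν e₁ e₂ e₃ t init body m} {y₀ : Y m} {step : ∀ j → Y (suc j) → Dist (Y j)} →
      10 + 8 * m ≤ suc ν * (8 + B) ^ 2 →
      Det B σ e₁ t ρ m → Det B σ e₂ init ρ (rep y₀) →
      (∀ j (y : Y (suc j)) j′ st → j < m → Spec B σ e₃ body (j ∷ j′ ∷ rep y ∷ st ∷ ρ) (rep {j}) (step j y)) →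
      Spec B (σ + ν * suc σ) (2 + (e₁ ⊔ (e₂ ⊔ e₃))) (for-nat t init body) ρ (rep {0}) (forᴺ step m y₀)
    for-nat-spec′ {C} {Y} {rep} {ν} {e₁} {e₂} {e₃} {t} {init} {body} {m} {y₀} {step} ok sₓ s₀ s .run f b =
      Sim-weaken le (tick (Sim-det (tick (Sim-det (sₓ .run f b₁) (Sim-post-det (_ ,_) (s₀ .run f b₂)))) (go f m y₀ m<f ℕ.≤-refl)))
      where
      le = loop≤ σ m ν e₁ e₂ e₃ ok
      c₁₂ = suc (cost B σ e₁ + cost B σ e₂)
      m<f : m < f
      m<f = ℕ.≤-trans (m<loop m (cost B σ e₃) c₁₂) (ℕ.≤-trans le b)
      σ≤ : σ ≤ σ + ν * suc σ
      σ≤ = ℕ.m≤m+n σ (ν * suc σ)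
      ≤f : ∀ {e} → e ≤ e₁ ⊔ (e₂ ⊔ e₃) → cost B σ e ≤ f
      ≤f le′ = ℕ.≤-trans (cost-mono σ≤ (ℕ.≤-trans le′ (ℕ.m≤n+m (e₁ ⊔ (e₂ ⊔ e₃)) 2))) b
      b₁ = ≤f (ℕ.m≤m⊔n e₁ (e₂ ⊔ e₃))
      b₂ = ≤f (ℕ.≤-trans (ℕ.m≤m⊔n e₂ e₃) (ℕ.m≤n⊔m e₁ (e₂ ⊔ e₃)))
      b₃ = ≤f (ℕ.≤-trans (ℕ.m≤n⊔m e₂ e₃) (ℕ.m≤n⊔m e₁ (e₂ ⊔ e₃)))
      g : ⟦ nat ⊗ C ⟧ → Run (⟦ nat ⊗ C ⟧ ⊎ ⟦ C ⟧)
      g a = eval f (split (var (here refl))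
         (case-nat (var (here refl)) (inr (var (there (here refl))))
           (inl (pair (var (here refl)) body)))) (a ∷ ρ)
      go : ∀ n j (y : Y j) → j < n → j ≤ m →
           Sim rep (j * (7 + cost B σ e₃) + 6) (iterate n g (j , rep y)) (forᴺ {Y} step j y)
      go (suc n) zero    y _         _   = tick (tick (tick (tick (tick (tick (halt refl))))))
      go (suc n) (suc j) y (s≤s l) j<m =
        tick (tick (tick (tick (tick (tick (tick
          (Sim-cost (sym (ℕ.+-assoc (cost B σ e₃) (j * (7 + cost B σ e₃)) 6))
            (Sim-bind (Sim-post inj₁ (Sim-post (j ,_) (s j y _ _ j<m .run f b₃)))
                      (λ y′ → go n j y′ l (ℕ.<⇒≤ j<m))))))))))

foldᴸ : ∀ {X Y : Set} → (X → Y → Y) → List X → Y → Y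
foldᴸ f []       y = y
foldᴸ f (x ∷ xs) y = foldᴸ f xs (f x y)

foldᴺ : ∀ {Y : Set} → (Y → Y) → ℕ → Y → Y
foldᴺ f zero    y = y
foldᴺ f (suc m) y = foldᴺ f m (f y)

forᴸ-pure : ∀ {X Y : Set} (f : X → Y → Y) xs y → forᴸ (λ x y → pure (f x y)) xs y ≡ pure (foldᴸ f xs y)
forᴸ-pure f []       y = refl
forᴸ-pure f (x ∷ xs) y = forᴸ-pure f xs (f x y)

forᴺ-pure : ∀ {Y : Set} (f : Y → Y) m y → forᴺ {λ _ → Y} (λ _ y → pure (f y)) m y ≡ pure (foldᴺ f m y)
forᴺ-pure f zero    y = refl
forᴺ-pure f (suc m) y = forᴺ-pure f m (f y)

module _ {B σ : ℕ} {Γ : Ctx} {ρ : Env Γ} where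

  Spec-det : ∀ {A Y e t} {rep : Y → ⟦ A ⟧} {y} → Spec B σ e t ρ rep (pure y) → Det B σ e t ρ (rep y)
  Spec-det s .run f b = go (s .run f b)
    where
    go : ∀ {X Y : Set} {t} {r : Run X} {rep : Y → X} {y} → Sim rep t r (pure y) → Sim id t r (pure (rep y))
    go (halt eq) = halt eq
    go (tick s)  = tick (go s)

  private
    unit-factor : σ + 0 * suc σ ≤ σ
    unit-factor = ℕ.≤-reflexive (ℕ.+-identityʳ σ)

  for-list-spec :
    ∀ {A C} {X Y : Set} {repX : X → ⟦ A ⟧} {rep : Y → ⟦ C ⟧} {e₁ e₂ e₃ ts init body} {xs : List X} {y₀ : Y} {step} →
    length xs ≤ B →
    Det B σ e₁ ts ρ (List.map repX xs) → Det B σ e₂ init ρ (rep y₀) →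
    (∀ x rest rest′ y st → x ∈ xs → Spec B σ e₃ body (repX x ∷ rest ∷ rest′ ∷ rep y ∷ st ∷ ρ) rep (step x y)) →
    Spec B σ (2 + (e₁ ⊔ (e₂ ⊔ e₃))) (for-list ts init body) ρ rep (forᴸ step xs y₀)
  for-list-spec {xs = xs} le sₓ s₀ s = Spec-weaken unit-factor ℕ.≤-refl (for-list-spec′ {ν = 0} {xs = xs} (poly-loop {B} (length xs) le) sₓ s₀ s)

  for-nat-spec :
    ∀ {C} {Y : ℕ → Set} {rep : ∀ {j} → Y j → ⟦ C ⟧} {e₁ e₂ e₃ t init body m} {y₀ : Y m} {step : ∀ j → Y (suc j) → Dist (Y j)} →
    m ≤ B →
    Det B σ e₁ t ρ m → Det B σ e₂ init ρ (rep y₀) →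
    (∀ j (y : Y (suc j)) j′ st → j < m → Spec B σ e₃ body (j ∷ j′ ∷ rep y ∷ st ∷ ρ) (rep {j}) (step j y)) →
    Spec B σ (2 + (e₁ ⊔ (e₂ ⊔ e₃))) (for-nat t init body) ρ (rep {0}) (forᴺ step m y₀)
  for-nat-spec {rep = rep} {m = m} le sₓ s₀ s =
    Spec-weaken unit-factor ℕ.≤-refl (for-nat-spec′ {rep = rep} {ν = 0} {m = m} (poly-loop {B} m le) sₓ s₀ s)

  for-list-det′ :
    ∀ {A C} {X Y : Set} {repX : X → ⟦ A ⟧} {rep : Y → ⟦ C ⟧} {ν e₁ e₂ e₃ ts init body} {xs : List X} {y₀ : Y} {f : X → Y → Y} →
    10 + 8 * length xs ≤ suc ν * (8 + B) ^ 2 →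
    Det B σ e₁ ts ρ (List.map repX xs) → Det B σ e₂ init ρ (rep y₀) →
    (∀ x rest rest′ y st → x ∈ xs → Det B σ e₃ body (repX x ∷ rest ∷ rest′ ∷ rep y ∷ st ∷ ρ) (rep (f x y))) →
    Spec B (σ + ν * suc σ) (2 + (e₁ ⊔ (e₂ ⊔ e₃))) (for-list ts init body) ρ rep (pure (foldᴸ f xs y₀))
  for-list-det′ {rep = rep} {ν} {xs = xs} {y₀} {f} le sₓ s₀ s =
    Spec-≡ (forᴸ-pure f xs y₀)
      (for-list-spec′ {ν = ν} le sₓ s₀ (λ x r r′ y st x∈ → Spec-rep refl (s x r r′ y st x∈)))

  for-list-det :
    ∀ {A C} {X Y : Set} {repX : X → ⟦ A ⟧} {rep : Y → ⟦ C ⟧} {e₁ e₂ e₃ ts init body} {xs : List X} {y₀ : Y} {f : X → Y → Y} →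
    length xs ≤ B →
    Det B σ e₁ ts ρ (List.map repX xs) → Det B σ e₂ init ρ (rep y₀) →
    (∀ x rest rest′ y st → x ∈ xs → Det B σ e₃ body (repX x ∷ rest ∷ rest′ ∷ rep y ∷ st ∷ ρ) (rep (f x y))) →
    Det B σ (2 + (e₁ ⊔ (e₂ ⊔ e₃))) (for-list ts init body) ρ (rep (foldᴸ f xs y₀))
  for-list-det {rep = rep} {xs = xs} le sₓ s₀ s =
    Spec-det (Spec-weaken unit-factor ℕ.≤-refl (for-list-det′ {rep = rep} {ν = 0} {xs = xs} (poly-loop {B} (length xs) le) sₓ s₀ s))

  for-nat-det :
    ∀ {C} {Y : Set} {rep : Y → ⟦ C ⟧} {e₁ e₂ e₃ t init body m} {y₀ : Y} {f : Y → Y} →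
    m ≤ B →
    Det B σ e₁ t ρ m → Det B σ e₂ init ρ (rep y₀) →
    (∀ j y j′ st → Det B σ e₃ body (j ∷ j′ ∷ rep y ∷ st ∷ ρ) (rep (f y))) →
    Det B σ (2 + (e₁ ⊔ (e₂ ⊔ e₃))) (for-nat t init body) ρ (rep (foldᴺ f m y₀))
  for-nat-det {rep = rep} {m = m} {y₀} {f} le sₓ s₀ s = Spec-det (subst (Spec B σ _ _ ρ rep) (forᴺ-pure f m y₀)
    (for-nat-spec {rep = rep} le sₓ s₀ (λ j y j′ st _ → Spec-rep refl (s j y j′ st))))

sucs : ∀ {Γ} → ℕ → Term Γ nat → Term Γ nat
sucs zero    t = t
sucs (suc c) t = suc′ (sucs c t)

sucs-spec : ∀ {B σ Γ} {ρ : Env Γ} {e t a c} → c ≤ B → Det B σ e t ρ a → Det B σ (suc e) (sucs c t) ρ (c + a)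
sucs-spec {B} {σ} {ρ = ρ} {e} {t} {a} {c} c≤B s .run f b = Sim-weaken le (go c)
  where
  le : c + cost B σ e ≤ cost B σ (suc e)
  le = begin
    c + cost B σ e
      ≤⟨ ℕ.+-monoˡ-≤ (cost B σ e) (ℕ.≤-trans (ℕ.m≤m*n c (cost B σ e) {{ℕ.>-nonZero (1≤cost σ e)}}) (ℕ.*-monoˡ-≤ (cost B σ e) (ℕ.≤-trans c≤B (ℕ.m≤n+m B 7)))) ⟩
    (7 + B) * cost B σ e + cost B σ e ≡⟨ ℕ.+-comm _ (cost B σ e) ⟩
    (8 + B) * cost B σ e ≡⟨ cost-suc σ e ⟨
    cost B σ (suc e) ∎
    where open ℕ.≤-Reasoning
  go : ∀ c → Sim id (c + cost B σ e) (eval f (sucs c t) ρ) (pure (c + a))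
  go zero    = s .run f (ℕ.≤-trans (cost-mono (ℕ.≤-refl {σ}) (ℕ.n≤1+n e)) b)
  go (suc c) = tick (Sim-post-det suc (go c))

-- The program

pattern #0 = here refl
pattern #1 = there #0
pattern #2 = there #1
pattern #3 = there #2
pattern #4 = there #3
pattern #5 = there #4
pattern #6 = there #5
pattern #7 = there #6

monus : ∀ {Γ} → Term Γ nat → Term Γ nat → Term Γ nat
monus s t = for-nat t s (case-nat (var #2) zero′ (var #0))

foldᴺ-pred : ∀ b a → foldᴺ ℕ.pred b a ≡ a ∸ b
foldᴺ-pred zero    a = refl
foldᴺ-pred (suc b) zero    = trans (foldᴺ-pred b 0) (ℕ.0∸n≡0 b)
foldᴺ-pred (suc b) (suc a) = foldᴺ-pred b a

module _ {B σ : ℕ} {Γ : Ctx} {ρ : Env Γ} where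

  monus-spec : ∀ {e₁ e₂ s t a b} → b ≤ B → Det B σ e₁ s ρ a → Det B σ e₂ t ρ b →
               Det B σ _ (monus s t) ρ (a ∸ b)
  monus-spec {a = a} {b} b≤B S T = Det-≡ (foldᴺ-pred b a)
    (for-nat-det {rep = id} b≤B T S λ j y j′ st →
      case-nat-spec {a = y} var-spec (λ eq → Det-≡ (sym (cong ℕ.pred eq)) zero-spec)
                                     (λ a′ eq → Det-≡ (sym (cong ℕ.pred eq)) var-spec))

nth : ∀ {Γ} → Term Γ (list bool) → Term Γ nat → Term Γ bool
nth y v = case-list (for-nat v y (case-list (var #2) nil (var #1))) (bit false) (var #0)

tail : ∀ {A : Set} → List A → List A
tail []       = []
tail (x ∷ xs) = xs

head-or-false : List Bool → Bool
head-or-false []      = false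
head-or-false (b ∷ _) = b

head-foldᴺ-tail : ∀ {n} (y : Vec Bool n) i → head-or-false (foldᴺ tail (toℕ i) (toList y)) ≡ lookup y i
head-foldᴺ-tail (b ∷ y) zero    = refl
head-foldᴺ-tail (b ∷ y) (suc i) = head-foldᴺ-tail y i

==ᵇ-term : ∀ {Γ} → Term Γ bool → Term Γ bool → Term Γ bool
==ᵇ-term s t = if′ s t (if′ t (bit false) (bit true))

_==ᵇ_ : Bool → Bool → Bool
a ==ᵇ b = if a then b else not b

module _ {B σ : ℕ} {Γ : Ctx} {ρ : Env Γ} where

  tail-spec : ∀ {A e} {t : Term Γ (list A)} {as} → Det B σ e t ρ as →
              Det B σ _ (case-list t nil (var #1)) ρ (tail as)
  tail-spec s = case-list-spec s (λ eq → Det-≡ (sym (cong tail eq)) nil-spec)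
                                 (λ a as′ eq → Det-≡ (sym (cong tail eq)) var-spec)

module _ {B σ : ℕ} {Γ : Ctx} {ρ : Env Γ} where

  nth-spec : ∀ {e₁ e₂ s t n} {y : Vec Bool n} {i} → n ≤ B →
             Det B σ e₁ s ρ (toList y) → Det B σ e₂ t ρ (toℕ i) → Det B σ _ (nth s t) ρ (lookup y i)
  nth-spec {y = y} {i} n≤B S T = Det-≡ (head-foldᴺ-tail y i)
    (case-list-spec
      (for-nat-det {rep = id} {f = tail} (ℕ.≤-trans (ℕ.<⇒≤ (toℕ<n i)) n≤B) T S (λ j y j′ st → tail-spec var-spec))
      (λ eq → Det-≡ (sym (cong head-or-false eq)) bit-spec)
      (λ a as′ eq → Det-≡ (sym (cong head-or-false eq)) var-spec))

  ==ᵇ-spec : ∀ {e₁ e₂ s t a b} → Det B σ e₁ s ρ a → Det B σ e₂ t ρ b → Det B σ _ (==ᵇ-term s t) ρ (a ==ᵇ b)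
  ==ᵇ-spec {a = a} {b} S T = if-spec S
    (λ eq → Det-≡ (sym (cong (_==ᵇ b) eq)) T)
    (λ eq → Det-≡ (sym (cong (_==ᵇ b) eq)) (if-spec T (λ eq → Det-≡ (sym (cong not eq)) bit-spec)
                                                      (λ eq → Det-≡ (sym (cong not eq)) bit-spec)))

literal-rep : ∀ {n} → Literal n → Bool × ℕ
literal-rep = map₂ toℕ

clause-rep : ∀ {n} → Clause n → List (Bool × ℕ)
clause-rep = List.map literal-rep

clause-sat : ∀ {Γ} → list bool ∈ Γ → Term Γ (list (bool ⊗ nat)) → Term Γ bool
clause-sat y C = for-list C (bit false)
  (if′ (var #3) (bit true)
    (split (var #0) (==ᵇ-term (nth (var (there (there (there (there (there (there (there y)))))))) (var #1)) (var #0))))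

satᶜ : ∀ {n} → Assignment n → Clause n → Bool
satᶜ y C = foldᴸ (λ (b , i) acc → if acc then true else lookup y i ==ᵇ b) C false

falsified-term : ∀ {Γ} → list bool ∈ Γ → Term Γ (list (list (bool ⊗ nat))) → Term Γ (list (list (bool ⊗ nat)))
falsified-term y F = for-list F nil
  (if′ (clause-sat (there (there (there (there (there y))))) (var #0)) (var #3) (cons (var #0) (var #3)))

falsified : ∀ {n} → Assignment n → CNF n → List (Clause n)
falsified y F = foldᴸ (λ C acc → if satᶜ y C then acc else C ∷ acc) F []

if-true : ∀ {X : Set} {b} {x y : X} → b ≡ true → (if b then x else y) ≡ x
if-true refl = refl

if-false : ∀ {X : Set} {b} {x y : X} → b ≡ false → (if b then x else y) ≡ y
if-false refl = refl

module _ {B σ : ℕ} {Γ : Ctx} {ρ : Env Γ} where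

  clause-sat-spec : ∀ {n e t} {C : Clause n} {y : Assignment n} {v : list bool ∈ Γ} → n ≤ B → length C ≤ B →
    All.lookup ρ v ≡ toList y → Det B σ e t ρ (clause-rep C) →
    Det B σ _ (clause-sat v t) ρ (satᶜ y C)
  clause-sat-spec n≤B C≤B eq T = for-list-det {repX = literal-rep} {rep = id} C≤B T bit-spec λ (b , i) _ _ acc _ _ →
    if-spec {b = acc} var-spec
      (λ a → Det-≡ (sym (if-true a)) bit-spec)
      (λ a → Det-≡ (sym (if-false a)) (split-spec var-spec
        (==ᵇ-spec (nth-spec {i = i} n≤B (Det-≡ eq var-spec) var-spec) var-spec)))

module _ {B σ : ℕ} {Γ : Ctx} {ρ : Env Γ} where

  falsified-spec : ∀ {n e t} {F : CNF n} {y : Assignment n} {v : list bool ∈ Γ} → n ≤ B → length F ≤ B →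
    (∀ {C} → C ∈ F → length C ≤ B) →
    All.lookup ρ v ≡ toList y → Det B σ e t ρ (List.map clause-rep F) →
    Det B σ _ (falsified-term v t) ρ (List.map clause-rep (falsified y F))
  falsified-spec {y = y} n≤B F≤B C≤B eq T = for-list-det {repX = clause-rep} {rep = List.map clause-rep} F≤B T nil-spec λ C _ _ acc _ C∈F →
    if-spec {b = satᶜ y C} (clause-sat-spec n≤B (C≤B C∈F) eq var-spec)
      (λ a → Det-≡ (cong (List.map clause-rep) (sym (if-true a))) var-spec)
      (λ a → Det-≡ (cong (List.map clause-rep) (sym (if-false a))) (cons-spec var-spec var-spec))

-- A zipper: the list before position v is reversed while moving there.
set-at : ∀ {Γ} → Term Γ (list bool) → Term Γ nat → bool ∈ Γ → Term Γ (list bool)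
set-at y v b = split
  (for-nat v (pair nil y)
    (split (var #2) (case-list (var #1) (pair (var #0) nil) (pair (cons (var #0) (var #2)) (var #1)))))
  (case-list (var #1) (var #0)
    (for-list (var #2) (cons (var (there (there (there (there b))))) (var #1)) (cons (var #0) (var #3))))

shift : List Bool × List Bool → List Bool × List Bool
shift (l , [])    = l , []
shift (l , x ∷ r) = x ∷ l , r

replace-head : Bool → List Bool × List Bool → List Bool
replace-head b (l , [])    = l
replace-head b (l , _ ∷ r) = foldᴸ _∷_ l (b ∷ r)

replace-head-shift : ∀ {n} b (y : Assignment n) i l →
  replace-head b (foldᴺ shift (toℕ i) (l , toList y)) ≡ foldᴸ _∷_ l (toList (y Vec.[ i ]≔ b))
replace-head-shift b (x ∷ y) zero    l = refl
replace-head-shift b (x ∷ y) (suc i) l = replace-head-shift b y i (x ∷ l)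

length-shift : ∀ m s → length (proj₁ (foldᴺ shift m s)) ≤ m + length (proj₁ s)
length-shift zero    s = ℕ.≤-refl
length-shift (suc m) (l , [])    = ℕ.m≤n⇒m≤1+n (length-shift m (l , []))
length-shift (suc m) (l , x ∷ r) = ℕ.≤-trans (length-shift m (x ∷ l , r)) (ℕ.≤-reflexive (ℕ.+-suc m (length l)))

module _ {B σ : ℕ} {Γ : Ctx} {ρ : Env Γ} where

  set-at-spec : ∀ {e₁ e₂ s t n} {y : Assignment n} {i} {v : bool ∈ Γ} → n ≤ B →
    Det B σ e₁ s ρ (toList y) → Det B σ e₂ t ρ (toℕ i) →
    Det B σ _ (set-at s t v) ρ (toList (y Vec.[ i ]≔ All.lookup ρ v))
  set-at-spec {y = y} {i} {v} n≤B S T = Det-≡ (replace-head-shift b y i [])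
    (split-spec
      (for-nat-det {rep = id} {f = shift} i≤B T (pair-spec nil-spec S) λ j st j′ _ →
        split-spec var-spec (case-list-spec var-spec
          (λ eq → Det-≡ (sym (cong (λ r → shift (proj₁ st , r)) eq)) (pair-spec var-spec nil-spec))
          (λ x r eq → Det-≡ (sym (cong (λ r → shift (proj₁ st , r)) eq)) (pair-spec (cons-spec var-spec var-spec) var-spec))))
      (case-list-spec var-spec
        (λ eq → Det-≡ (sym (cong (λ r → replace-head b (proj₁ z , r)) eq)) var-spec)
        (λ x r eq → Det-≡ (sym (cong (λ r → replace-head b (proj₁ z , r)) eq))
          (for-list-det {repX = id} {rep = id} z≤B (Det-≡ (sym (map-id (proj₁ z))) var-spec)
            (cons-spec var-spec var-spec) (λ _ _ _ _ _ _ → cons-spec var-spec var-spec)))))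
    where
    b = All.lookup ρ v
    z = foldᴺ shift (toℕ i) ([] , toList y)
    i≤B : toℕ i ≤ B
    i≤B = ℕ.≤-trans (ℕ.<⇒≤ (toℕ<n i)) n≤B
    z≤B : length (proj₁ z) ≤ B
    z≤B = ℕ.≤-trans (length-shift (toℕ i) ([] , toList y)) (ℕ.≤-trans (ℕ.≤-reflexive (ℕ.+-identityʳ (toℕ i))) i≤B)

-- One step of Schöning's walk on the variables beyond position i: a falsified
-- clause is chosen, and the literal at a uniform index of {0,…,κ} is made true;
-- nothing changes if there is no such literal or its variable is frozen.
walk-step-term : ∀ {Γ} → ℕ → list bool ∈ Γ → list (list (bool ⊗ nat)) ∈ Γ → nat ∈ Γ → Term Γ (list bool)
walk-step-term κ y F i =
  case-list (falsified-term y (var F)) (var y)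
    (let′ (draw κ)
      (case-list (for-nat (var #0) (var #1) (case-list (var #2) nil (var #1)))
        (var (↑ (↑ (↑ y))))
        (split (var #0)
          (case-nat (monus (var #1) (var (↑ (↑ (↑ (↑ (↑ (↑ (↑ i)))))))))
            (var (↑ (↑ (↑ (↑ (↑ (↑ (↑ y))))))))
            (set-at (var (↑ (↑ (↑ (↑ (↑ (↑ (↑ (↑ y))))))))) (var #2) #1)))))
  where
  ↑ : ∀ {Γ : Ctx} {A C} → A ∈ Γ → A ∈ C ∷ Γ
  ↑ = there

repair : ∀ {n} → ℕ → Assignment n → Clause n → Assignment n
repair i y []            = y
-- Only variables strictly beyond `i` are free: at `i` itself the cylinder prescribes the bit that
-- differs from the centre.
repair i y ((b , v) ∷ _) = natCase y (λ _ → y Vec.[ v ]≔ b) (toℕ v ∸ i)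

repair-some : ∀ {n} → ℕ → ℕ → Assignment n → List (Clause n) → Dist (Assignment n)
repair-some κ i y []      = pure y
repair-some κ i y (C ∷ _) = draw κ (λ j → pure (repair i y (foldᴺ tail (toℕ j) C)))

walk-step : ∀ {n} → ℕ → CNF n → ℕ → Assignment n → Dist (Assignment n)
walk-step κ F i y = repair-some κ i y (falsified y F)

map-foldᴺ-tail : ∀ {X Y : Set} (f : X → Y) m xs → List.map f (foldᴺ tail m xs) ≡ foldᴺ tail m (List.map f xs)
map-foldᴺ-tail f zero    xs       = refl
map-foldᴺ-tail f (suc m) []       = map-foldᴺ-tail f m []
map-foldᴺ-tail f (suc m) (x ∷ xs) = map-foldᴺ-tail f m xs

module _ {B σ : ℕ} {Γ : Ctx} {ρ : Env Γ} where

  walk-step-spec : ∀ {n κ} {F : CNF n} {y : Assignment n} {v : list bool ∈ Γ} {f : list (list (bool ⊗ nat)) ∈ Γ} {i : nat ∈ Γ} →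
    n ≤ B → κ ≤ B → length F ≤ B → (∀ {C} → C ∈ F → length C ≤ B) → All.lookup ρ i ≤ B →
    All.lookup ρ v ≡ toList y → All.lookup ρ f ≡ List.map clause-rep F →
    Spec B σ _ (walk-step-term κ v f i) ρ toList (walk-step κ F (All.lookup ρ i) y)
  walk-step-spec {κ = κ} {F} {y} {i = i} n≤B κ≤B F≤B C≤B i≤B eq eqF =
    case-list-elim (repair-some κ (All.lookup ρ i) y) (falsified-spec n≤B F≤B C≤B eq (Det-≡ eqF var-spec))
      (Spec-rep eq var-spec)
      (λ C Cs → let-bind draw-spec (λ j →
        case-list-elim {repX = literal-rep} (λ C′ → pure (repair (All.lookup ρ i) y C′))
          (Det-≡ (sym (map-foldᴺ-tail literal-rep (toℕ j) C))
            (for-nat-det {rep = id} {f = tail} (ℕ.≤-trans (ℕ.<⇒≤pred (toℕ<n j)) κ≤B) var-spec var-spec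
              (λ _ _ _ _ → tail-spec var-spec)))
          (Spec-rep eq var-spec)
          (λ (b , u) _ → split-spec var-spec
            (case-nat-elim (λ a → pure (natCase y (λ _ → y Vec.[ u ]≔ b) a))
              (monus-spec i≤B var-spec var-spec)
              (Spec-rep eq var-spec)
              (λ _ → Spec-rep refl (set-at-spec {i = u} n≤B (Det-≡ eq var-spec) var-spec))))))

-- The frozen prefix is copied from c up to position i - 1 and flipped at
-- position i, where ι = i + 1 counts down; each later bit is flipped with
-- probability 1/2 or 1/5.
flip-range : Bool → ℕ
flip-range true  = 1
flip-range false = 4

flip-draw : ∀ {Γ} → bool ∈ Γ → Term Γ nat
flip-draw mode = if′ (var mode) (draw 1) (draw 4)

not-term : ∀ {Γ} → Term Γ bool → Term Γ bool
not-term t = if′ t (bit false) (bit true)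

sample-term : ∀ {Γ} → bool ∈ Γ → list bool ∈ Γ → Term Γ nat → Term Γ (list bool)
sample-term mode c ι = split
  (for-list (var c) (pair ι nil)
    (split (var #3)
      (case-nat (var #0)
        (case-nat (flip-draw (↑ (↑ (↑ (↑ (↑ (↑ (↑ mode))))))))
          (pair zero′ (cons (not-term (var #2)) (var #1)))
          (pair zero′ (cons (var #3) (var #2))))
        (case-nat (var #0)
          (pair zero′ (cons (not-term (var #3)) (var #2)))
          (pair (suc′ (var #0)) (cons (var #4) (var #3)))))))
  (for-list (var #1) nil (cons (var #0) (var #3)))
  where
  ↑ : ∀ {Γ : Ctx} {A C} → A ∈ Γ → A ∈ C ∷ Γ
  ↑ = there

flipped : ∀ {m} → Fin m → Bool → Bool
flipped zero    b = not b
flipped (suc _) b = b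

randomize : ∀ {n} → ℕ → Assignment n → Dist (Assignment n)
randomize m []      = pure []
randomize m (b ∷ c) = draw m (λ i → mapᴰ (flipped i b ∷_) (randomize m c))

sample : ∀ {n} → ℕ → Assignment n → ℕ → Dist (Assignment n)
sample m []      _       = pure []
sample m (b ∷ c) zero    = mapᴰ (not b ∷_) (randomize m c)
sample m (b ∷ c) (suc i) = mapᴰ (b ∷_) (sample m c i)

sample-step : ℕ → Bool → ℕ × List Bool → Dist (ℕ × List Bool)
sample-step m b (zero        , out) = draw m (λ i → pure (0 , flipped i b ∷ out))
sample-step m b (suc zero    , out) = pure (0 , not b ∷ out)
sample-step m b (suc (suc j) , out) = pure (suc j , b ∷ out)

randomize-image : ∀ {n} m (c : Assignment n) out →
  Image (λ y → 0 , foldᴸ _∷_ (toList y) out) (forᴸ (sample-step m) (toList c) (0 , out)) (randomize m c)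
randomize-image m []      out = pure refl
randomize-image m (b ∷ c) out =
  draw (λ i → Image-map (λ _ → refl) (randomize-image m c (flipped i b ∷ out)))

-- The loop collects the bits in reverse order, which a second loop undoes. Its counter ends at
-- `suc i ∸ n`, which is positive if the whole centre has been copied.
sample-image : ∀ {n} m (c : Assignment n) i out →
  Image (λ y → suc i ∸ n , foldᴸ _∷_ (toList y) out) (forᴸ (sample-step m) (toList c) (suc i , out)) (sample m c i)
sample-image m []      i       out = pure refl
sample-image {suc n} m (b ∷ c) zero out = Image-map (λ y → cong (_, foldᴸ _∷_ (toList y) (not b ∷ out)) (ℕ.0∸n≡0 n)) (randomize-image m c (not b ∷ out))
sample-image m (b ∷ c) (suc i) out = Image-map (λ _ → refl) (sample-image m c i (b ∷ out))

foldᴸ-∷-foldᴸ-∷ : ∀ {X : Set} (xs : List X) {ys zs} → foldᴸ _∷_ (foldᴸ _∷_ xs ys) zs ≡ foldᴸ _∷_ ys (xs List.++ zs)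
foldᴸ-∷-foldᴸ-∷ []       = refl
foldᴸ-∷-foldᴸ-∷ (x ∷ xs) = foldᴸ-∷-foldᴸ-∷ xs

length-foldᴸ-∷ : ∀ {X : Set} (xs ys : List X) → length (foldᴸ _∷_ xs ys) ≡ length xs + length ys
length-foldᴸ-∷ []       ys = refl
length-foldᴸ-∷ (x ∷ xs) ys = trans (length-foldᴸ-∷ xs (x ∷ ys)) (ℕ.+-suc (length xs) (length ys))

module _ {B σ : ℕ} {Γ : Ctx} {ρ : Env Γ} where

  not-spec : ∀ {e t b} → Det B σ e t ρ b → Det B σ _ (not-term t) ρ (not b)
  not-spec s = if-spec s (λ eq → Det-≡ (sym (cong not eq)) bit-spec) (λ eq → Det-≡ (sym (cong not eq)) bit-spec)

  flip-draw-spec : ∀ {v : bool ∈ Γ} {b} → All.lookup ρ v ≡ b → Spec B σ 1 (flip-draw v) ρ toℕ (draw (flip-range b) pure)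
  flip-draw-spec {b = true}  eq = if-spec {e₃ = 0} (Det-≡ eq var-spec) (λ _ → draw-spec) (λ ())
  flip-draw-spec {b = false} eq = if-spec {e₂ = 0} (Det-≡ eq var-spec) (λ ()) (λ _ → draw-spec)

module _ {B σ : ℕ} {Γ : Ctx} {ρ : Env Γ} where

  sample-spec : ∀ {n e t} {c : Assignment n} {u : bool ∈ Γ} {v : list bool ∈ Γ} {i} → n ≤ B →
    All.lookup ρ v ≡ toList c → Det B σ e t ρ (suc i) →
    Spec B σ _ (sample-term u v t) ρ toList (sample (flip-range (All.lookup ρ u)) c i)
  sample-spec {n} {c = c} {u} {i = i} n≤B eq T = Spec-image
    (split-bind {rep = λ y → suc i ∸ n , foldᴸ _∷_ (toList y) []}
      (Spec-image
        (for-list-spec {repX = id} {rep = id} {step = sample-step m} (ℕ.≤-trans (ℕ.≤-reflexive (length-toList c)) n≤B)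
          (Det-≡ (trans eq (sym (map-id (toList c)))) var-spec)
          (pair-spec T nil-spec)
          (λ b _ _ (ι , out) st _ → split-spec var-spec
            (case-nat-elim (λ ι → sample-step m b (ι , out)) var-spec
              (case-nat-bind (flip-draw-spec refl)
                (pair-spec zero-spec (cons-spec (not-spec var-spec) var-spec))
                (λ _ → pair-spec zero-spec (cons-spec var-spec var-spec)))
              (λ j → case-nat-elim (λ j → sample-step m b (suc j , out)) var-spec
                (pair-spec zero-spec (cons-spec (not-spec var-spec) var-spec))
                (λ _ → pair-spec (suc-spec var-spec) (cons-spec var-spec var-spec))))))
        (sample-image m c i []))
      (λ y → Spec-rep (trans (foldᴸ-∷-foldᴸ-∷ (toList y)) (++-identityʳ (toList y)))
        (for-list-det {repX = id} {rep = id} {f = _∷_}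
          (ℕ.≤-trans (ℕ.≤-reflexive (trans (length-foldᴸ-∷ (toList y) []) (trans (ℕ.+-identityʳ _) (length-toList y)))) n≤B)
          (Det-≡ (sym (map-id (foldᴸ _∷_ (toList y) []))) var-spec) nil-spec
          (λ _ _ _ _ _ _ → cons-spec var-spec var-spec))))
    (Image-bind-pure (sample m c i))
    where
    m = flip-range (All.lookup ρ u)

weight-term : ∀ {Γ} → list bool ∈ Γ → Term Γ nat
weight-term z = for-list (var z) zero′ (if′ (var #0) (suc′ (var #3)) (var #3))

foldᴸ-weight : ∀ {n} (z : Assignment n) a → foldᴸ (λ b a → if b then suc a else a) (toList z) a ≡ a + ∣ z ∣
foldᴸ-weight []          a = sym (ℕ.+-identityʳ a)
foldᴸ-weight (true  ∷ z) a = trans (foldᴸ-weight z (suc a)) (sym (ℕ.+-suc a ∣ z ∣))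
foldᴸ-weight (false ∷ z) a = foldᴸ-weight z a

distance-term : ∀ {Γ} → list bool ∈ Γ → list bool ∈ Γ → Term Γ nat
distance-term z p = split
  (for-list (var z) (pair (var p) zero′)
    (split (var #3) (case-list (var #0) (pair nil (var #1))
      (pair (var #1) (if′ (==ᵇ-term (var #4) (var #0)) (var #3) (suc′ (var #3)))))))
  (var #1)

distance-step : Bool → List Bool × ℕ → List Bool × ℕ
distance-step x ([]    , a) = [] , a
distance-step x (y ∷ r , a) = r , (if x ==ᵇ y then a else suc a)

foldᴸ-distance : ∀ {n} (z p : Assignment n) a →
                 proj₂ (foldᴸ distance-step (toList z) (toList p , a)) ≡ a + dH z p
foldᴸ-distance []          []          a = sym (ℕ.+-identityʳ a)
foldᴸ-distance (true  ∷ z) (true  ∷ p) a = foldᴸ-distance z p a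
foldᴸ-distance (true  ∷ z) (false ∷ p) a = trans (foldᴸ-distance z p (suc a)) (sym (ℕ.+-suc a (dH z p)))
foldᴸ-distance (false ∷ z) (true  ∷ p) a = trans (foldᴸ-distance z p (suc a)) (sym (ℕ.+-suc a (dH z p)))
foldᴸ-distance (false ∷ z) (false ∷ p) a = foldᴸ-distance z p a

score-term : ∀ {Γ} → list bool ∈ Γ → list (list bool) ∈ Γ → nat ∈ Γ → Term Γ nat
score-term z S n = for-list (var S) (var n)
  (let′ (distance-term (there (there (there (there (there z))))) #0)
    (case-nat (monus (var #4) (var #0)) (var #4) (var #1)))

score : ∀ {n} → Assignment n → List (Assignment n) → ℕ
score {n} z S = foldᴸ (λ p a → a ⊓ dH z p) S n

add-multiple : ∀ {Γ} → ℕ → Term Γ nat → Term Γ nat → Term Γ nat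
add-multiple c x a = for-nat x a (sucs c (var #2))

foldᴺ-+ : ∀ c x a → foldᴺ (c +_) x a ≡ x * c + a
foldᴺ-+ c zero    a = refl
foldᴺ-+ c (suc x) a = trans (foldᴺ-+ c x (c + a)) (eq c x a)
  where
  eq : ∀ c x a → x * c + (c + a) ≡ c + x * c + a
  eq = ℕ-Solver.solve-∀

module _ {B σ : ℕ} {Γ : Ctx} {ρ : Env Γ} where

  weight-spec : ∀ {n} {z : Assignment n} {v : list bool ∈ Γ} → n ≤ B → All.lookup ρ v ≡ toList z →
                Det B σ _ (weight-term v) ρ ∣ z ∣
  weight-spec {z = z} n≤B eq = Det-≡ (foldᴸ-weight z 0)
    (for-list-det {repX = id} {rep = id} (ℕ.≤-trans (ℕ.≤-reflexive (length-toList z)) n≤B)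
      (Det-≡ (trans eq (sym (map-id (toList z)))) var-spec) zero-spec
      (λ b _ _ a _ _ → if-spec {b = b} var-spec
        (λ eq → Det-≡ (sym (if-true eq)) (suc-spec var-spec)) (λ eq → Det-≡ (sym (if-false eq)) var-spec)))

  distance-spec : ∀ {n} {z p : Assignment n} {v w : list bool ∈ Γ} → n ≤ B →
                  All.lookup ρ v ≡ toList z → All.lookup ρ w ≡ toList p →
                  Det B σ _ (distance-term v w) ρ (dH z p)
  distance-spec {z = z} {p} n≤B eq eq′ = Det-≡ (foldᴸ-distance z p 0)
    (split-spec
      (for-list-det {repX = id} {rep = id} {f = distance-step} (ℕ.≤-trans (ℕ.≤-reflexive (length-toList z)) n≤B)
        (Det-≡ (trans eq (sym (map-id (toList z)))) var-spec) (pair-spec (Det-≡ eq′ var-spec) zero-spec)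
        (λ x _ _ (r , a) _ _ → split-spec var-spec
          (case-list-spec var-spec
            (λ eq → Det-≡ (sym (cong (λ r → distance-step x (r , a)) eq)) (pair-spec nil-spec var-spec))
            (λ y r eq → Det-≡ (sym (cong (λ r → distance-step x (r , a)) eq))
              (pair-spec var-spec (if-spec (==ᵇ-spec var-spec var-spec)
                (λ eq → Det-≡ (sym (if-true eq)) var-spec)
                (λ eq → Det-≡ (sym (if-false eq)) (suc-spec var-spec))))))))
      var-spec)

  add-multiple-spec : ∀ {e₁ e₂ c t u x a} → c ≤ B → x ≤ B → Det B σ e₁ t ρ x → Det B σ e₂ u ρ a →
                      Det B σ _ (add-multiple c t u) ρ (x * c + a)
  add-multiple-spec {c = c} {x = x} {a} c≤B x≤B T U = Det-≡ (foldᴺ-+ c x a)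
    (for-nat-det {rep = id} x≤B T U (λ _ _ _ _ → sucs-spec c≤B var-spec))

dH≤n : ∀ {n} (z p : Assignment n) → dH z p ≤ n
dH≤n z p = ∣p∣≤n (Vec.zipWith _xor_ z p)

module _ {B : ℕ} {Γ : Ctx} {ρ : Env Γ} where

  score-spec : ∀ {n s} {z : Assignment n} {S : List (Assignment n)} {v : list bool ∈ Γ} {w : list (list bool) ∈ Γ} {m : nat ∈ Γ} →
               n ≤ B → length S ≤ s → All.lookup ρ v ≡ toList z → All.lookup ρ w ≡ List.map toList S →
               All.lookup ρ m ≡ n → Det B s _ (score-term v w m) ρ (score z S)
  score-spec {s = s} {z} {S} n≤B S≤s eq eq′ eqn = Spec-weaken (ℕ.≤-reflexive (ℕ.*-identityʳ s)) ℕ.≤-refl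
    (for-list-det′ {σ = 0} {repX = toList} {rep = id} {ν = s} {f = λ p a → a ⊓ dH z p} (long-loop {B} S≤s) (Det-≡ eq′ var-spec) (Det-≡ eqn var-spec)
      (λ p _ _ a _ _ → let-spec (distance-spec {z = z} {p} n≤B eq refl)
        (case-nat-spec (monus-spec (ℕ.≤-trans (dH≤n z p) n≤B) var-spec var-spec)
          (λ a∸d≡0 → Det-≡ (sym (ℕ.m≤n⇒m⊓n≡m (ℕ.m∸n≡0⇒m≤n a∸d≡0))) var-spec)
          (λ x a∸d≡1+x → Det-≡ (sym (ℕ.m≥n⇒m⊓n≡n (ℕ.<⇒≤ (ℕ.m∸n≢0⇒n<m (λ eq → ℕ.0≢1+n (trans (sym eq) a∸d≡1+x)))))) var-spec))))

-- Literals are drawn at an index of {0,…,literal-range}; a walk has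
-- n * walk-rate steps; the number of trials starts from n * trial-rate and is
-- multiplied n times by about growth / k.  An assignment of weight w is
-- admitted if β W + α w ≤ ζ W + γ w.
record Params : Set where
  field
    literal-range walk-rate trial-rate growth α β γ ζ : ℕ

open Params

↑ : ∀ {Γ : Ctx} {A C} → A ∈ Γ → A ∈ C ∷ Γ
↑ = there

↑⁴ : ∀ {Γ : Ctx} {A C₁ C₂ C₃ C₄} → A ∈ Γ → A ∈ C₁ ∷ C₂ ∷ C₃ ∷ C₄ ∷ Γ
↑⁴ x = there (there (there (there x)))

best-type : Ty
best-type = nat ⊗ list bool

Best : ℕ → Set
Best n = ℕ × Assignment n

best-rep : ∀ {n} → Best n → ⟦ best-type ⟧
best-rep = map₂ toList

update-term : ∀ {Γ} → Params → list bool ∈ Γ → list (list (bool ⊗ nat)) ∈ Γ → nat ∈ Γ → nat ∈ Γ →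
              list (list bool) ∈ Γ → best-type ∈ Γ → Term Γ best-type
update-term P z F W n S best =
  case-list (falsified-term z (var F))
    (let′ (weight-term z)
      (case-nat (monus (add-multiple (P .β) (var (↑ W)) (add-multiple (P .α) (var #0) zero′))
                       (add-multiple (P .ζ) (var (↑ W)) (add-multiple (P .γ) (var #0) zero′)))
        (let′ (score-term (↑ z) (↑ S) (↑ n))
          (split (var (↑ (↑ best)))
            (case-nat (monus (suc′ (var #0)) (var #2))
              (pair (var #2) (var (↑⁴ z)))
              (var (↑ (↑⁴ best))))))
        (var (↑ (↑ best)))))
    (var (↑ (↑ best)))

excess : Params → ℕ → ℕ → ℕ
excess P W w = (W * P .β + (w * P .α + 0)) ∸ (W * P .ζ + (w * P .γ + 0))

-- The incumbent yields only to a strictly larger score. An element of `S` has score 0 and is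
-- therefore never taken.
challenge : ∀ {n} → List (Assignment n) → Best n → Assignment n → Best n
challenge S best z = natCase (score z S , z) (λ _ → best) (suc (proj₁ best) ∸ score z S)

update : ∀ {n} → Params → CNF n → ℕ → List (Assignment n) → Best n → Assignment n → Best n
update P F W S best z =
  listCase (natCase (challenge S best z) (λ _ → best) (excess P W ∣ z ∣)) (λ _ _ → best) (falsified z F)

trial-term : ∀ {Γ} → Params → list (list (bool ⊗ nat)) ∈ Γ → nat ∈ Γ → nat ∈ Γ → nat ∈ Γ →
             list (list bool) ∈ Γ → list bool ∈ Γ → nat ∈ Γ → best-type ∈ Γ → Term Γ best-type
trial-term P F W n T S c i best =
  let′ (case-nat (draw 1) (bit true) (bit false))
    (let′ (sample-term #0 (↑ c) (suc′ (var (↑ i))))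
      (let′ (for-nat (var (↑ (↑ T))) (var #0) (walk-step-term (P .literal-range) #2 (↑⁴ (↑ (↑ F))) (↑⁴ (↑ (↑ i)))))
        (update-term P #0 (↑ (↑ (↑ F))) (↑ (↑ (↑ W))) (↑ (↑ (↑ n))) (↑ (↑ (↑ S))) (↑ (↑ (↑ best))))))

walk : ∀ {n} → ℕ → CNF n → ℕ → ℕ → Assignment n → Dist (Assignment n)
walk κ F i = forᴺ (λ _ → walk-step κ F i)

coin-side : Fin 2 → Dist Bool
coin-side zero    = pure true
coin-side (suc _) = pure false

fair-coin : Dist Bool
fair-coin = draw 1 coin-side

trial : ∀ {n} → Params → CNF n → ℕ → ℕ → List (Assignment n) → Assignment n → ℕ → Best n → Dist (Best n)
trial P F W T S c i best =
  bind fair-coin λ mode → bind (sample (flip-range mode) c i) λ y →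
    bind (walk (P .literal-range) F i T y) λ z → pure (update P F W S best z)

mode-candidate : ∀ {n} → ℕ → CNF n → ℕ → Assignment n → ℕ → Bool → Dist (Assignment n)
mode-candidate κ F T c i mode = bind (sample (flip-range mode) c i) (walk κ F i T)

candidate : ∀ {n} → ℕ → CNF n → ℕ → Assignment n → ℕ → Dist (Assignment n)
candidate κ F T c i = bind fair-coin (mode-candidate κ F T c i)

record Bounds (B : ℕ) (P : Params) {n} (F : CNF n) (W T : ℕ) : Set where
  field
    1+n≤ : suc n ≤ B
    κ≤   : P .literal-range ≤ B
    α≤   : P .α ≤ B
    β≤   : P .β ≤ B
    γ≤   : P .γ ≤ B
    ζ≤   : P .ζ ≤ B
    W≤   : W ≤ B
    T≤   : T ≤ B
    F≤   : length F ≤ B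
    C≤   : ∀ {C} → C ∈ F → length C ≤ B
    lin≤ : ∀ {w} → w ≤ n → W * P .ζ + (w * P .γ + 0) ≤ B
  n≤ : n ≤ B
  n≤ = ℕ.<⇒≤ 1+n≤

foldᴸ-min≤ : ∀ {X : Set} (f : X → ℕ) xs a → foldᴸ (λ x a → a ⊓ f x) xs a ≤ a
foldᴸ-min≤ f []       a = ℕ.≤-refl
foldᴸ-min≤ f (x ∷ xs) a = ℕ.≤-trans (foldᴸ-min≤ f xs (a ⊓ f x)) (ℕ.m⊓n≤m a (f x))

score≤n : ∀ {n} (z : Assignment n) S → score z S ≤ n
score≤n z S = foldᴸ-min≤ (dH z) S _

module _ {B : ℕ} {P : Params} {n : ℕ} {F : CNF n} {W T : ℕ} (bounds : Bounds B P F W T) where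

  open Bounds bounds

  module _ {Γ : Ctx} {ρ : Env Γ} where

    update-spec : ∀ {s z S best} {z′ : list bool ∈ Γ} {F′ : list (list (bool ⊗ nat)) ∈ Γ} {W′ n′ : nat ∈ Γ}
      {S′ : list (list bool) ∈ Γ} {best′ : best-type ∈ Γ} → length S ≤ s →
      All.lookup ρ z′ ≡ toList z → All.lookup ρ F′ ≡ List.map clause-rep F → All.lookup ρ W′ ≡ W →
      All.lookup ρ n′ ≡ n → All.lookup ρ S′ ≡ List.map toList S → All.lookup ρ best′ ≡ best-rep best →
      Spec B s _ (update-term P z′ F′ W′ n′ S′ best′) ρ best-rep (pure (update P F W S best z))
    update-spec {z = z} {S} {best} S≤s eqz eqF eqW eqn eqS eqb =
      case-list-elim {repX = clause-rep} (λ Cs → pure (listCase (natCase (challenge S best z) (λ _ → best) (excess P W ∣ z ∣)) (λ _ _ → best) Cs))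
        (falsified-spec {y = z} n≤ F≤ C≤ eqz (Det-≡ eqF var-spec))
        (let-spec (weight-spec {z = z} n≤ eqz)
          (case-nat-elim (λ x → pure (natCase (challenge S best z) (λ _ → best) x))
            (monus-spec (lin≤ (∣p∣≤n z))
              (add-multiple-spec β≤ W≤ (Det-≡ eqW var-spec) (add-multiple-spec α≤ (ℕ.≤-trans (∣p∣≤n z) n≤) var-spec zero-spec))
              (add-multiple-spec ζ≤ W≤ (Det-≡ eqW var-spec) (add-multiple-spec γ≤ (ℕ.≤-trans (∣p∣≤n z) n≤) var-spec zero-spec)))
            (let-spec (score-spec {z = z} {S} n≤ S≤s eqz eqS eqn)
              (split-spec (Det-≡ eqb var-spec)
                (case-nat-elim (λ x → pure (natCase (score z S , z) (λ _ → best) x))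
                  (monus-spec (ℕ.≤-trans (score≤n z S) n≤) (suc-spec var-spec) var-spec)
                  (Spec-rep refl (pair-spec var-spec (Det-≡ eqz var-spec)))
                  (λ _ → Spec-rep eqb var-spec))))
            (λ _ → Spec-rep eqb var-spec)))
        (λ _ _ → Spec-rep eqb var-spec)

  module _ {Γ : Ctx} {ρ : Env Γ} where

    trial-spec : ∀ {s S c best} {F′ : list (list (bool ⊗ nat)) ∈ Γ} {W′ n′ T′ : nat ∈ Γ}
      {S′ : list (list bool) ∈ Γ} {c′ : list bool ∈ Γ} {i : nat ∈ Γ} {best′ : best-type ∈ Γ} → length S ≤ s → All.lookup ρ i ≤ n →
      All.lookup ρ F′ ≡ List.map clause-rep F → All.lookup ρ W′ ≡ W → All.lookup ρ n′ ≡ n → All.lookup ρ T′ ≡ T →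
      All.lookup ρ S′ ≡ List.map toList S → All.lookup ρ c′ ≡ toList c → All.lookup ρ best′ ≡ best-rep best →
      Spec B s _ (trial-term P F′ W′ n′ T′ S′ c′ i best′) ρ best-rep (trial P F W T S c (All.lookup ρ i) best)
    trial-spec {S = S} {c} {best} {i = i} S≤s i≤n eqF eqW eqn eqT eqS eqc eqb =
      let-bind (case-nat-bind {g = coin-side} draw-spec bit-spec (λ _ → bit-spec)) λ mode →
        let-bind (sample-spec {c = c} n≤ eqc (suc-spec var-spec)) λ y →
          let-bind (for-nat-spec {Y = λ _ → Assignment n} {rep = toList}
                     {step = λ _ → walk-step (P .literal-range) F (All.lookup ρ i)} T≤ (Det-≡ eqT var-spec) var-spec
                     (λ _ y _ _ _ → walk-step-spec {y = y} n≤ κ≤ F≤ C≤ (ℕ.≤-trans i≤n n≤) refl eqF)) λ z →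
            update-spec {z = z} {S} {best} S≤s refl eqF eqW eqn eqS eqb

search-term : ∀ {Γ} → Params → list (list (bool ⊗ nat)) ∈ Γ → nat ∈ Γ → nat ∈ Γ → nat ∈ Γ → nat ∈ Γ →
              list bool ∈ Γ → list (list bool) ∈ Γ → Term Γ best-type
search-term P F W n T M zeros S =
  for-list (cons (var zeros) (var S)) (pair zero′ (var zeros))
    (for-nat (suc′ (var (↑⁵ n))) (var #3)
      (for-nat (var (↑⁴ (↑⁵ n))) (var #2)
        (for-nat (var (↑⁴ (↑⁴ (↑⁵ M)))) (var #2)
          (trial-term P (↑¹⁷ F) (↑¹⁷ W) (↑¹⁷ n) (↑¹⁷ T) (↑¹⁷ S) (↑⁴ (↑⁴ (↑⁴ #0))) (↑⁴ (↑⁴ #0)) #2))))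
  where
  ↑⁵ : ∀ {Γ : Ctx} {A C₁ C₂ C₃ C₄ C₅} → A ∈ Γ → A ∈ C₁ ∷ C₂ ∷ C₃ ∷ C₄ ∷ C₅ ∷ Γ
  ↑⁵ x = ↑ (↑⁴ x)
  ↑¹⁷ : ∀ {Γ : Ctx} {A C₁ C₂ C₃ C₄ C₅ C₆ C₇ C₈ C₉ D₁ D₂ D₃ D₄ D₅ D₆ D₇ D₈} → A ∈ Γ →
        A ∈ C₁ ∷ C₂ ∷ C₃ ∷ C₄ ∷ C₅ ∷ C₆ ∷ C₇ ∷ C₈ ∷ C₉ ∷ D₁ ∷ D₂ ∷ D₃ ∷ D₄ ∷ D₅ ∷ D₆ ∷ D₇ ∷ D₈ ∷ Γ
  ↑¹⁷ x = ↑⁴ (↑⁴ (↑⁴ (↑⁵ x)))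

zeros : ∀ n → Assignment n
zeros n = Vec.replicate n false

repeat : ∀ {Y : Set} → (Y → Dist Y) → ℕ → Y → Dist Y
repeat f = forᴺ (λ _ → f)

search : ∀ {n} → Params → CNF n → ℕ → ℕ → ℕ → List (Assignment n) → Dist (Best n)
search {n} P F W T M S =
  forᴸ (λ c → forᴺ {λ _ → Best n} (λ i → repeat (repeat (trial P F W T S c i) M) n) (suc n))
       (zeros n ∷ S) (0 , zeros n)

round-term : ∀ {Γ} → Params → list (list (bool ⊗ nat)) ∈ Γ → nat ∈ Γ → nat ∈ Γ → nat ∈ Γ → nat ∈ Γ →
             list bool ∈ Γ → list (list bool) ∈ Γ → Term Γ (list (list bool))
round-term P F W n T M zeros S = split (search-term P F W n T M zeros S) (cons (var #1) (var (↑ (↑ S))))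

-- Its successor is `(2 + s) (1 + M) (1 + s)`: one factor each for the centres, the trials and the
-- comparison with `S`.
search-σ : ℕ → ℕ → ℕ
search-σ s M = s + M * suc s + suc s * suc (s + M * suc s)

module _ {B : ℕ} {P : Params} {n : ℕ} {F : CNF n} {W T : ℕ} (bounds : Bounds B P F W T) where

  open Bounds bounds

  module _ {Γ : Ctx} {ρ : Env Γ} where

    search-spec : ∀ {s M S} {F′ : list (list (bool ⊗ nat)) ∈ Γ} {W′ n′ T′ M′ : nat ∈ Γ} {z′ : list bool ∈ Γ}
      {S′ : list (list bool) ∈ Γ} → length S ≤ s →
      All.lookup ρ F′ ≡ List.map clause-rep F → All.lookup ρ W′ ≡ W → All.lookup ρ n′ ≡ n → All.lookup ρ T′ ≡ T →
      All.lookup ρ M′ ≡ M → All.lookup ρ z′ ≡ toList (zeros n) → All.lookup ρ S′ ≡ List.map toList S →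
      Spec B (search-σ s M) _ (search-term P F′ W′ n′ T′ M′ z′ S′) ρ best-rep (search P F W T M S)
    search-spec {s} {M} {S} S≤s eqF eqW eqn eqT eqM eqz eqS =
      for-list-spec′ {repX = toList} {rep = best-rep} {ν = suc s} {xs = zeros n ∷ S} (long-loop {B} (s≤s S≤s))
        (cons-spec (Det-≡ eqz var-spec) (Det-≡ eqS var-spec)) (pair-spec zero-spec (Det-≡ eqz var-spec))
        λ c _ _ _ _ _ →
          for-nat-spec {rep = best-rep} {step = λ i → repeat (repeat (trial P F W T S c i) M) n} 1+n≤ (suc-spec (Det-≡ eqn var-spec)) var-spec λ i _ _ _ i≤n →
            for-nat-spec {rep = best-rep} {step = λ _ → repeat (trial P F W T S c i) M} n≤ (Det-≡ eqn var-spec) var-spec λ _ _ _ _ _ →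
              for-nat-spec′ {rep = best-rep} {ν = M} {step = λ _ → trial P F W T S c i} (long-loop {B} {M} ℕ.≤-refl) (Det-≡ eqM var-spec) var-spec λ _ best _ _ _ →
                trial-spec bounds {S = S} {c} {best} S≤s (ℕ.≤-pred i≤n) eqF eqW eqn eqT eqS refl refl

-- ⌊x / (κ + 1)⌋ + 1 times a, by counting down from κ repeatedly.
grow-term : ∀ {Γ} → ℕ → ℕ → Term Γ nat → Term Γ nat
grow-term κ a x = split
  (for-nat x (pair (sucs κ zero′) (sucs a zero′))
    (split (var #2)
      (case-nat (var #0) (pair (sucs κ zero′) (sucs a (var #1))) (pair (var #0) (var #2)))))
  (var #1)

grow-step : ℕ → ℕ → ℕ × ℕ → ℕ × ℕ
grow-step κ a (zero  , x) = κ , a + x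
grow-step κ a (suc c , x) = c , x

grow : ℕ → ℕ → ℕ → ℕ
grow κ a x = proj₂ (foldᴺ (grow-step κ a) x (κ , a))

foldᴺ-suc : ∀ {Y : Set} (f : Y → Y) m y → foldᴺ f (suc m) y ≡ f (foldᴺ f m y)
foldᴺ-suc f zero    y = refl
foldᴺ-suc f (suc m) y = foldᴺ-suc f m (f y)

-- (κ + 1) x′ = a (t + c + 1) holds along the loop after t steps.
grow-invariant : ∀ κ a x → let (c , x′) = foldᴺ (grow-step κ a) x (κ , a) in
                 c ≤ κ × suc κ * x′ ≡ a * (x + suc c)
grow-invariant κ a zero = ℕ.≤-refl , ℕ.*-comm (suc κ) a
grow-invariant κ a (suc x) rewrite foldᴺ-suc (grow-step κ a) x (κ , a)
  with foldᴺ (grow-step κ a) x (κ , a) | grow-invariant κ a x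
... | zero  , x′ | _   , eq = ℕ.≤-refl , trans (ℕ.*-distribˡ-+ (suc κ) a x′) (trans (cong (suc κ * a +_) eq) (ring κ a x))
  where
  ring : ∀ κ a x → suc κ * a + a * (x + 1) ≡ a * (suc x + suc κ)
  ring = ℕ-Solver.solve-∀
... | suc c , x′ | c<κ , eq = ℕ.<⇒≤ c<κ , trans eq (cong (a *_) (ℕ.+-suc x (suc c)))

grow-lower : ∀ κ a x → a * x ≤ suc κ * grow κ a x
grow-lower κ a x = ℕ.≤-trans (ℕ.*-monoʳ-≤ a (ℕ.m≤m+n x _)) (ℕ.≤-reflexive (sym (proj₂ (grow-invariant κ a x))))

grow-upper : ∀ κ a x → suc κ * grow κ a x ≤ a * (x + suc κ)
grow-upper κ a x = ℕ.≤-trans (ℕ.≤-reflexive (proj₂ (grow-invariant κ a x)))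
                             (ℕ.*-monoʳ-≤ a (ℕ.+-monoʳ-≤ x (s≤s (proj₁ (grow-invariant κ a x)))))

grow-≥ : ∀ κ a x → suc κ ≤ a → x ≤ grow κ a x
grow-≥ κ a x κ<a = ℕ.*-cancelˡ-≤ (suc κ) (ℕ.≤-trans (ℕ.*-monoˡ-≤ x κ<a) (grow-lower κ a x))

foldᴺ-grow-≥ : ∀ κ a m x → suc κ ≤ a → x ≤ foldᴺ (grow κ a) m x
foldᴺ-grow-≥ κ a zero    x κ<a = ℕ.≤-refl
foldᴺ-grow-≥ κ a (suc m) x κ<a = ℕ.≤-trans (grow-≥ κ a x κ<a) (foldᴺ-grow-≥ κ a m (grow κ a x) κ<a)

trials-term : ∀ {Γ} → Params → nat ∈ Γ → Term Γ nat
trials-term P n = for-nat (var n) (add-multiple (P .trial-rate) (var n) zero′) (grow-term (P .literal-range) (P .growth) (var #2))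

trials : Params → ℕ → ℕ
trials P n = foldᴺ (grow (P .literal-range) (P .growth)) n (n * P .trial-rate + 0)

program : Params → Algorithm
program P =
  let′ (for-nat (var #0) nil (cons (bit false) (var #2)))
    (let′ (add-multiple (P .walk-rate) (var #1) zero′)
      (let′ (trials-term P #2)
        (for-nat (var #5) nil
          (round-term P (↑⁴ #4) (↑⁴ #6) (↑⁴ #3) (↑⁴ #1) (↑⁴ #0) (↑⁴ #2) #2))))

toList-zeros : ∀ n → foldᴺ (false ∷_) n [] ≡ toList (zeros n)
toList-zeros zero    = refl
toList-zeros (suc n) = trans (foldᴺ-suc (false ∷_) n []) (cong (false ∷_) (toList-zeros n))

Partial : ℕ → ℕ → ℕ → Set
Partial n s j = Σ (List (Assignment n)) λ S → length S + j ≡ s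

partial-rep : ∀ {n s j} → Partial n s j → List (List Bool)
partial-rep (S , _) = List.map toList S

extend : ∀ {n s j} → Partial n s (suc j) → Best n → Partial n s j
extend {j = j} (S , eq) best = proj₂ best ∷ S , trans (sym (ℕ.+-suc (length S) j)) eq

round : ∀ {n s} → Params → CNF n → ℕ → ℕ → ℕ → ∀ j → Partial n s (suc j) → Dist (Partial n s j)
round P F W T M j S = bind (search P F W T M (proj₁ S)) (λ best → pure (extend S best))

walk-length : Params → ℕ → ℕ
walk-length P n = n * P .walk-rate + 0

disperse : ∀ {n} → Params → CNF n → ℕ → ∀ s → Dist (Partial n s 0)
disperse {n} P F W s = forᴺ (round P F W (walk-length P n) (trials P n)) s ([] , refl)

program-σ : ℕ → ℕ → ℕ
program-σ s M = search-σ s M + s * suc (search-σ s M)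

module _ {B : ℕ} {Γ : Ctx} {ρ : Env Γ} where

  grow-spec : ∀ {M κ a e t x} → x ≤ M → κ ≤ B → a ≤ B → Det B 0 e t ρ x →
              Det B M _ (grow-term κ a t) ρ (grow κ a x)
  grow-spec {M} {κ} {a} {x = x} x≤M κ≤B a≤B X =
    split-spec
      (Spec-weaken (ℕ.≤-reflexive (ℕ.*-identityʳ M)) ℕ.≤-refl
        (Spec-≡ (forᴺ-pure (grow-step κ a) x (κ , a))
          (for-nat-spec′ {σ = 0} {Y = λ _ → ℕ × ℕ} {rep = id} {ν = M} {m = x} {step = λ _ → pure ∘ grow-step κ a} (long-loop {B} {x} x≤M) X
            (pair-spec (Det-≡ (ℕ.+-identityʳ κ) (sucs-spec κ≤B zero-spec)) (Det-≡ (ℕ.+-identityʳ a) (sucs-spec a≤B zero-spec)))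
            (λ _ (c , x) _ _ _ → split-spec var-spec
              (case-nat-elim (λ c → pure (grow-step κ a (c , x))) var-spec
                (pair-spec (Det-≡ (ℕ.+-identityʳ κ) (sucs-spec κ≤B zero-spec)) (sucs-spec a≤B var-spec))
                (λ _ → pair-spec var-spec var-spec))))))
      var-spec

module _ {B : ℕ} {P : Params} {n : ℕ} (n≤B : n ≤ B) (κ≤B : P .literal-range ≤ B) (growth≤B : P .growth ≤ B)
         (rate≤B : P .trial-rate ≤ B) (κ<growth : P .literal-range < P .growth) where

  private
    M = trials P n
    f = grow (P .literal-range) (P .growth)

    -- The state remembers that `j` more growth steps lead to `M`. Growth never decreases the count,
    -- so every intermediate count, and with it the length of the loop that computes the next one,
    -- is bounded by `M`.
    Stage : ℕ → Set
    Stage j = Σ ℕ λ x → foldᴺ f j x ≡ M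

    stage-step : ∀ j → Stage (suc j) → Dist (Stage j)
    stage-step j (x , eq) = pure (f x , eq)

    stages : ∀ j y → forᴺ stage-step j y ≡ pure (M , refl)
    stages zero    (x , refl) = refl
    stages (suc j) (x , eq)   = stages j (f x , eq)

  trials-spec : ∀ {Γ} {ρ : Env Γ} {v : nat ∈ Γ} → All.lookup ρ v ≡ n → Det B M _ (trials-term P v) ρ M
  trials-spec eq = Spec-det (Spec-≡ (stages n (_ , refl))
    (for-nat-spec {Y = Stage} {rep = proj₁} {step = stage-step} n≤B (Det-≡ eq var-spec)
      (add-multiple-spec rate≤B n≤B (Det-≡ eq var-spec) zero-spec)
      (λ j (x , eq) _ _ _ → Spec-rep refl
        (grow-spec {x = x} (subst (x ≤_) eq (foldᴺ-grow-≥ (P .literal-range) (P .growth) (suc j) x κ<growth)) κ≤B growth≤B var-spec))))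

module _ {B : ℕ} {P : Params} {n : ℕ} {F : CNF n} {W : ℕ} (bounds : Bounds B P F W (walk-length P n))
         (walk-rate≤B : P .walk-rate ≤ B) (trial-rate≤B : P .trial-rate ≤ B)
         (growth≤B : P .growth ≤ B) (κ<growth : P .literal-range < P .growth) where

  open Bounds bounds

  private
    M = trials P n
    T = walk-length P n

  trials≤σ : ∀ s → M ≤ program-σ s M
  trials≤σ s = begin
    M ≤⟨ ℕ.m≤m*n M (suc s) ⟩
    M * suc s ≤⟨ ℕ.m≤n+m _ s ⟩
    s + M * suc s ≤⟨ ℕ.m≤m+n _ (suc s * suc (s + M * suc s)) ⟩
    search-σ s M ≤⟨ ℕ.m≤m+n _ (s * suc (search-σ s M)) ⟩
    program-σ s M ∎
    where open ℕ.≤-Reasoning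

  program-spec : ∀ s → Spec B (program-σ s M) 33 (program P)
                     (n ∷ List.map clause-rep F ∷ s ∷ W ∷ []) partial-rep (disperse P F W s)
  program-spec s =
    let-spec (Det-≡ (toList-zeros n) (for-nat-det {rep = id} {f = false ∷_} n≤ var-spec nil-spec (λ _ _ _ _ → cons-spec bit-spec var-spec)))
      (let-spec (add-multiple-spec walk-rate≤B n≤ var-spec zero-spec)
        (let-spec (Spec-weaken (trials≤σ s) ℕ.≤-refl (trials-spec {P = P} n≤ κ≤ growth≤B trial-rate≤B κ<growth refl))
          (for-nat-spec′ {Y = Partial n s} {rep = partial-rep} {ν = s} {step = round P F W T M} (long-loop {B} {s} ℕ.≤-refl) var-spec nil-spec
            (λ j S _ _ _ → split-bind
              (search-spec bounds {S = proj₁ S} (length≤ j S) refl refl refl refl refl refl refl)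
              (λ best → Spec-rep refl (cons-spec var-spec var-spec))))))
    where
    length≤ : ∀ j (S : Partial n s (suc j)) → length (proj₁ S) ≤ s
    length≤ j (S , eq) = subst (length S ≤_) eq (ℕ.m≤m+n (length S) (suc j))

-- Abstract, since evaluating the program on variables is infeasible.
abstract
  algorithm : Params → Algorithm
  algorithm = program

  time-exponent : ℕ
  time-exponent = 33

  algorithm-spec : ∀ {B P n} {F : CNF n} {W} → Bounds B P F W (walk-length P n) → P .walk-rate ≤ B →
    P .trial-rate ≤ B → P .growth ≤ B → P .literal-range < P .growth → ∀ s →
    Spec B (program-σ s (trials P n)) time-exponent (algorithm P)
      (n ∷ List.map clause-rep F ∷ s ∷ W ∷ []) partial-rep (disperse P F W s)
  algorithm-spec = program-spec

-- Hamming distance, cylinders and clauses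

dH-refl : ∀ {n} (z : Assignment n) → dH z z ≡ 0
dH-refl []          = refl
dH-refl (true  ∷ z) = dH-refl z
dH-refl (false ∷ z) = dH-refl z

dH-sym : ∀ {n} (y z : Assignment n) → dH y z ≡ dH z y
dH-sym []          []          = refl
dH-sym (true  ∷ y) (true  ∷ z) = dH-sym y z
dH-sym (true  ∷ y) (false ∷ z) = cong suc (dH-sym y z)
dH-sym (false ∷ y) (true  ∷ z) = cong suc (dH-sym y z)
dH-sym (false ∷ y) (false ∷ z) = dH-sym y z

dH≡0⇒≡ : ∀ {n} (y z : Assignment n) → dH y z ≡ 0 → y ≡ z
dH≡0⇒≡ []          []          eq = refl
dH≡0⇒≡ (true  ∷ y) (true  ∷ z) eq = cong (true ∷_) (dH≡0⇒≡ y z eq)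
dH≡0⇒≡ (false ∷ y) (false ∷ z) eq = cong (false ∷_) (dH≡0⇒≡ y z eq)

dH-∷-≤ : ∀ {n} b c (y z : Assignment n) → dH (b ∷ y) (c ∷ z) ≤ suc (dH y z)
dH-∷-≤ true  true  y z = ℕ.n≤1+n _
dH-∷-≤ true  false y z = ℕ.≤-refl
dH-∷-≤ false true  y z = ℕ.≤-refl
dH-∷-≤ false false y z = ℕ.n≤1+n _

dH≤dH-∷ : ∀ {n} b c (y z : Assignment n) → dH y z ≤ dH (b ∷ y) (c ∷ z)
dH≤dH-∷ true  true  y z = ℕ.≤-refl
dH≤dH-∷ true  false y z = ℕ.n≤1+n _
dH≤dH-∷ false true  y z = ℕ.n≤1+n _
dH≤dH-∷ false false y z = ℕ.≤-refl

dH-not : ∀ {n} b (y z : Assignment n) → dH (b ∷ y) (not b ∷ z) ≡ suc (dH y z)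
dH-not true  y z = refl
dH-not false y z = refl

dH-triangle : ∀ {n} (x y z : Assignment n) → dH x z ≤ dH x y + dH y z
dH-triangle []      []      []      = z≤n
dH-triangle (true  ∷ x) (true  ∷ y) (true  ∷ z) = dH-triangle x y z
dH-triangle (true  ∷ x) (true  ∷ y) (false ∷ z) = ℕ.≤-trans (s≤s (dH-triangle x y z)) (ℕ.≤-reflexive (sym (ℕ.+-suc (dH x y) (dH y z))))
dH-triangle (true  ∷ x) (false ∷ y) (true  ∷ z) = ℕ.≤-trans (dH-triangle x y z) (ℕ.+-mono-≤ (ℕ.n≤1+n (dH x y)) (ℕ.n≤1+n (dH y z)))
dH-triangle (true  ∷ x) (false ∷ y) (false ∷ z) = s≤s (dH-triangle x y z)
dH-triangle (false ∷ x) (true  ∷ y) (true  ∷ z) = s≤s (dH-triangle x y z)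
dH-triangle (false ∷ x) (true  ∷ y) (false ∷ z) = ℕ.≤-trans (dH-triangle x y z) (ℕ.+-mono-≤ (ℕ.n≤1+n (dH x y)) (ℕ.n≤1+n (dH y z)))
dH-triangle (false ∷ x) (false ∷ y) (true  ∷ z) = ℕ.≤-trans (s≤s (dH-triangle x y z)) (ℕ.≤-reflexive (sym (ℕ.+-suc (dH x y) (dH y z))))
dH-triangle (false ∷ x) (false ∷ y) (false ∷ z) = dH-triangle x y z

dH-zeros : ∀ {n} (z : Assignment n) → dH (zeros n) z ≡ ∣ z ∣
dH-zeros []          = refl
dH-zeros (true  ∷ z) = cong suc (dH-zeros z)
dH-zeros (false ∷ z) = dH-zeros z

weight-≤ : ∀ {n} (y z : Assignment n) → ∣ y ∣ ≤ ∣ z ∣ + dH z y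
weight-≤ y z = subst₂ _≤_ (dH-zeros y) (cong (_+ dH z y) (dH-zeros z)) (dH-triangle (zeros _) z y)

dH-set-closer : ∀ {n} (y z : Assignment n) v {b} → lookup z v ≡ b → lookup y v ≢ b →
                suc (dH (y Vec.[ v ]≔ b) z) ≡ dH y z
dH-set-closer (true  ∷ y) (true  ∷ z) zero    refl ne = contradiction refl ne
dH-set-closer (true  ∷ y) (false ∷ z) zero    refl ne = refl
dH-set-closer (false ∷ y) (true  ∷ z) zero    refl ne = refl
dH-set-closer (false ∷ y) (false ∷ z) zero    refl ne = contradiction refl ne
dH-set-closer (true  ∷ y) (true  ∷ z) (suc v) eq   ne = dH-set-closer y z v eq ne
dH-set-closer (true  ∷ y) (false ∷ z) (suc v) eq   ne = cong suc (dH-set-closer y z v eq ne)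
dH-set-closer (false ∷ y) (true  ∷ z) (suc v) eq   ne = cong suc (dH-set-closer y z v eq ne)
dH-set-closer (false ∷ y) (false ∷ z) (suc v) eq   ne = dH-set-closer y z v eq ne

dH-set-≤ : ∀ {n} (y z : Assignment n) v b → dH (y Vec.[ v ]≔ b) z ≤ suc (dH y z)
dH-set-≤ (x ∷ y) (c ∷ z) zero    b = ℕ.≤-trans (dH-∷-≤ b c y z) (s≤s (dH≤dH-∷ x c y z))
dH-set-≤ (true  ∷ y) (true  ∷ z) (suc v) b = dH-set-≤ y z v b
dH-set-≤ (true  ∷ y) (false ∷ z) (suc v) b = s≤s (dH-set-≤ y z v b)
dH-set-≤ (false ∷ y) (true  ∷ z) (suc v) b = s≤s (dH-set-≤ y z v b)
dH-set-≤ (false ∷ y) (false ∷ z) (suc v) b = dH-set-≤ y z v b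

-- z agrees with c before position i and differs from it there; for i ≥ n this
-- means z = c.
Cylinder : ∀ {n} → Assignment n → ℕ → Assignment n → Set
Cylinder []      i       []      = ⊤
Cylinder (b ∷ c) zero    (x ∷ z) = x ≡ not b
Cylinder (b ∷ c) (suc i) (x ∷ z) = x ≡ b × Cylinder c i z

Cylinder-set : ∀ {n} (c : Assignment n) i y v b → Cylinder c i y → i < toℕ v → Cylinder c i (y Vec.[ v ]≔ b)
Cylinder-set (_ ∷ c) zero    (_ ∷ y) (suc v) b h       _           = h
Cylinder-set (_ ∷ c) (suc i) (_ ∷ y) (suc v) b (e , h) (s≤s i<v) = e , Cylinder-set c i y v b h i<v

-- Since bits are binary, the one at position `i` is common to the whole cylinder too. Hence
-- freezing never blocks a variable on which the current point and the solution differ, and the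
-- helpful repair of a clause stays available.
Cylinder-lookup : ∀ {n} (c : Assignment n) i y z v → Cylinder c i y → Cylinder c i z → lookup y v ≢ lookup z v → i < toℕ v
Cylinder-lookup (_ ∷ c) zero    (_ ∷ y) (_ ∷ z) zero    h       h′        ne = contradiction (trans h (sym h′)) ne
Cylinder-lookup (_ ∷ c) zero    (_ ∷ y) (_ ∷ z) (suc v) h       h′        ne = s≤s z≤n
Cylinder-lookup (_ ∷ c) (suc i) (_ ∷ y) (_ ∷ z) zero    (e , _) (e′ , _)  ne = contradiction (trans e (sym e′)) ne
Cylinder-lookup (_ ∷ c) (suc i) (_ ∷ y) (_ ∷ z) (suc v) (_ , h) (_ , h′)  ne = s≤s (Cylinder-lookup c i y z v h h′ ne)

lcp : ∀ {n} → Assignment n → Assignment n → ℕ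
lcp []      []      = 0
lcp (b ∷ c) (x ∷ z) with x Bool.≟ b
... | yes _ = suc (lcp c z)
... | no  _ = 0

lcp≤n : ∀ {n} (c z : Assignment n) → lcp c z ≤ n
lcp≤n []      []      = z≤n
lcp≤n (b ∷ c) (x ∷ z) with x Bool.≟ b
... | yes _ = s≤s (lcp≤n c z)
... | no  _ = z≤n

Cylinder-lcp : ∀ {n} (c z : Assignment n) → Cylinder c (lcp c z) z
Cylinder-lcp []      []      = tt
Cylinder-lcp (b ∷ c) (x ∷ z) with x Bool.≟ b
... | yes x≡b = x≡b , Cylinder-lcp c z
... | no  x≢b = Bool.¬-not x≢b

Cylinder⇒lcp : ∀ {n} (c : Assignment n) i y z → Cylinder c i y → Cylinder c i z → i < n → i < lcp y z
Cylinder⇒lcp (_ ∷ c) zero    (x ∷ y) (x′ ∷ z) h       h′       _ with x′ Bool.≟ x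
... | yes _ = s≤s z≤n
... | no ne = contradiction (trans h′ (sym h)) ne
Cylinder⇒lcp (_ ∷ c) (suc i) (x ∷ y) (x′ ∷ z) (e , h) (e′ , h′) (s≤s i<n) with x′ Bool.≟ x
... | yes _ = s≤s (Cylinder⇒lcp c i y z h h′ i<n)
... | no ne = contradiction (trans e′ (sym e)) ne

lcp≡n⇒≡ : ∀ {n} (c z : Assignment n) → lcp c z ≡ n → c ≡ z
lcp≡n⇒≡ []      []      eq = refl
lcp≡n⇒≡ (b ∷ c) (x ∷ z) eq with x Bool.≟ b
... | yes x≡b = cong₂ _∷_ (sym x≡b) (lcp≡n⇒≡ c z (ℕ.suc-injective eq))

longest : ∀ {n} (z c : Assignment n) cs → ∃ λ c′ → c′ ∈ c ∷ cs × (∀ {p} → p ∈ c ∷ cs → lcp p z ≤ lcp c′ z)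
longest z c []       = c , here refl , λ where (here refl) → ℕ.≤-refl
longest z c (d ∷ cs) with longest z d cs
... | c′ , c′∈ , max with ℕ.≤-total (lcp c z) (lcp c′ z)
...   | inj₁ le = c′ , there c′∈ , λ where
  (here refl) → le
  (there p∈)  → max p∈
...   | inj₂ ge = c , here refl , λ where
  (here refl) → ℕ.≤-refl
  (there p∈)  → ℕ.≤-trans (max p∈) ge

-- A longest common prefix isolates z from all given assignments.
isolate : ∀ {n} (z c : Assignment n) cs → ¬ z ∈ c ∷ cs →
          ∃ λ c′ → ∃ λ i → c′ ∈ c ∷ cs × i ≤ n × Cylinder c′ i z × (∀ {p} → p ∈ c ∷ cs → ¬ Cylinder c′ i p)
isolate {n} z c cs z∉ with longest z c cs
... | c′ , c′∈ , max = c′ , lcp c′ z , c′∈ , lcp≤n c′ z , Cylinder-lcp c′ z , λ {p} p∈ h →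
  -- A `p` in the cylinder would also share with `z` the bit at position `lcp c′ z`, one more than
  -- `c′` does. This position exists because `z` itself is not among the given assignments.
  ℕ.<⇒≱ (Cylinder⇒lcp c′ (lcp c′ z) p z h (Cylinder-lcp c′ z)
          (ℕ.≤∧≢⇒< (lcp≤n c′ z) λ eq → z∉ (subst (_∈ c ∷ cs) (lcp≡n⇒≡ c′ z eq) c′∈)))
        (max p∈)

==ᵇ⇒≡ : ∀ a b → a ==ᵇ b ≡ true → a ≡ b
==ᵇ⇒≡ true  true  _ = refl
==ᵇ⇒≡ false false _ = refl

≡⇒==ᵇ : ∀ a b → a ≡ b → a ==ᵇ b ≡ true
≡⇒==ᵇ true  _ refl = refl
≡⇒==ᵇ false _ refl = refl

module _ {n} (y : Assignment n) where

  private
    holds : Literal n → Bool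
    holds (b , i) = lookup y i ==ᵇ b

    or-holds : Literal n → Bool → Bool
    or-holds l acc = if acc then true else holds l

  Satisfies : Clause n → Set
  Satisfies = Any (λ (b , i) → lookup y i ≡ b)

  foldᴸ-or-true : ∀ C → foldᴸ or-holds C true ≡ true
  foldᴸ-or-true []      = refl
  foldᴸ-or-true (l ∷ C) = foldᴸ-or-true C

  satᶜ⇒ : ∀ C → satᶜ y C ≡ true → Satisfies C
  satᶜ⇒ ((b , i) ∷ C) eq with lookup y i ==ᵇ b in eqᵢ
  ... | true  = here (==ᵇ⇒≡ (lookup y i) b eqᵢ)
  ... | false = there (satᶜ⇒ C eq)

  satᶜ⇐ : ∀ C → Satisfies C → satᶜ y C ≡ true
  satᶜ⇐ ((b , i) ∷ C) (here px) rewrite ≡⇒==ᵇ (lookup y i) b px = foldᴸ-or-true C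
  satᶜ⇐ ((b , i) ∷ C) (there h) with lookup y i ==ᵇ b
  ... | true  = foldᴸ-or-true C
  ... | false = satᶜ⇐ C h

  private
    collect : Clause n → List (Clause n) → List (Clause n)
    collect C acc = if satᶜ y C then acc else C ∷ acc

  foldᴸ-collect-∷ : ∀ F {C acc} → foldᴸ collect F (C ∷ acc) ≢ []
  foldᴸ-collect-∷ []      ()
  foldᴸ-collect-∷ (D ∷ F) eq with satᶜ y D
  ... | true  = foldᴸ-collect-∷ F eq
  ... | false = foldᴸ-collect-∷ F eq

  falsified-[]⇒⊨ : ∀ F → falsified y F ≡ [] → y ⊨ F
  falsified-[]⇒⊨ []      eq = []
  falsified-[]⇒⊨ (C ∷ F) eq with satᶜ y C in eqC
  ... | true  = satᶜ⇒ C eqC ∷ falsified-[]⇒⊨ F eq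
  ... | false = contradiction eq (foldᴸ-collect-∷ F)

  ⊨⇒falsified-[] : ∀ F → y ⊨ F → falsified y F ≡ []
  ⊨⇒falsified-[] []      []      = refl
  ⊨⇒falsified-[] (C ∷ F) (h ∷ hs) rewrite satᶜ⇐ C h = ⊨⇒falsified-[] F hs

  ∈-collect : ∀ F acc {C} → C ∈ foldᴸ collect F acc → C ∈ acc ⊎ (C ∈ F × ¬ Satisfies C)
  ∈-collect []      acc C∈ = inj₁ C∈
  ∈-collect (D ∷ F) acc C∈ with satᶜ y D in eqD
  ... | true with ∈-collect F acc C∈
  ...   | inj₁ h       = inj₁ h
  ...   | inj₂ (h , u) = inj₂ (there h , u)
  ∈-collect (D ∷ F) acc C∈ | false with ∈-collect F (D ∷ acc) C∈
  ...   | inj₁ (here refl) = inj₂ (here refl , λ s → case trans (sym (satᶜ⇐ D s)) eqD of λ ())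
  ...   | inj₁ (there h)   = inj₁ h
  ...   | inj₂ (h , u)     = inj₂ (there h , u)

  ∈-falsified : ∀ F {C} → C ∈ falsified y F → C ∈ F × ¬ Satisfies C
  ∈-falsified F C∈ with ∈-collect F [] C∈
  ... | inj₂ h = h

-- Schöning's walk

walk-fixed : ∀ {n} (F : CNF n) κ i (φ : Assignment n → ℚ) t y → falsified y F ≡ [] → E φ (walk κ F i t y) ≡ φ y
walk-fixed F κ i φ zero    y eq = refl
walk-fixed F κ i φ (suc t) y eq =
  trans (cong (λ Cs → E φ (bind (repair-some κ i y Cs) (walk κ F i t))) eq) (walk-fixed F κ i φ t y eq)

module Potential (k′ Δ : ℕ) where

  κ k : ℕ
  κ = suc (suc k′)
  k = suc κ

  -- A step of the biased walk multiplies `x ^ d` on average by `p / x + (1 - p) x`. This factor is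
  -- 1 at `x = q` and `x = 1` and smaller strictly between. The point `τ = 2 / k` lies there, with
  -- factor `μ`; it replaces the optimal but in general irrational `√q`.
  p q τ μ : ℚ
  p = inv κ
  q = inv (suc k′)
  τ = p ℚ.+ p
  μ = ½ ℚ.+ τ ℚ.* (p ℚ.* fromℕ κ)

  -- A lower bound for the chance that a walk at distance d from a fixed solution
  -- finds some solution within t steps without exceeding distance Δ, where d
  -- moves down with probability p and up otherwise.  The first two terms are
  -- harmonic, the last one pays for the walks that take too long.
  potential : ℕ → ℕ → ℚ
  potential t d = q ^ℚ d - q ^ℚ suc Δ - τ ^ℚ d ℚ.* μ ^ℚ t

  0≤p : 0ℚ ℚ.≤ p
  0≤p = 0≤inv κ

  0≤q : 0ℚ ℚ.≤ q
  0≤q = 0≤inv (suc k′)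

  0≤τ : 0ℚ ℚ.≤ τ
  0≤τ = 0≤+ 0≤p 0≤p

  0≤μ : 0ℚ ℚ.≤ μ
  0≤μ = 0≤+ (0≤inv 1) (0≤* 0≤τ (0≤* 0≤p (0≤fromℕ κ)))

  κ*q : fromℕ κ ℚ.* q ≡ 1ℚ
  κ*q = trans (ℚ.*-comm (fromℕ κ) q) (inv-* (suc k′))

  p*κ+p : p ℚ.* fromℕ κ ℚ.+ p ≡ 1ℚ
  p*κ+p = begin
    p ℚ.* fromℕ κ ℚ.+ p ≡⟨ ring p (fromℕ κ) ⟩
    p ℚ.* (1ℚ ℚ.+ fromℕ κ) ≡⟨ cong (p ℚ.*_) (fromℕ-+ 1 κ) ⟨
    p ℚ.* fromℕ k ≡⟨ inv-* κ ⟩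
    1ℚ ∎
    where
    open ≡-Reasoning
    ring : ∀ p K → p ℚ.* K ℚ.+ p ≡ p ℚ.* (1ℚ ℚ.+ K)
    ring = solve-∀ ringℚ

  p+pq : p ℚ.+ p ℚ.* q ≡ q
  p+pq = begin
    p ℚ.+ p ℚ.* q ≡⟨ cong (ℚ._+ p ℚ.* q) (ℚ.*-identityʳ p) ⟨
    p ℚ.* 1ℚ ℚ.+ p ℚ.* q ≡⟨ cong (λ x → p ℚ.* x ℚ.+ p ℚ.* q) κ*q ⟨
    p ℚ.* (fromℕ κ ℚ.* q) ℚ.+ p ℚ.* q ≡⟨ ring p (fromℕ κ) q ⟩
    (p ℚ.* fromℕ κ ℚ.+ p) ℚ.* q ≡⟨ cong (ℚ._* q) p*κ+p ⟩
    1ℚ ℚ.* q ≡⟨ ℚ.*-identityˡ q ⟩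
    q ∎
    where
    open ≡-Reasoning
    ring : ∀ p K q → p ℚ.* (K ℚ.* q) ℚ.+ p ℚ.* q ≡ (p ℚ.* K ℚ.+ p) ℚ.* q
    ring = solve-∀ ringℚ

  potential-step : ∀ t d → p ℚ.* (potential t d ℚ.+ fromℕ κ ℚ.* potential t (suc (suc d))) ≡ potential (suc t) (suc d)
  potential-step t d = begin
    p ℚ.* ((X - Q - Y ℚ.* Z) ℚ.+ K ℚ.* (q ℚ.* (q ℚ.* X) - Q - τ ℚ.* (τ ℚ.* Y) ℚ.* Z))
      ≡⟨ ring p K q X Q Y Z ⟩
    (p ℚ.+ p ℚ.* ((K ℚ.* q) ℚ.* q)) ℚ.* X - (p ℚ.* K ℚ.+ p) ℚ.* Q - (τ ℚ.* Y) ℚ.* (μ ℚ.* Z)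
      ≡⟨ cong₂ (λ a b → (p ℚ.+ p ℚ.* (a ℚ.* q)) ℚ.* X - b ℚ.* Q - (τ ℚ.* Y) ℚ.* (μ ℚ.* Z)) κ*q p*κ+p ⟩
    (p ℚ.+ p ℚ.* (1ℚ ℚ.* q)) ℚ.* X - 1ℚ ℚ.* Q - (τ ℚ.* Y) ℚ.* (μ ℚ.* Z)
      ≡⟨ cong₂ (λ a b → a ℚ.* X - b - (τ ℚ.* Y) ℚ.* (μ ℚ.* Z)) (trans (cong (λ a → p ℚ.+ p ℚ.* a) (ℚ.*-identityˡ q)) p+pq) (ℚ.*-identityˡ Q) ⟩
    q ℚ.* X - Q - (τ ℚ.* Y) ℚ.* (μ ℚ.* Z) ∎
    where
    open ≡-Reasoning
    X = q ^ℚ d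
    Q = q ^ℚ suc Δ
    Y = τ ^ℚ d
    Z = μ ^ℚ t
    K = fromℕ κ
    ring : ∀ p K q X Q Y Z →
      p ℚ.* ((X - Q - Y ℚ.* Z) ℚ.+ K ℚ.* (q ℚ.* (q ℚ.* X) - Q - (p ℚ.+ p) ℚ.* ((p ℚ.+ p) ℚ.* Y) ℚ.* Z)) ≡
      (p ℚ.+ p ℚ.* ((K ℚ.* q) ℚ.* q)) ℚ.* X - (p ℚ.* K ℚ.+ p) ℚ.* Q - ((p ℚ.+ p) ℚ.* Y) ℚ.* ((½ ℚ.+ (p ℚ.+ p) ℚ.* (p ℚ.* K)) ℚ.* Z)
    ring = solve-∀ ringℚ

  inv-≤ : ∀ m → inv m ℚ.≤ 1ℚ
  inv-≤ m = ℚ.≤-trans (ℚ.≤-reflexive (sym (ℚ.*-identityʳ (inv m))))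
    (ℚ.≤-trans (*-monoˡ-≤ (0≤inv m) (fromℕ-mono-≤ {1} {suc m} (s≤s z≤n))) (ℚ.≤-reflexive (inv-* m)))

  q≤1 : q ℚ.≤ 1ℚ
  q≤1 = inv-≤ (suc k′)

  p≤q : p ℚ.≤ q
  p≤q = ≤-from-diff (p ℚ.* q) (0≤* 0≤p 0≤q) p+pq

  q≤τ : q ℚ.≤ τ
  q≤τ = ℚ.≤-trans (ℚ.≤-reflexive (sym p+pq)) (ℚ.+-monoʳ-≤ p
    (ℚ.≤-trans (*-monoˡ-≤ 0≤p q≤1) (ℚ.≤-reflexive (ℚ.*-identityʳ p))))

  x-y≤x : ∀ x {y} → 0ℚ ℚ.≤ y → x - y ℚ.≤ x
  x-y≤x x {y} 0≤y = ≤-from-diff y 0≤y (ring x y)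
    where
    ring : ∀ x y → x - y ℚ.+ y ≡ x
    ring = solve-∀ ringℚ

  private
    0≤tail : ∀ t d → 0ℚ ℚ.≤ τ ^ℚ d ℚ.* μ ^ℚ t
    0≤tail t d = 0≤* (0≤^ d 0≤τ) (0≤^ t 0≤μ)

  potential≤1 : ∀ t d → potential t d ℚ.≤ 1ℚ
  potential≤1 t d = begin
    q ^ℚ d - q ^ℚ suc Δ - τ ^ℚ d ℚ.* μ ^ℚ t ≤⟨ x-y≤x _ (0≤tail t d) ⟩
    q ^ℚ d - q ^ℚ suc Δ ≤⟨ x-y≤x _ (0≤^ (suc Δ) 0≤q) ⟩
    q ^ℚ d ≤⟨ ^≤1 d 0≤q q≤1 ⟩
    1ℚ ∎
    where open ℚ.≤-Reasoning

  -- A boundary condition of the lower bound: the subtracted constant `q ^ suc Δ` makes it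
  -- nonpositive outside the ball. In `potential-end`, the last term does the same when time has run
  -- out, as `q ≤ τ`.
  potential-far : ∀ t {d} → Δ < d → potential t d ℚ.≤ 0ℚ
  potential-far t {d} Δ<d = begin
    q ^ℚ d - q ^ℚ suc Δ - τ ^ℚ d ℚ.* μ ^ℚ t ≤⟨ x-y≤x _ (0≤tail t d) ⟩
    q ^ℚ d - q ^ℚ suc Δ ≤⟨ ℚ.+-monoˡ-≤ (- (q ^ℚ suc Δ)) (^-anti-≤ 0≤q q≤1 Δ<d) ⟩
    q ^ℚ suc Δ - q ^ℚ suc Δ ≡⟨ ℚ.+-inverseʳ (q ^ℚ suc Δ) ⟩
    0ℚ ∎
    where open ℚ.≤-Reasoning

  potential-end : ∀ d → potential 0 d ℚ.≤ 0ℚ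
  potential-end d = begin
    q ^ℚ d - q ^ℚ suc Δ - τ ^ℚ d ℚ.* 1ℚ ≤⟨ ℚ.+-monoˡ-≤ (- (τ ^ℚ d ℚ.* 1ℚ)) (x-y≤x (q ^ℚ d) (0≤^ (suc Δ) 0≤q)) ⟩
    q ^ℚ d - τ ^ℚ d ℚ.* 1ℚ ≤⟨ ℚ.+-monoˡ-≤ (- (τ ^ℚ d ℚ.* 1ℚ)) (^-mono-≤ d 0≤q q≤τ) ⟩
    τ ^ℚ d - τ ^ℚ d ℚ.* 1ℚ ≡⟨ ring (τ ^ℚ d) ⟩
    0ℚ ∎
    where
    open ℚ.≤-Reasoning
    ring : ∀ x → x - x ℚ.* 1ℚ ≡ 0ℚ
    ring = solve-∀ ringℚ

  -- The product of this number and `1 - μ` is `(k - 2)² ≥ 1`, so that Bernoulli's inequality bounds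
  -- this power of `μ` by 1/2.
  half-μ : ℕ
  half-μ = 2 * (k * k)

  μ^half-μ : μ ^ℚ half-μ ℚ.≤ ½

  private
    -- 1 - μ = (1 - 2p)² / 2, and k (1 - 2p) = k - 2.
    K = fromℕ k
    gap : 1ℚ - μ ≡ ½ ℚ.* ((1ℚ - τ) ℚ.* (1ℚ - τ))
    gap = trans (cong (λ x → 1ℚ - (½ ℚ.+ τ ℚ.* x)) p*κ) (ring p)
      where
      p*κ : p ℚ.* fromℕ κ ≡ 1ℚ - p
      p*κ = trans (sym (ring₁ (p ℚ.* fromℕ κ) p)) (cong (_- p) p*κ+p)
        where
        ring₁ : ∀ x p → x ℚ.+ p - p ≡ x
        ring₁ = solve-∀ ringℚ
      ring : ∀ p → 1ℚ - (½ ℚ.+ (p ℚ.+ p) ℚ.* (1ℚ - p)) ≡ ½ ℚ.* ((1ℚ - (p ℚ.+ p)) ℚ.* (1ℚ - (p ℚ.+ p)))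
      ring = solve-∀ ringℚ

    K[1-τ] : K ℚ.* (1ℚ - τ) ≡ fromℕ (suc k′)
    K[1-τ] = begin
      K ℚ.* (1ℚ - τ) ≡⟨ ring₁ K p ⟩
      K - (p ℚ.* K ℚ.+ p ℚ.* K) ≡⟨ cong (λ x → K - (x ℚ.+ x)) (inv-* κ) ⟩
      K - (1ℚ ℚ.+ 1ℚ) ≡⟨ cong (_- (1ℚ ℚ.+ 1ℚ)) (fromℕ-+ 2 (suc k′)) ⟩
      fromℕ 2 ℚ.+ fromℕ (suc k′) - (1ℚ ℚ.+ 1ℚ) ≡⟨ ring₂ (fromℕ (suc k′)) ⟩
      fromℕ (suc k′) ∎
      where
      open ≡-Reasoning
      ring₁ : ∀ K p → K ℚ.* (1ℚ - (p ℚ.+ p)) ≡ K - (p ℚ.* K ℚ.+ p ℚ.* K)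
      ring₁ = solve-∀ ringℚ
      ring₂ : ∀ x → fromℕ 2 ℚ.+ x - (1ℚ ℚ.+ 1ℚ) ≡ x
      ring₂ = solve-∀ ringℚ

    half-μ*gap : fromℕ half-μ ℚ.* (1ℚ - μ) ≡ fromℕ (suc k′ * suc k′)
    half-μ*gap = begin
      fromℕ half-μ ℚ.* (1ℚ - μ)
        ≡⟨ cong₂ ℚ._*_ (trans (fromℕ-* 2 (k * k)) (cong (fromℕ 2 ℚ.*_) (fromℕ-* k k))) gap ⟩
      fromℕ 2 ℚ.* (K ℚ.* K) ℚ.* (½ ℚ.* ((1ℚ - τ) ℚ.* (1ℚ - τ)))
        ≡⟨ ring K (1ℚ - τ) ⟩
      (K ℚ.* (1ℚ - τ)) ℚ.* (K ℚ.* (1ℚ - τ))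
        ≡⟨ cong₂ ℚ._*_ K[1-τ] K[1-τ] ⟩
      fromℕ (suc k′) ℚ.* fromℕ (suc k′)
        ≡⟨ fromℕ-* (suc k′) (suc k′) ⟨
      fromℕ (suc k′ * suc k′) ∎
      where
      open ≡-Reasoning
      ring : ∀ K x → fromℕ 2 ℚ.* (K ℚ.* K) ℚ.* (½ ℚ.* (x ℚ.* x)) ≡ (K ℚ.* x) ℚ.* (K ℚ.* x)
      ring = solve-∀ ringℚ

    0≤1-τ : 0ℚ ℚ.≤ 1ℚ - τ
    0≤1-τ = *-cancelˡ-≤ 0<K (ℚ.≤-trans (ℚ.≤-reflexive (ℚ.*-zeroʳ K)) (ℚ.≤-trans (0≤fromℕ (suc k′)) (ℚ.≤-reflexive (sym K[1-τ]))))
      where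
      0<K : 0ℚ ℚ.< K
      0<K = ℚ.positive⁻¹ K {{ℚ.normalize-pos k 1}}

    0≤1-μ : 0ℚ ℚ.≤ 1ℚ - μ
    0≤1-μ = ℚ.≤-trans (0≤* (0≤inv 1) (0≤* 0≤1-τ 0≤1-τ)) (ℚ.≤-reflexive (sym gap))

  μ^half-μ = begin
    μ ^ℚ half-μ
      ≡⟨ ring₁ (μ ^ℚ half-μ) ⟩
    ½ ℚ.* (μ ^ℚ half-μ ℚ.* (1ℚ ℚ.+ fromℕ 1))
      ≤⟨ *-monoˡ-≤ (0≤inv 1) (*-monoˡ-≤ (0≤^ half-μ 0≤μ) (ℚ.+-monoʳ-≤ 1ℚ (fromℕ-mono-≤ {1} {suc k′ * suc k′} (s≤s z≤n)))) ⟩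
    ½ ℚ.* (μ ^ℚ half-μ ℚ.* (1ℚ ℚ.+ fromℕ (suc k′ * suc k′)))
      ≡⟨ cong₂ (λ x y → ½ ℚ.* (x ^ℚ half-μ ℚ.* (1ℚ ℚ.+ y))) (sym (ring₂ μ)) (sym half-μ*gap) ⟩
    ½ ℚ.* ((1ℚ - (1ℚ - μ)) ^ℚ half-μ ℚ.* (1ℚ ℚ.+ fromℕ half-μ ℚ.* (1ℚ - μ)))
      ≤⟨ *-monoˡ-≤ (0≤inv 1) (bernoulli half-μ 0≤1-μ (x-y≤x 1ℚ 0≤μ)) ⟩
    ½ ℚ.* 1ℚ
      ≡⟨ ℚ.*-identityʳ ½ ⟩
    ½ ∎
    where
    open ℚ.≤-Reasoning
    ring₁ : ∀ x → x ≡ ½ ℚ.* (x ℚ.* (1ℚ ℚ.+ fromℕ 1))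
    ring₁ = solve-∀ ringℚ
    ring₂ : ∀ x → 1ℚ - (1ℚ - x) ≡ x
    ring₂ = solve-∀ ringℚ

  q≤½ : q ℚ.≤ ½
  q≤½ = begin
    q ≡⟨ ring q ⟩
    ½ ℚ.* (fromℕ 2 ℚ.* q) ≤⟨ *-monoˡ-≤ (0≤inv 1) (*-monoʳ-≤ 0≤q (fromℕ-mono-≤ {2} {κ} (s≤s (s≤s z≤n)))) ⟩
    ½ ℚ.* (fromℕ κ ℚ.* q) ≡⟨ cong (½ ℚ.*_) κ*q ⟩
    ½ ℚ.* 1ℚ ≡⟨ ℚ.*-identityʳ ½ ⟩
    ½ ∎
    where
    open ℚ.≤-Reasoning
    ring : ∀ q → q ≡ ½ ℚ.* (fromℕ 2 ℚ.* q)
    ring = solve-∀ ringℚ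

  ½≤1 : ½ ℚ.≤ 1ℚ
  ½≤1 = inv-≤ 1

  -- Replacing `τ` by `2 q` loses `2 ^ d ≤ 2 ^ n`; the `3 n` halvings of the power of `μ` make up
  -- for this and for the factor 1/4.
  slow-walks : ∀ n d → 1 ≤ n → d ≤ n → τ ^ℚ d ℚ.* μ ^ℚ (half-μ * (3 * n)) ℚ.≤ (½ ℚ.* ½) ℚ.* q ^ℚ d
  slow-walks n d 1≤n d≤n = begin
    τ ^ℚ d ℚ.* μ ^ℚ (half-μ * (3 * n))
      ≡⟨ cong (τ ^ℚ d ℚ.*_) (^-assocʳ μ half-μ (3 * n)) ⟨
    τ ^ℚ d ℚ.* (μ ^ℚ half-μ) ^ℚ (3 * n)
      ≤⟨ *-mono-≤ (0≤^ d 0≤τ) (0≤^ (3 * n) (0≤inv 1)) (^-mono-≤ d 0≤τ τ≤2q) (^-mono-≤ (3 * n) (0≤^ half-μ 0≤μ) μ^half-μ) ⟩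
    (fromℕ 2 ℚ.* q) ^ℚ d ℚ.* ½ ^ℚ (3 * n)
      ≡⟨ cong (ℚ._* ½ ^ℚ (3 * n)) (^-distrib-* (fromℕ 2) q d) ⟩
    fromℕ 2 ^ℚ d ℚ.* q ^ℚ d ℚ.* ½ ^ℚ (3 * n)
      ≤⟨ *-monoˡ-≤ (0≤* (0≤^ d (0≤fromℕ 2)) (0≤^ d 0≤q)) (^-anti-≤ (0≤inv 1) ½≤1 d+2≤3n) ⟩
    fromℕ 2 ^ℚ d ℚ.* q ^ℚ d ℚ.* ½ ^ℚ (d + 2)
      ≡⟨ cong (fromℕ 2 ^ℚ d ℚ.* q ^ℚ d ℚ.*_) (^-homo-* ½ d 2) ⟩
    fromℕ 2 ^ℚ d ℚ.* q ^ℚ d ℚ.* (½ ^ℚ d ℚ.* (½ ℚ.* (½ ℚ.* 1ℚ)))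
      ≡⟨ ring (fromℕ 2 ^ℚ d) (q ^ℚ d) (½ ^ℚ d) ⟩
    (fromℕ 2 ^ℚ d ℚ.* ½ ^ℚ d) ℚ.* ((½ ℚ.* ½) ℚ.* q ^ℚ d)
      ≡⟨ cong (ℚ._* ((½ ℚ.* ½) ℚ.* q ^ℚ d)) (trans (sym (^-distrib-* (fromℕ 2) ½ d)) (1^ d)) ⟩
    1ℚ ℚ.* ((½ ℚ.* ½) ℚ.* q ^ℚ d)
      ≡⟨ ℚ.*-identityˡ _ ⟩
    (½ ℚ.* ½) ℚ.* q ^ℚ d ∎
    where
    open ℚ.≤-Reasoning
    ring : ∀ a b c → a ℚ.* b ℚ.* (c ℚ.* (½ ℚ.* (½ ℚ.* 1ℚ))) ≡ (a ℚ.* c) ℚ.* ((½ ℚ.* ½) ℚ.* b)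
    ring = solve-∀ ringℚ
    τ≤2q : τ ℚ.≤ fromℕ 2 ℚ.* q
    τ≤2q = ℚ.≤-trans (ℚ.+-mono-≤ p≤q p≤q) (ℚ.≤-reflexive (double q))
      where
      double : ∀ q → q ℚ.+ q ≡ fromℕ 2 ℚ.* q
      double = solve-∀ ringℚ
    d+2≤3n : d + 2 ≤ 3 * n
    d+2≤3n = ℕ.≤-trans (ℕ.+-mono-≤ d≤n (ℕ.*-monoʳ-≤ 2 1≤n)) (ℕ.≤-reflexive (eq n))
      where
      eq : ∀ n → n + 2 * n ≡ 3 * n
      eq = ℕ-Solver.solve-∀

  -- Walks that leave the ball cost at most half of `q ^ d`, because `q ≤ ½` and `d ≤ Δ`, and slow
  -- walks cost at most a quarter.
  potential-near : ∀ n d → 1 ≤ n → d ≤ n → d ≤ Δ → (½ ℚ.* ½) ℚ.* q ^ℚ d ℚ.≤ potential (half-μ * (3 * n)) d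
  potential-near n d 1≤n d≤n d≤Δ = begin
    (½ ℚ.* ½) ℚ.* X
      ≡⟨ ring X ⟩
    X - ½ ℚ.* X - (½ ℚ.* ½) ℚ.* X
      ≤⟨ ℚ.+-mono-≤ (ℚ.+-monoʳ-≤ X (ℚ.neg-antimono-≤ (*-mono-≤ 0≤q (0≤^ d 0≤q) q≤½ (^-anti-≤ 0≤q q≤1 d≤Δ))))
                    (ℚ.neg-antimono-≤ (slow-walks n d 1≤n d≤n)) ⟩
    potential (half-μ * (3 * n)) d ∎
    where
    open ℚ.≤-Reasoning
    X = q ^ℚ d
    ring : ∀ X → (½ ℚ.* ½) ℚ.* X ≡ X - ½ ℚ.* X - (½ ℚ.* ½) ℚ.* X
    ring = solve-∀ ringℚ

  module Walk {n} (F : CNF n) (F-k : IsKCNF k F) (c : Assignment n) (i : ℕ) (z* : Assignment n)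
              (z*⊨F : z* ⊨ F) (z*∈ : Cylinder c i z*)
              (φ : Assignment n → ℚ) (g : ℚ) (0≤g : 0ℚ ℚ.≤ g) (0≤φ : ∀ z → 0ℚ ℚ.≤ φ z)
              (g≤φ : ∀ z → z ⊨ F → Cylinder c i z → dH z z* ≤ Δ → g ℚ.≤ φ z) where

    RepairedBy : Assignment n → ℕ → Clause n → Set
    RepairedBy y d C = Cylinder c i (repair i y C) × dH (repair i y C) z* ≤ d

    repair-any : ∀ y D C → Cylinder c i y → dH y z* ≤ D → RepairedBy y (suc D) C
    repair-any y D []            y∈ y≤ = y∈ , ℕ.m≤n⇒m≤1+n y≤
    repair-any y D ((b , v) ∷ C) y∈ y≤ with toℕ v ∸ i in eq
    ... | zero  = y∈ , ℕ.m≤n⇒m≤1+n y≤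
    ... | suc _ = Cylinder-set c i y v b y∈ (ℕ.m∸n≢0⇒n<m λ eq′ → ℕ.0≢1+n (trans (sym eq′) eq))
                , ℕ.≤-trans (dH-set-≤ y z* v b) (s≤s y≤)

    repair-good : ∀ y d b v C → Cylinder c i y → dH y z* ≤ suc d → lookup z* v ≡ b → lookup y v ≢ b →
                  RepairedBy y d ((b , v) ∷ C)
    repair-good y d b v C y∈ y≤ z*v yv with toℕ v ∸ i in eq
    ... | zero  = contradiction (ℕ.m∸n≡0⇒m≤n eq)
                    (ℕ.<⇒≱ (Cylinder-lookup c i y z* v y∈ z*∈ λ eq′ → yv (trans eq′ z*v)))
    ... | suc _ = Cylinder-set c i y v b y∈ (ℕ.m∸n≢0⇒n<m λ eq′ → ℕ.0≢1+n (trans (sym eq′) eq))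
                , ℕ.≤-pred (ℕ.≤-trans (ℕ.≤-reflexive (dH-set-closer y z* v z*v yv)) y≤)

    good-index : ∀ {m} C → Satisfies z* C → length C ≤ m →
                 ∃ λ (j : Fin m) → ∃ λ b → ∃ λ v → ∃ λ C′ → foldᴺ tail (toℕ j) C ≡ (b , v) ∷ C′ × lookup z* v ≡ b × (b , v) ∈ C
    good-index {suc m} ((b , v) ∷ C) (here eq) len = zero , b , v , C , refl , eq , here refl
    good-index {suc m} (l ∷ C) (there h) (s≤s len) with good-index C h len
    ... | j , b , v , C′ , eq , eq′ , l∈ = suc j , b , v , C′ , eq , eq′ , there l∈

    -- The induction follows an upper bound `D` of the distance instead of the distance. It performs
    -- the biased walk exactly, so a step that does better than predicted requires no monotonicity
    -- of the potential.
    walk-hits : ∀ t y D → Cylinder c i y → dH y z* ≤ D → potential t D ℚ.* g ℚ.≤ E φ (walk κ F i t y)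
    walk-hits t y D y∈ y≤D with D ℕ.≤? Δ
    ... | no D≰Δ = ℚ.≤-trans (ℚ.≤-trans (*-monoʳ-≤ 0≤g (potential-far t (ℕ.≰⇒> D≰Δ))) (ℚ.≤-reflexive (ℚ.*-zeroˡ g)))
                             (E-≥ 0≤φ (walk κ F i t y))
    walk-hits zero y D y∈ y≤D | yes D≤Δ =
      ℚ.≤-trans (ℚ.≤-trans (*-monoʳ-≤ 0≤g (potential-end D)) (ℚ.≤-reflexive (ℚ.*-zeroˡ g))) (0≤φ y)
    walk-hits (suc t) y D y∈ y≤D | yes D≤Δ with falsified y F in eq
    ... | [] = begin
      potential (suc t) D ℚ.* g ≤⟨ *-monoʳ-≤ 0≤g (potential≤1 (suc t) D) ⟩
      1ℚ ℚ.* g ≡⟨ ℚ.*-identityˡ g ⟩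
      g ≤⟨ g≤φ y (falsified-[]⇒⊨ y F eq) y∈ (ℕ.≤-trans y≤D D≤Δ) ⟩
      φ y ≡⟨ walk-fixed F κ i φ t y eq ⟨
      E φ (walk κ F i t y) ∎
      where open ℚ.≤-Reasoning
    walk-hits (suc t) y zero y∈ y≤0 | yes _ | C ∷ Cs =
      contradiction (subst (_⊨ F) (sym (dH≡0⇒≡ y z* (ℕ.n≤0⇒n≡0 y≤0))) z*⊨F)
        λ y⊨F → case trans (sym eq) (⊨⇒falsified-[] y F y⊨F) of λ ()
    walk-hits (suc t) y (suc d) y∈ y≤ | yes _ | C ∷ Cs
      with ∈-falsified y F {C} (subst (C ∈_) (sym eq) (here refl))
    ... | C∈F , ¬sat with good-index C (All.lookup z*⊨F C∈F) (All.lookup F-k C∈F)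
    ... | j , b , v , C′ , at-j , z*v , l∈ = begin
      potential (suc t) (suc d) ℚ.* g
        ≡⟨ cong (ℚ._* g) (potential-step t d) ⟨
      p ℚ.* (potential t d ℚ.+ fromℕ κ ℚ.* potential t (suc (suc d))) ℚ.* g
        ≡⟨ ring p (potential t d) (fromℕ κ) (potential t (suc (suc d))) g ⟩
      p ℚ.* (potential t d ℚ.* g ℚ.+ fromℕ κ ℚ.* (potential t (suc (suc d)) ℚ.* g))
        -- Index `j` is drawn with probability `1 / k`. All others, including those past the end of
        -- a short clause or at a frozen variable, are charged an increase of the distance.
        ≤⟨ *-monoˡ-≤ 0≤p (∑-single (λ j → E φ (walk κ F i t (repair i y (foldᴺ tail (toℕ j) C)))) j good any) ⟩
      p ℚ.* ∑ {k} (λ j → E φ (walk κ F i t (repair i y (foldᴺ tail (toℕ j) C)))) ∎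
      where
      open ℚ.≤-Reasoning
      ring : ∀ p u K u′ g → p ℚ.* (u ℚ.+ K ℚ.* u′) ℚ.* g ≡ p ℚ.* (u ℚ.* g ℚ.+ K ℚ.* (u′ ℚ.* g))
      ring = solve-∀ ringℚ
      yv : lookup y v ≢ b
      yv yv≡b = ¬sat (Any.map (λ where refl → yv≡b) l∈)
      good : potential t d ℚ.* g ℚ.≤ E φ (walk κ F i t (repair i y (foldᴺ tail (toℕ j) C)))
      good = let (r∈ , r≤) = subst (RepairedBy y d) (sym at-j) (repair-good y d b v C′ y∈ y≤ z*v yv) in
             walk-hits t _ d r∈ r≤
      any : ∀ j′ → j′ ≢ j → potential t (suc (suc d)) ℚ.* g ℚ.≤ E φ (walk κ F i t (repair i y (foldᴺ tail (toℕ j′) C)))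
      any j′ _ = let (r∈ , r≤) = repair-any y (suc d) (foldᴺ tail (toℕ j′) C) y∈ y≤ in
                 walk-hits t _ (suc (suc d)) r∈ r≤
 

-- Random starting points

E-map : ∀ {X Y} (φ : Y → ℚ) (f : X → Y) d → E φ (mapᴰ f d) ≡ E (φ ∘ f) d
E-map φ f d = E-bind φ d (pure ∘ f)

dH-∷ : ∀ {n} b (y z : Assignment n) → dH (b ∷ y) (b ∷ z) ≡ dH y z
dH-∷ true  y z = refl
dH-∷ false y z = refl

-- A fairly flipped bit is uniform whatever `b` is, so it can be expressed relative to the bit `x`
-- of the target.
randomize-fair : ∀ {n} (φ : Assignment (suc n) → ℚ) b x c →
  E φ (randomize 1 (b ∷ c)) ≡ ½ ℚ.* (E (φ ∘ (x ∷_)) (randomize 1 c) ℚ.+ E (φ ∘ (not x ∷_)) (randomize 1 c))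
randomize-fair φ b x c = trans
  (cong₂ (λ u v → ½ ℚ.* (u ℚ.+ (v ℚ.+ 0ℚ))) (E-map φ (not b ∷_) (randomize 1 c)) (E-map φ (b ∷_) (randomize 1 c)))
  (swap b x)
  where
  e : Bool → ℚ
  e b = E (φ ∘ (b ∷_)) (randomize 1 c)
  ring₁ : ∀ u v → ½ ℚ.* (u ℚ.+ (v ℚ.+ 0ℚ)) ≡ ½ ℚ.* (v ℚ.+ u)
  ring₁ = solve-∀ ringℚ
  ring₂ : ∀ u v → ½ ℚ.* (u ℚ.+ (v ℚ.+ 0ℚ)) ≡ ½ ℚ.* (u ℚ.+ v)
  ring₂ = solve-∀ ringℚ
  swap : ∀ b x → ½ ℚ.* (e (not b) ℚ.+ (e b ℚ.+ 0ℚ)) ≡ ½ ℚ.* (e x ℚ.+ e (not x))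
  swap true  true  = ring₁ (e false) (e true)
  swap true  false = ring₂ (e false) (e true)
  swap false true  = ring₂ (e true) (e false)
  swap false false = ring₁ (e true) (e false)

bias : ℚ
bias = fromℕ 4 ℚ.* inv 4

-- A flip has probability 1/5 = 4/5 · 1/4: with a factor 4/5 taken out of every bit, each difference
-- contributes 1/4.
randomize-biased-≥ : ∀ {n} (φ : Assignment n → ℚ) → (∀ y → 0ℚ ℚ.≤ φ y) → ∀ c z →
  bias ^ℚ n ℚ.* inv 3 ^ℚ dH c z ℚ.* φ z ℚ.≤ E φ (randomize 4 c)
randomize-biased-≥ φ 0≤φ []      []      = ℚ.≤-reflexive (ring (φ []))
  where
  ring : ∀ x → 1ℚ ℚ.* 1ℚ ℚ.* x ≡ x
  ring = solve-∀ ringℚ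
randomize-biased-≥ {suc n} φ 0≤φ (b ∷ c) (x ∷ z) = begin
  bias ^ℚ suc n ℚ.* inv 3 ^ℚ dH (b ∷ c) (x ∷ z) ℚ.* φ (x ∷ z)
    ≤⟨ first-bit b x ⟩
  inv 4 ℚ.* (e (not b) ℚ.+ (e b ℚ.+ (e b ℚ.+ (e b ℚ.+ (e b ℚ.+ 0ℚ)))))
    ≡⟨ cong₂ (λ u v → inv 4 ℚ.* (u ℚ.+ (v ℚ.+ (v ℚ.+ (v ℚ.+ (v ℚ.+ 0ℚ)))))) (E-map φ (not b ∷_) (randomize 4 c)) (E-map φ (b ∷_) (randomize 4 c)) ⟨
  E φ (randomize 4 (b ∷ c)) ∎
  where
  open ℚ.≤-Reasoning
  e : Bool → ℚ
  e b = E (φ ∘ (b ∷_)) (randomize 4 c)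
  0≤e : ∀ b → 0ℚ ℚ.≤ e b
  0≤e b = E-≥ (λ y → 0≤φ (b ∷ y)) (randomize 4 c)
  X Y : ℚ
  X = bias ^ℚ n
  Y = inv 3 ^ℚ dH c z
  ih : ∀ b → X ℚ.* Y ℚ.* φ (b ∷ z) ℚ.≤ e b
  ih b = randomize-biased-≥ (φ ∘ (b ∷_)) (λ y → 0≤φ (b ∷ y)) c z
  keep : ∀ X Y w u v → X ℚ.* Y ℚ.* w ℚ.≤ v → 0ℚ ℚ.≤ u →
         bias ℚ.* X ℚ.* Y ℚ.* w ℚ.≤ inv 4 ℚ.* (u ℚ.+ (v ℚ.+ (v ℚ.+ (v ℚ.+ (v ℚ.+ 0ℚ)))))
  keep X Y w u v le 0≤u = ≤-from-diff (inv 4 ℚ.* u ℚ.+ bias ℚ.* (v - X ℚ.* Y ℚ.* w))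
    (0≤+ (0≤* (0≤inv 4) 0≤u) (0≤* (0≤* (0≤fromℕ 4) (0≤inv 4)) (p≤q⇒0≤q-p le))) (ring X Y w u v)
    where
    ring : ∀ X Y w u v → (fromℕ 4 ℚ.* inv 4) ℚ.* X ℚ.* Y ℚ.* w ℚ.+ (inv 4 ℚ.* u ℚ.+ (fromℕ 4 ℚ.* inv 4) ℚ.* (v - X ℚ.* Y ℚ.* w))
           ≡ inv 4 ℚ.* (u ℚ.+ (v ℚ.+ (v ℚ.+ (v ℚ.+ (v ℚ.+ 0ℚ)))))
    ring = solve-∀ ringℚ
  flip : ∀ X Y w u v → X ℚ.* Y ℚ.* w ℚ.≤ u → 0ℚ ℚ.≤ v →
         bias ℚ.* X ℚ.* (inv 3 ℚ.* Y) ℚ.* w ℚ.≤ inv 4 ℚ.* (u ℚ.+ (v ℚ.+ (v ℚ.+ (v ℚ.+ (v ℚ.+ 0ℚ)))))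
  flip X Y w u v le 0≤v = ≤-from-diff (inv 4 ℚ.* (u - X ℚ.* Y ℚ.* w) ℚ.+ bias ℚ.* v)
    (0≤+ (0≤* (0≤inv 4) (p≤q⇒0≤q-p le)) (0≤* (0≤* (0≤fromℕ 4) (0≤inv 4)) 0≤v)) (ring X Y w u v)
    where
    ring : ∀ X Y w u v → (fromℕ 4 ℚ.* inv 4) ℚ.* X ℚ.* (inv 3 ℚ.* Y) ℚ.* w ℚ.+ (inv 4 ℚ.* (u - X ℚ.* Y ℚ.* w) ℚ.+ (fromℕ 4 ℚ.* inv 4) ℚ.* v)
           ≡ inv 4 ℚ.* (u ℚ.+ (v ℚ.+ (v ℚ.+ (v ℚ.+ (v ℚ.+ 0ℚ)))))
    ring = solve-∀ ringℚ
  first-bit : ∀ b x → bias ^ℚ suc n ℚ.* inv 3 ^ℚ dH (b ∷ c) (x ∷ z) ℚ.* φ (x ∷ z) ℚ.≤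
                  inv 4 ℚ.* (e (not b) ℚ.+ (e b ℚ.+ (e b ℚ.+ (e b ℚ.+ (e b ℚ.+ 0ℚ)))))
  first-bit true  true  = keep X Y (φ (true ∷ z)) (e false) (e true) (ih true) (0≤e false)
  first-bit true  false = flip X Y (φ (false ∷ z)) (e false) (e true) (ih false) (0≤e true)
  first-bit false true  = flip X Y (φ (true ∷ z)) (e true) (e false) (ih true) (0≤e false)
  first-bit false false = keep X Y (φ (false ∷ z)) (e true) (e false) (ih false) (0≤e true)

bias≤1 : bias ℚ.≤ 1ℚ
bias≤1 = ℚ.≤ᵇ⇒≤ tt

0≤bias : 0ℚ ℚ.≤ bias
0≤bias = ℚ.≤ᵇ⇒≤ tt

sample-biased-≥ : ∀ {n} (φ : Assignment n → ℚ) → (∀ y → 0ℚ ℚ.≤ φ y) → ∀ c i z → Cylinder c i z →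
  bias ^ℚ n ℚ.* inv 3 ^ℚ dH c z ℚ.* φ z ℚ.≤ E φ (sample 4 c i)
sample-biased-≥ φ 0≤φ []      i       []      _ = ℚ.≤-reflexive (ring (φ []))
  where
  ring : ∀ x → 1ℚ ℚ.* 1ℚ ℚ.* x ≡ x
  ring = solve-∀ ringℚ
sample-biased-≥ {suc n} φ 0≤φ (b ∷ c) zero    (x ∷ z) refl = begin
  bias ^ℚ suc n ℚ.* inv 3 ^ℚ dH (b ∷ c) (not b ∷ z) ℚ.* φ (not b ∷ z)
    ≤⟨ *-monoʳ-≤ (0≤φ _) (*-mono-≤ (0≤^ (suc n) 0≤bias) (0≤^ (dH c z) (0≤inv 3))
        (^-anti-≤ 0≤bias bias≤1 (ℕ.n≤1+n n)) (^-anti-≤ (0≤inv 3) (ℚ.≤ᵇ⇒≤ tt) (dH≤dH-∷ b (not b) c z))) ⟩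
  bias ^ℚ n ℚ.* inv 3 ^ℚ dH c z ℚ.* φ (not b ∷ z)
    ≤⟨ randomize-biased-≥ (φ ∘ (not b ∷_)) (λ y → 0≤φ _) c z ⟩
  E (φ ∘ (not b ∷_)) (randomize 4 c)
    ≡⟨ E-map φ (not b ∷_) (randomize 4 c) ⟨
  E φ (sample 4 (b ∷ c) 0) ∎
  where open ℚ.≤-Reasoning
sample-biased-≥ {suc n} φ 0≤φ (b ∷ c) (suc i) (x ∷ z) (refl , h) = begin
  bias ^ℚ suc n ℚ.* inv 3 ^ℚ dH (b ∷ c) (b ∷ z) ℚ.* φ (b ∷ z)
    ≤⟨ *-monoʳ-≤ (0≤φ _) (*-mono-≤ (0≤^ (suc n) 0≤bias) (0≤^ (dH c z) (0≤inv 3))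
        (^-anti-≤ 0≤bias bias≤1 (ℕ.n≤1+n n)) (^-anti-≤ (0≤inv 3) (ℚ.≤ᵇ⇒≤ tt) (dH≤dH-∷ b b c z))) ⟩
  bias ^ℚ n ℚ.* inv 3 ^ℚ dH c z ℚ.* φ (b ∷ z)
    ≤⟨ sample-biased-≥ (φ ∘ (b ∷_)) (λ y → 0≤φ _) c i z h ⟩
  E (φ ∘ (b ∷_)) (sample 4 c i)
    ≡⟨ E-map φ (b ∷_) (sample 4 c i) ⟨
  E φ (sample 4 (b ∷ c) (suc i)) ∎
  where open ℚ.≤-Reasoning

module Uniform (k′ Δ : ℕ) where

  open Potential k′ Δ

  -- The mean of `q ^ d` over a single uniform bit, equal to `k / (2 (k - 1))`.
  h : ℚ
  h = ½ ℚ.* (1ℚ ℚ.+ q)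

  0≤h : 0ℚ ℚ.≤ h
  0≤h = 0≤* (0≤inv 1) (0≤+ (0≤fromℕ 1) 0≤q)

  h≤1 : h ℚ.≤ 1ℚ
  h≤1 = ℚ.≤-trans (*-monoˡ-≤ (0≤inv 1) (ℚ.+-monoʳ-≤ 1ℚ q≤1)) (ℚ.≤ᵇ⇒≤ tt)

  -- R - d vanishes at d = R, so that this is a lower bound for the weight q^d
  -- truncated to d ≤ Δ (Markov's inequality, when R = Δ + 1).
  truncated : ℚ → ℚ → ℕ → ℚ
  truncated C R d = C ℚ.* (q ^ℚ d ℚ.* (R - fromℕ d))

  truncated-suc : ∀ C R d → truncated C R (suc d) ≡ truncated (C ℚ.* q) (R - 1ℚ) d
  truncated-suc C R d = trans (cong (λ x → C ℚ.* (q ^ℚ suc d ℚ.* (R - x))) (fromℕ-+ 1 d)) (ring C q (q ^ℚ d) R (fromℕ d))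
    where
    ring : ∀ C q X R D → C ℚ.* (q ℚ.* X ℚ.* (R - (1ℚ ℚ.+ D))) ≡ C ℚ.* q ℚ.* (X ℚ.* (R - 1ℚ - D))
    ring = solve-∀ ringℚ

  -- The exact mean of `truncated` over `n` uniform bits: after normalizing the weights `q ^ d`, a
  -- bit differs from the target with probability `q / (1 + q) = p`, so that `R - d` has mean
  -- `R - n p`.
  mean : ℚ → ℚ → ℕ → ℚ
  mean C R n = C ℚ.* (h ^ℚ n ℚ.* (R - fromℕ n ℚ.* p))

  mean-suc : ∀ C R n → mean C R (suc n) ≡ ½ ℚ.* (mean C R n ℚ.+ mean (C ℚ.* q) (R - 1ℚ) n)
  mean-suc C R n = begin
    C ℚ.* (h ℚ.* H ℚ.* (R - fromℕ (suc n) ℚ.* p))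
      ≡⟨ cong (λ x → C ℚ.* (h ℚ.* H ℚ.* (R - x ℚ.* p))) (fromℕ-+ 1 n) ⟩
    C ℚ.* (h ℚ.* H ℚ.* (R - (1ℚ ℚ.+ N) ℚ.* p))
      ≡⟨ ring₁ C q H R N p ⟩
    ½ ℚ.* (C ℚ.* (H ℚ.* ((1ℚ ℚ.+ q) ℚ.* (R - N ℚ.* p) - (p ℚ.+ p ℚ.* q))))
      ≡⟨ cong (λ x → ½ ℚ.* (C ℚ.* (H ℚ.* ((1ℚ ℚ.+ q) ℚ.* (R - N ℚ.* p) - x)))) p+pq ⟩
    ½ ℚ.* (C ℚ.* (H ℚ.* ((1ℚ ℚ.+ q) ℚ.* (R - N ℚ.* p) - q)))
      ≡⟨ ring₂ C q H R N p ⟩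
    ½ ℚ.* (mean C R n ℚ.+ mean (C ℚ.* q) (R - 1ℚ) n) ∎
    where
    open ≡-Reasoning
    H = h ^ℚ n
    N = fromℕ n
    ring₁ : ∀ C q H R N p → C ℚ.* (½ ℚ.* (1ℚ ℚ.+ q) ℚ.* H ℚ.* (R - (1ℚ ℚ.+ N) ℚ.* p)) ≡
            ½ ℚ.* (C ℚ.* (H ℚ.* ((1ℚ ℚ.+ q) ℚ.* (R - N ℚ.* p) - (p ℚ.+ p ℚ.* q))))
    ring₁ = solve-∀ ringℚ
    ring₂ : ∀ C q H R N p → ½ ℚ.* (C ℚ.* (H ℚ.* ((1ℚ ℚ.+ q) ℚ.* (R - N ℚ.* p) - q))) ≡
            ½ ℚ.* (C ℚ.* (H ℚ.* (R - N ℚ.* p)) ℚ.+ C ℚ.* q ℚ.* (H ℚ.* (R - 1ℚ - N ℚ.* p)))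
    ring₂ = solve-∀ ringℚ

  -- `C` and `R` are general for the sake of the induction: a bit that differs from `z` multiplies
  -- `C` by `q` and lowers `R` by 1.
  randomize-≥ : ∀ {n} (φ : Assignment n → ℚ) C R c z → (∀ y → truncated C R (dH y z) ℚ.≤ φ y) →
                mean C R n ℚ.≤ E φ (randomize 1 c)
  randomize-≥ φ C R []      []      le = ℚ.≤-trans (ℚ.≤-reflexive (ring C R p)) (le [])
    where
    ring : ∀ C R p → C ℚ.* (1ℚ ℚ.* (R - 0ℚ ℚ.* p)) ≡ C ℚ.* (1ℚ ℚ.* (R - 0ℚ))
    ring = solve-∀ ringℚ
  randomize-≥ {suc n} φ C R (b ∷ c) (x ∷ z) le = begin
    mean C R (suc n)
      ≡⟨ mean-suc C R n ⟩
    ½ ℚ.* (mean C R n ℚ.+ mean (C ℚ.* q) (R - 1ℚ) n)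
      ≤⟨ *-monoˡ-≤ (0≤inv 1) (ℚ.+-mono-≤
          (randomize-≥ (φ ∘ (x ∷_)) C R c z λ y →
            ℚ.≤-trans (ℚ.≤-reflexive (cong (truncated C R) (sym (dH-∷ x y z)))) (le (x ∷ y)))
          (randomize-≥ (φ ∘ (not x ∷_)) (C ℚ.* q) (R - 1ℚ) c z λ y →
            ℚ.≤-trans (ℚ.≤-reflexive (trans (sym (truncated-suc C R (dH y z)))
              (cong (truncated C R) (sym (trans (dH-sym (not x ∷ y) (x ∷ z)) (trans (dH-not x z y) (cong suc (dH-sym z y)))))))) (le (not x ∷ y)))) ⟩
    ½ ℚ.* (E (φ ∘ (x ∷_)) (randomize 1 c) ℚ.+ E (φ ∘ (not x ∷_)) (randomize 1 c))
      ≡⟨ randomize-fair φ b x c ⟨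
    E φ (randomize 1 (b ∷ c)) ∎
    where open ℚ.≤-Reasoning

  mean-anti : ∀ {C R n} → 0ℚ ℚ.≤ C → fromℕ (suc n) ℚ.* p ℚ.≤ R → mean C R (suc n) ℚ.≤ mean C R n
  mean-anti {C} {R} {n} 0≤C le = *-monoˡ-≤ 0≤C (*-mono-≤ (0≤^ (suc n) 0≤h) (p≤q⇒0≤q-p (ℚ.≤-trans n≤ le)) h≤ (ℚ.+-monoʳ-≤ R (ℚ.neg-antimono-≤ n≤)))
    where
    n≤ : fromℕ n ℚ.* p ℚ.≤ fromℕ (suc n) ℚ.* p
    n≤ = *-monoʳ-≤ 0≤p (fromℕ-mono-≤ {n} {suc n} (ℕ.n≤1+n n))
    h≤ : h ^ℚ suc n ℚ.≤ h ^ℚ n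
    h≤ = ^-anti-≤ 0≤h h≤1 (ℕ.n≤1+n n)

  sample-≥ : ∀ {n} (φ : Assignment n → ℚ) C R c i z → 0ℚ ℚ.≤ C → fromℕ n ℚ.* p ℚ.≤ R → Cylinder c i z →
             (∀ y → Cylinder c i y → truncated C R (dH y z) ℚ.≤ φ y) → mean C R n ℚ.≤ E φ (sample 1 c i)
  sample-≥ φ C R []      i       []      0≤C n≤ _ le = ℚ.≤-trans (ℚ.≤-reflexive (ring C R p)) (le [] tt)
    where
    ring : ∀ C R p → C ℚ.* (1ℚ ℚ.* (R - 0ℚ ℚ.* p)) ≡ C ℚ.* (1ℚ ℚ.* (R - 0ℚ))
    ring = solve-∀ ringℚ
  sample-≥ {suc n} φ C R (b ∷ c) zero    (x ∷ z) 0≤C n≤ refl le = begin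
    mean C R (suc n) ≤⟨ mean-anti {C} {R} {n} 0≤C n≤ ⟩
    mean C R n ≤⟨ randomize-≥ (φ ∘ (not b ∷_)) C R c z (λ y →
      ℚ.≤-trans (ℚ.≤-reflexive (cong (truncated C R) (sym (dH-∷ (not b) y z)))) (le (not b ∷ y) refl)) ⟩
    E (φ ∘ (not b ∷_)) (randomize 1 c) ≡⟨ E-map φ (not b ∷_) (randomize 1 c) ⟨
    E φ (sample 1 (b ∷ c) 0) ∎
    where open ℚ.≤-Reasoning
  sample-≥ {suc n} φ C R (b ∷ c) (suc i) (x ∷ z) 0≤C n≤ (refl , h) le = begin
    mean C R (suc n) ≤⟨ mean-anti {C} {R} {n} 0≤C n≤ ⟩
    mean C R n ≤⟨ sample-≥ (φ ∘ (b ∷_)) C R c i z 0≤C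
      (ℚ.≤-trans (*-monoʳ-≤ 0≤p (fromℕ-mono-≤ {n} {suc n} (ℕ.n≤1+n n))) n≤) h (λ y y∈ →
      ℚ.≤-trans (ℚ.≤-reflexive (cong (truncated C R) (sym (dH-∷ b y z)))) (le (b ∷ y) (refl , y∈))) ⟩
    E (φ ∘ (b ∷_)) (sample 1 c i) ≡⟨ E-map φ (b ∷_) (sample 1 c i) ⟨
    E φ (sample 1 (b ∷ c) (suc i)) ∎
    where open ℚ.≤-Reasoning

-- The numerical bound for biased flips

*-^ : ∀ a b m → (a * b) ^ m ≡ a ^ m * b ^ m
*-^ a b zero    = refl
*-^ a b (suc m) = trans (cong (a * b *_) (*-^ a b m)) (eq a b (a ^ m) (b ^ m))
  where
  eq : ∀ a b x y → a * b * (x * y) ≡ a * x * (b * y)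
  eq = ℕ-Solver.solve-∀

-- With k = 3 + m and e = (k-2)² / (4k(k-1)), this is the 4k(k-1)-th power of
-- (5/4) 4ᵉ ≤ 2(k-1)/k.  For k ≥ 9 it suffices that 2(5k)² ≤ (8(k-1))².
exponent : ℕ → ℕ
exponent m = 4 * ((2 + m) * (3 + m))

ball-base : ∀ m → (5 * (3 + m)) ^ exponent m * 4 ^ (suc m * suc m) ≤ (8 * (2 + m)) ^ exponent m
ball-base 0 = ℕ.≤ᵇ⇒≤ _ _ tt
ball-base 1 = ℕ.≤ᵇ⇒≤ _ _ tt
ball-base 2 = ℕ.≤ᵇ⇒≤ _ _ tt
ball-base 3 = ℕ.≤ᵇ⇒≤ _ _ tt
ball-base 4 = ℕ.≤ᵇ⇒≤ _ _ tt
ball-base 5 = ℕ.≤ᵇ⇒≤ _ _ tt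
ball-base m@(suc (suc (suc (suc (suc (suc m′)))))) = begin
  u ^ exponent m * 4 ^ (suc m * suc m)
    ≤⟨ ℕ.*-monoʳ-≤ (u ^ exponent m) (ℕ.^-monoʳ-≤ 4 (ℕ.*-mono-≤ (ℕ.n≤1+n (suc m)) (ℕ.≤-trans (ℕ.n≤1+n (suc m)) (ℕ.n≤1+n (2 + m))))) ⟩
  u ^ exponent m * 4 ^ L
    ≡⟨ cong₂ _*_ (trans (cong (u ^_) (sym (eq₁ L))) (sym (ℕ.^-*-assoc u 2 (2 * L)))) (ℕ.^-*-assoc 2 2 L) ⟩
  (u ^ 2) ^ (2 * L) * 2 ^ (2 * L)
    ≡⟨ *-^ (u ^ 2) 2 (2 * L) ⟨
  (u ^ 2 * 2) ^ (2 * L)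
    ≤⟨ ℕ.^-monoˡ-≤ (2 * L) square ⟩
  (v ^ 2) ^ (2 * L)
    ≡⟨ trans (ℕ.^-*-assoc v 2 (2 * L)) (cong (v ^_) (eq₁ L)) ⟩
  v ^ exponent m ∎
  where
  open ℕ.≤-Reasoning
  u = 5 * (3 + m)
  v = 8 * (2 + m)
  L = (2 + m) * (3 + m)
  eq₁ : ∀ L → 2 * (2 * L) ≡ 4 * L
  eq₁ = ℕ-Solver.solve-∀
  square : u ^ 2 * 2 ≤ v ^ 2
  square = ℕ.≤-trans (ℕ.m≤m+n (u ^ 2 * 2) (46 + 124 * m′ + 14 * (m′ * m′))) (ℕ.≤-reflexive (eq₂ m′))
    where
    eq₂ : ∀ m → (5 * (9 + m)) * ((5 * (9 + m)) * 1) * 2 + (46 + 124 * m + 14 * (m * m)) ≡ (8 * (8 + m)) * ((8 * (8 + m)) * 1)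
    eq₂ = ℕ-Solver.solve-∀

-- Both sides are compared after raising them to the power `exponent m`, which clears the
-- denominator of the bound on `e / n`; what remains is the `n`-th power of `ball-base`.
ball-bound : ∀ m n e → exponent m * e ≤ suc m * suc m * n →
             (5 * (3 + m)) ^ n * 4 ^ e ≤ (8 * (2 + m)) ^ n
ball-bound m n e le = ℕ.≮⇒≥ λ lt → ℕ.<⇒≱ (ℕ.^-monoˡ-< L lt) (begin
  (u ^ n * 4 ^ e) ^ L
    ≡⟨ *-^ (u ^ n) (4 ^ e) L ⟩
  (u ^ n) ^ L * (4 ^ e) ^ L
    ≡⟨ cong₂ _*_ (swap u n L) (trans (ℕ.^-*-assoc 4 e L) (cong (4 ^_) (ℕ.*-comm e L))) ⟩
  (u ^ L) ^ n * 4 ^ (L * e)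
    ≤⟨ ℕ.*-monoʳ-≤ ((u ^ L) ^ n) (ℕ.^-monoʳ-≤ 4 le) ⟩
  (u ^ L) ^ n * 4 ^ (suc m * suc m * n)
    ≡⟨ cong ((u ^ L) ^ n *_) (ℕ.^-*-assoc 4 (suc m * suc m) n) ⟨
  (u ^ L) ^ n * (4 ^ (suc m * suc m)) ^ n
    ≡⟨ *-^ (u ^ L) (4 ^ (suc m * suc m)) n ⟨
  (u ^ L * 4 ^ (suc m * suc m)) ^ n
    ≤⟨ ℕ.^-monoˡ-≤ n (ball-base m) ⟩
  (v ^ L) ^ n
    ≡⟨ swap v L n ⟩
  (v ^ n) ^ L ∎)
  where
  open ℕ.≤-Reasoning
  L = exponent m
  u = 5 * (3 + m)
  v = 8 * (2 + m)
  swap : ∀ a b c → (a ^ b) ^ c ≡ (a ^ c) ^ b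
  swap a b c = trans (ℕ.^-*-assoc a b c) (trans (cong (a ^_) (ℕ.*-comm b c)) (sym (ℕ.^-*-assoc a c b)))

module Success (k′ n : ℕ) (1≤n : 1 ≤ n) where

  Δ : ℕ
  Δ = n / (3 + k′)

  open Potential k′ Δ public
  open Uniform k′ Δ public

  Δ*k≤n : Δ * k ≤ n
  Δ*k≤n = m/n*n≤m n k

  n<[1+Δ]*k : n < suc Δ * k
  n<[1+Δ]*k = begin-strict
    n ≡⟨ m≡m%n+[m/n]*n n k ⟩
    n % k + Δ * k <⟨ ℕ.+-monoˡ-< (Δ * k) (m%n<n n k) ⟩
    k + Δ * k ∎
    where open ℕ.≤-Reasoning

  -- The factor 1/4 comes from `potential-near`, `inv Δ` normalizes `R - d ≤ R = Δ + 1`, and `p` is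
  -- a lower bound for `R - n p`. The ½ in `success` is the coin that selects the flip rate.
  uniform-rate success : ℚ
  uniform-rate = (½ ℚ.* ½) ℚ.* inv Δ ℚ.* (h ^ℚ n ℚ.* p)
  success = ½ ℚ.* uniform-rate

  0≤¼ : 0ℚ ℚ.≤ ½ ℚ.* ½
  0≤¼ = 0≤* (0≤inv 1) (0≤inv 1)

  0≤uniform-rate : 0ℚ ℚ.≤ uniform-rate
  0≤uniform-rate = 0≤* (0≤* 0≤¼ (0≤inv Δ)) (0≤* (0≤^ n 0≤h) 0≤p)

  0≤success : 0ℚ ℚ.≤ success
  0≤success = 0≤* (0≤inv 1) 0≤uniform-rate

  uniform-rate≤h^n : uniform-rate ℚ.≤ h ^ℚ n
  uniform-rate≤h^n = begin
    (½ ℚ.* ½) ℚ.* inv Δ ℚ.* (h ^ℚ n ℚ.* p) ≤⟨ *-mono-≤ (0≤* 0≤¼ (0≤inv Δ)) (0≤^ n 0≤h)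
      (*-mono-≤ {s = 1ℚ} 0≤¼ (0≤fromℕ 1) (ℚ.≤ᵇ⇒≤ {q = 1ℚ} tt) (inv-≤ Δ))
      (ℚ.≤-trans (*-monoˡ-≤ (0≤^ n 0≤h) (inv-≤ κ)) (ℚ.≤-reflexive (ℚ.*-identityʳ (h ^ℚ n)))) ⟩
    1ℚ ℚ.* 1ℚ ℚ.* h ^ℚ n ≡⟨ ℚ.*-identityˡ (h ^ℚ n) ⟩
    h ^ℚ n ∎
    where open ℚ.≤-Reasoning

  h*2κ : h ℚ.* fromℕ (2 * κ) ≡ fromℕ k
  h*2κ = begin
    h ℚ.* fromℕ (2 * κ) ≡⟨ cong (h ℚ.*_) (fromℕ-* 2 κ) ⟩
    ½ ℚ.* (1ℚ ℚ.+ q) ℚ.* (fromℕ 2 ℚ.* fromℕ κ) ≡⟨ ring q (fromℕ κ) ⟩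
    fromℕ κ ℚ.* q ℚ.+ fromℕ κ ≡⟨ cong (ℚ._+ fromℕ κ) κ*q ⟩
    1ℚ ℚ.+ fromℕ κ ≡⟨ fromℕ-+ 1 κ ⟨
    fromℕ k ∎
    where
    open ≡-Reasoning
    ring : ∀ q K → ½ ℚ.* (1ℚ ℚ.+ q) ℚ.* (fromℕ 2 ℚ.* K) ≡ K ℚ.* q ℚ.+ K
    ring = solve-∀ ringℚ

  0<fromℕ : ∀ m → 0ℚ ℚ.< fromℕ (suc m)
  0<fromℕ m = ℚ.positive⁻¹ (fromℕ (suc m)) {{ℚ.normalize-pos (suc m) 1}}

  0<* : ∀ {x y} → 0ℚ ℚ.< x → 0ℚ ℚ.< y → 0ℚ ℚ.< x ℚ.* y
  0<* {x} {y} 0<x 0<y = ℚ.positive⁻¹ (x ℚ.* y) {{ℚ.pos*pos⇒pos x {{ℚ.positive 0<x}} y {{ℚ.positive 0<y}}}}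

  0<^ : ∀ {x} m → 0ℚ ℚ.< x → 0ℚ ℚ.< x ^ℚ m
  0<^ zero    0<x = 0<fromℕ 0
  0<^ (suc m) 0<x = 0<* 0<x (0<^ m 0<x)

  h^n≤biased : ∀ e → exponent k′ * e ≤ suc k′ * suc k′ * n → h ^ℚ n ℚ.≤ bias ^ℚ n ℚ.* inv 3 ^ℚ e
  h^n≤biased e le = *-cancelʳ-≤ (0<* (0<^ n (0<* (0<fromℕ 4) (0<fromℕ (suc k′ + (κ + 0))))) (0<^ e (0<fromℕ 3))) (begin
    h ^ℚ n ℚ.* ((fromℕ 5 ℚ.* fromℕ (2 * κ)) ^ℚ n ℚ.* fromℕ 4 ^ℚ e)
      ≡⟨ ℚ.*-assoc (h ^ℚ n) _ _ ⟨
    h ^ℚ n ℚ.* (fromℕ 5 ℚ.* fromℕ (2 * κ)) ^ℚ n ℚ.* fromℕ 4 ^ℚ e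
      ≡⟨ cong (ℚ._* fromℕ 4 ^ℚ e) (^-distrib-* h (fromℕ 5 ℚ.* fromℕ (2 * κ)) n) ⟨
    (h ℚ.* (fromℕ 5 ℚ.* fromℕ (2 * κ))) ^ℚ n ℚ.* fromℕ 4 ^ℚ e
      ≡⟨ cong (λ x → x ^ℚ n ℚ.* fromℕ 4 ^ℚ e) (trans (ring₁ h (fromℕ 5) (fromℕ (2 * κ))) (trans (cong (fromℕ 5 ℚ.*_) h*2κ) (sym (fromℕ-* 5 k)))) ⟩
    fromℕ (5 * k) ^ℚ n ℚ.* fromℕ 4 ^ℚ e
      ≡⟨ cong₂ ℚ._*_ (fromℕ-^ (5 * k) n) (fromℕ-^ 4 e) ⟨
    fromℕ ((5 * k) ^ n) ℚ.* fromℕ (4 ^ e)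
      ≡⟨ fromℕ-* ((5 * k) ^ n) (4 ^ e) ⟨
    fromℕ ((5 * k) ^ n * 4 ^ e)
      ≤⟨ fromℕ-mono-≤ {(5 * k) ^ n * 4 ^ e} {(8 * κ) ^ n} (ball-bound k′ n e le) ⟩
    fromℕ ((8 * κ) ^ n)
      ≡⟨ fromℕ-^ (8 * κ) n ⟩
    fromℕ (8 * κ) ^ℚ n
      ≡⟨ cong (_^ℚ n) eight ⟩
    (bias ℚ.* (fromℕ 5 ℚ.* fromℕ (2 * κ))) ^ℚ n
      ≡⟨ ^-distrib-* bias (fromℕ 5 ℚ.* fromℕ (2 * κ)) n ⟩
    bias ^ℚ n ℚ.* (fromℕ 5 ℚ.* fromℕ (2 * κ)) ^ℚ n
      ≡⟨ ring₂ (bias ^ℚ n) ((fromℕ 5 ℚ.* fromℕ (2 * κ)) ^ℚ n) ⟩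
    bias ^ℚ n ℚ.* (fromℕ 5 ℚ.* fromℕ (2 * κ)) ^ℚ n ℚ.* 1ℚ
      ≡⟨ cong (bias ^ℚ n ℚ.* (fromℕ 5 ℚ.* fromℕ (2 * κ)) ^ℚ n ℚ.*_) (trans (sym (^-distrib-* (inv 3) (fromℕ 4) e)) (1^ e)) ⟨
    bias ^ℚ n ℚ.* (fromℕ 5 ℚ.* fromℕ (2 * κ)) ^ℚ n ℚ.* (inv 3 ^ℚ e ℚ.* fromℕ 4 ^ℚ e)
      ≡⟨ ring₃ (bias ^ℚ n) ((fromℕ 5 ℚ.* fromℕ (2 * κ)) ^ℚ n) (inv 3 ^ℚ e) (fromℕ 4 ^ℚ e) ⟩
    bias ^ℚ n ℚ.* inv 3 ^ℚ e ℚ.* ((fromℕ 5 ℚ.* fromℕ (2 * κ)) ^ℚ n ℚ.* fromℕ 4 ^ℚ e) ∎)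
    where
    open ℚ.≤-Reasoning
    ring₁ : ∀ a b c → a ℚ.* (b ℚ.* c) ≡ b ℚ.* (a ℚ.* c)
    ring₁ = solve-∀ ringℚ
    ring₂ : ∀ a b → a ℚ.* b ≡ a ℚ.* b ℚ.* 1ℚ
    ring₂ = solve-∀ ringℚ
    ring₃ : ∀ a b c d → a ℚ.* b ℚ.* (c ℚ.* d) ≡ a ℚ.* c ℚ.* (b ℚ.* d)
    ring₃ = solve-∀ ringℚ
    eight : fromℕ (8 * κ) ≡ bias ℚ.* (fromℕ 5 ℚ.* fromℕ (2 * κ))
    eight = trans (fromℕ-* 8 κ) (trans (ring (fromℕ κ)) (cong (λ x → bias ℚ.* (fromℕ 5 ℚ.* x)) (sym (fromℕ-* 2 κ))))
      where
      ring : ∀ K → fromℕ 8 ℚ.* K ≡ (fromℕ 4 ℚ.* inv 4) ℚ.* (fromℕ 5 ℚ.* (fromℕ 2 ℚ.* K))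
      ring = solve-∀ ringℚ

  steps : ℕ
  steps = half-μ * (3 * n)

  candidate-≥ : ∀ (F : CNF n) c i {φ r g} mode → (∀ z → 0ℚ ℚ.≤ φ z) →
                r ℚ.* g ℚ.≤ E φ (mode-candidate κ F steps c i mode) → ½ ℚ.* r ℚ.* g ℚ.≤ E φ (candidate κ F steps c i)
  candidate-≥ F c i {φ} {r} {g} mode 0≤φ le = begin
    ½ ℚ.* r ℚ.* g ≡⟨ ℚ.*-assoc ½ r g ⟩
    ½ ℚ.* (r ℚ.* g) ≤⟨ *-monoˡ-≤ (0≤inv 1) (either mode le) ⟩
    ½ ℚ.* (e true ℚ.+ (e false ℚ.+ 0ℚ)) ∎
    where
    open ℚ.≤-Reasoning
    e : Bool → ℚ
    e mode = E φ (mode-candidate κ F steps c i mode)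
    0≤e : ∀ mode → 0ℚ ℚ.≤ e mode
    0≤e mode = E-≥ 0≤φ (mode-candidate κ F steps c i mode)
    ring : ∀ x y → x ℚ.+ (y ℚ.+ 0ℚ) ≡ y ℚ.+ x
    ring = solve-∀ ringℚ
    either : ∀ mode {x} → x ℚ.≤ e mode → x ℚ.≤ e true ℚ.+ (e false ℚ.+ 0ℚ)
    either true  le = ℚ.≤-trans le (p≤p+r (e true) (0≤+ (0≤e false) ℚ.≤-refl))
    either false le = ℚ.≤-trans le (ℚ.≤-trans (p≤p+r (e false) (0≤e true)) (ℚ.≤-reflexive (sym (ring (e true) (e false)))))

  module _ (F : CNF n) (Good : Assignment n → Set) (z* : Assignment n) (z*⊨F : z* ⊨ F) where

    -- The only starting point counted is `z*` itself, which the walk leaves unchanged because it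
    -- satisfies `F`.
    biased-hits : ∀ c i → Cylinder c i z* → Good z* → exponent k′ * dH c z* ≤ suc k′ * suc k′ * n →
                  Hits (candidate κ F steps c i) Good success
    biased-hits c i z*∈ good close φ g 0≤g 0≤φ g≤φ = candidate-≥ F c i {φ} {uniform-rate} {g} false 0≤φ (begin
      uniform-rate ℚ.* g
        ≤⟨ *-mono-≤ 0≤uniform-rate (0≤φ z*) (ℚ.≤-trans uniform-rate≤h^n (h^n≤biased (dH c z*) close)) (g≤φ z* good) ⟩
      bias ^ℚ n ℚ.* inv 3 ^ℚ dH c z* ℚ.* φ z*
        ≡⟨ cong (bias ^ℚ n ℚ.* inv 3 ^ℚ dH c z* ℚ.*_) (walk-fixed F κ i φ steps z* (⊨⇒falsified-[] z* F z*⊨F)) ⟨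
      bias ^ℚ n ℚ.* inv 3 ^ℚ dH c z* ℚ.* E φ (walk κ F i steps z*)
        ≤⟨ sample-biased-≥ (λ y → E φ (walk κ F i steps y)) (λ y → E-≥ 0≤φ (walk κ F i steps y)) c i z* z*∈ ⟩
      E (λ y → E φ (walk κ F i steps y)) (sample 4 c i)
        ≡⟨ E-bind φ (sample 4 c i) (walk κ F i steps) ⟨
      E φ (mode-candidate κ F steps c i false) ∎)
      where open ℚ.≤-Reasoning

    uniform-hits : ∀ c i → Cylinder c i z* → IsKCNF k F →
                   (∀ z → z ⊨ F → Cylinder c i z → dH z z* ≤ Δ → Good z) → Hits (candidate κ F steps c i) Good success
    uniform-hits c i z*∈ F-k good φ g 0≤g 0≤φ g≤φ = candidate-≥ F c i {φ} {uniform-rate} {g} true 0≤φ (begin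
      uniform-rate ℚ.* g
        ≡⟨ ring (inv Δ) (h ^ℚ n) p g ⟩
      C ℚ.* (h ^ℚ n ℚ.* p)
        ≤⟨ *-monoˡ-≤ 0≤C (*-monoˡ-≤ (0≤^ n 0≤h) p≤R-np) ⟩
      mean C R n
        ≤⟨ sample-≥ (λ y → E φ (walk κ F i steps y)) C R c i z* 0≤C np≤R z*∈ (λ y y∈ → pointwise y y∈) ⟩
      E (λ y → E φ (walk κ F i steps y)) (sample 1 c i)
        ≡⟨ E-bind φ (sample 1 c i) (walk κ F i steps) ⟨
      E φ (mode-candidate κ F steps c i true) ∎)
      where
      open ℚ.≤-Reasoning
      open Walk F F-k c i z* z*⊨F z*∈ φ g 0≤g 0≤φ (λ z z⊨F z∈ close → g≤φ z (good z z⊨F z∈ close)) using (walk-hits)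
      C R : ℚ
      C = (½ ℚ.* ½) ℚ.* inv Δ ℚ.* g
      R = fromℕ (suc Δ)
      0≤C : 0ℚ ℚ.≤ C
      0≤C = 0≤* (0≤* 0≤¼ (0≤inv Δ)) 0≤g
      ring : ∀ D H p g → (½ ℚ.* ½) ℚ.* D ℚ.* (H ℚ.* p) ℚ.* g ≡ (½ ℚ.* ½) ℚ.* D ℚ.* g ℚ.* (H ℚ.* p)
      ring = solve-∀ ringℚ
      -- Integrality matters here: `n < (Δ + 1) k` leaves a gap `R - n p` of at least `1 / k`, so
      -- the mean is not merely nonnegative.
      [1+n]p≤R : fromℕ (suc n) ℚ.* p ℚ.≤ R
      [1+n]p≤R = begin
        fromℕ (suc n) ℚ.* p ≤⟨ *-monoʳ-≤ 0≤p (fromℕ-mono-≤ {suc n} {suc Δ * k} n<[1+Δ]*k) ⟩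
        fromℕ (suc Δ * k) ℚ.* p ≡⟨ cong (ℚ._* p) (fromℕ-* (suc Δ) k) ⟩
        R ℚ.* fromℕ k ℚ.* p ≡⟨ trans (ℚ.*-assoc R (fromℕ k) p) (cong (R ℚ.*_) (trans (ℚ.*-comm (fromℕ k) p) (inv-* κ))) ⟩
        R ℚ.* 1ℚ ≡⟨ ℚ.*-identityʳ R ⟩
        R ∎
      suc-n : fromℕ (suc n) ℚ.* p ≡ p ℚ.+ fromℕ n ℚ.* p
      suc-n = trans (cong (ℚ._* p) (fromℕ-+ 1 n)) (distrib (fromℕ n) p)
        where
        distrib : ∀ N p → (1ℚ ℚ.+ N) ℚ.* p ≡ p ℚ.+ N ℚ.* p
        distrib = solve-∀ ringℚ
      p+np≤R : p ℚ.+ fromℕ n ℚ.* p ℚ.≤ R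
      p+np≤R = ℚ.≤-trans (ℚ.≤-reflexive (sym suc-n)) [1+n]p≤R
      np≤R : fromℕ n ℚ.* p ℚ.≤ R
      np≤R = ℚ.≤-trans (ℚ.≤-trans (p≤p+r (fromℕ n ℚ.* p) 0≤p) (ℚ.≤-reflexive (ℚ.+-comm (fromℕ n ℚ.* p) p))) p+np≤R
      p≤R-np : p ℚ.≤ R - fromℕ n ℚ.* p
      p≤R-np = ℚ.≤-trans (ℚ.≤-reflexive (cancel p (fromℕ n ℚ.* p))) (ℚ.+-monoˡ-≤ (- (fromℕ n ℚ.* p)) p+np≤R)
        where
        cancel : ∀ p x → p ≡ p ℚ.+ x - x
        cancel = solve-∀ ringℚ
      pointwise : ∀ y → Cylinder c i y → truncated C R (dH y z*) ℚ.≤ E φ (walk κ F i steps y)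
      pointwise y y∈ with dH y z* ℕ.≤? Δ
      ... | yes d≤Δ = begin
        C ℚ.* (q ^ℚ d ℚ.* (R - fromℕ d))
          ≤⟨ *-monoˡ-≤ 0≤C (*-monoˡ-≤ (0≤^ d 0≤q) (x-y≤x R (0≤fromℕ d))) ⟩
        C ℚ.* (q ^ℚ d ℚ.* R)
          ≡⟨ ring₂ (inv Δ) g (q ^ℚ d) R ⟩
        (inv Δ ℚ.* R) ℚ.* ((½ ℚ.* ½) ℚ.* q ^ℚ d ℚ.* g)
          ≡⟨ trans (cong (ℚ._* ((½ ℚ.* ½) ℚ.* q ^ℚ d ℚ.* g)) (inv-* Δ)) (ℚ.*-identityˡ _) ⟩
        (½ ℚ.* ½) ℚ.* q ^ℚ d ℚ.* g
          ≤⟨ *-monoʳ-≤ 0≤g (potential-near n d 1≤n (dH≤n y z*) d≤Δ) ⟩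
        potential steps d ℚ.* g
          ≤⟨ walk-hits steps y d y∈ ℕ.≤-refl ⟩
        E φ (walk κ F i steps y) ∎
        where
        d = dH y z*
        ring₂ : ∀ D g X R → (½ ℚ.* ½) ℚ.* D ℚ.* g ℚ.* (X ℚ.* R) ≡ (D ℚ.* R) ℚ.* ((½ ℚ.* ½) ℚ.* X ℚ.* g)
        ring₂ = solve-∀ ringℚ
      ... | no d≰Δ = begin
        C ℚ.* (q ^ℚ d ℚ.* (R - fromℕ d))
          ≤⟨ *-monoˡ-≤ 0≤C (*-monoˡ-≤ (0≤^ d 0≤q) (ℚ.≤-trans (ℚ.+-monoˡ-≤ (- fromℕ d) (fromℕ-mono-≤ {suc Δ} {d} (ℕ.≰⇒> d≰Δ))) (ℚ.≤-reflexive (ℚ.+-inverseʳ (fromℕ d))))) ⟩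
        C ℚ.* (q ^ℚ d ℚ.* 0ℚ)
          ≡⟨ trans (cong (C ℚ.*_) (ℚ.*-zeroʳ (q ^ℚ d))) (ℚ.*-zeroʳ C) ⟩
        0ℚ
          ≤⟨ E-≥ 0≤φ (walk κ F i steps y) ⟩
        E φ (walk κ F i steps y) ∎
        where
        d = dH y z*
 

-- Repeated trials

-- One application of K turns Inv into Suc except with probability f, and keeps
-- both; stated for random variables that are c on Suc and c - g on Inv.
record Improves {Y : Set} (Inv Suc : Y → Set) (K : Y → Dist Y) (f : ℚ) : Set where
  constructor improves
  field
    bounds : ∀ (φ : Y → ℚ) c g → 0ℚ ℚ.≤ g →
      (∀ y → Inv y → c - g ℚ.≤ φ y) → (∀ y → Suc y → c ℚ.≤ φ y) →
      (∀ y → Inv y → c - f ℚ.* g ℚ.≤ E φ (K y)) × (∀ y → Suc y → c ℚ.≤ E φ (K y))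

open Improves using (bounds)

module _ {Y : Set} {Inv Suc : Y → Set} where

  Improves-weaken : ∀ {K f f′} → f ℚ.≤ f′ → Improves Inv Suc K f → Improves Inv Suc K f′
  Improves-weaken f≤f′ imp .bounds φ c g 0≤g hᵢ hₛ with imp .bounds φ c g 0≤g hᵢ hₛ
  ... | i , s = (λ y h → ℚ.≤-trans (ℚ.+-monoʳ-≤ c (ℚ.neg-antimono-≤ (*-monoʳ-≤ 0≤g f≤f′))) (i y h)) , s

  Improves-pure : Improves Inv Suc pure 1ℚ
  Improves-pure .bounds φ c g 0≤g hᵢ hₛ =
    (λ y h → ℚ.≤-trans (ℚ.≤-reflexive (cong (λ x → c - x) (ℚ.*-identityˡ g))) (hᵢ y h)) , hₛ

  -- After the second kernel the expectation is at least `c` on `Suc` and `c - f′ g` on `Inv`. The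
  -- first kernel is applied to this function with `f′ g` in place of `g`, so that failure
  -- probabilities multiply.
  Improves-bind : ∀ {K L f f′} → 0ℚ ℚ.≤ f′ → Improves Inv Suc K f → Improves Inv Suc L f′ →
                  Improves Inv Suc (λ y → bind (K y) L) (f ℚ.* f′)
  Improves-bind {K} {L} {f} {f′} 0≤f′ imp imp′ .bounds φ c g 0≤g hᵢ hₛ with imp′ .bounds φ c g 0≤g hᵢ hₛ
  ... | i′ , s′ with imp .bounds (λ y → E φ (L y)) c (f′ ℚ.* g) (0≤* 0≤f′ 0≤g) i′ s′
  ...   | i , s = (λ y h → ℚ.≤-trans (ℚ.≤-reflexive (cong (λ x → c - x) (ℚ.*-assoc f f′ g)))
                     (ℚ.≤-trans (i y h) (ℚ.≤-reflexive (sym (E-bind φ (K y) L)))))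
                , (λ y h → ℚ.≤-trans (s y h) (ℚ.≤-reflexive (sym (E-bind φ (K y) L))))

  Improves-then : ∀ {K L f} → Improves Inv Suc K f → Improves Inv Suc L 1ℚ → Improves Inv Suc (λ y → bind (K y) L) f
  Improves-then {K} {f = f} imp imp′ =
    Improves-weaken {K = λ y → bind (K y) _} (ℚ.≤-reflexive (ℚ.*-identityʳ f)) (Improves-bind {K = K} (0≤fromℕ 1) imp imp′)

  Improves-before : ∀ {K L f} → 0ℚ ℚ.≤ f → Improves Inv Suc K 1ℚ → Improves Inv Suc L f → Improves Inv Suc (λ y → bind (K y) L) f
  Improves-before {K} {f = f} 0≤f imp imp′ =
    Improves-weaken {K = λ y → bind (K y) _} (ℚ.≤-reflexive (ℚ.*-identityˡ f)) (Improves-bind {K = K} 0≤f imp imp′)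

  Improves-repeat : ∀ {K f} m → 0ℚ ℚ.≤ f → Improves Inv Suc K f → Improves Inv Suc (repeat K m) (f ^ℚ m)
  Improves-repeat zero    0≤f imp = Improves-pure
  Improves-repeat {K} (suc m) 0≤f imp = Improves-bind {K = K} (0≤^ m 0≤f) imp (Improves-repeat {K} m 0≤f imp)

  Improves-forᴺ : ∀ {K : ℕ → Y → Dist Y} m → (∀ i → Improves Inv Suc (K i) 1ℚ) → Improves Inv Suc (forᴺ {λ _ → Y} K m) 1ℚ
  Improves-forᴺ zero    imp = Improves-pure
  Improves-forᴺ {K} (suc m) imp = Improves-then {K = K m} (imp m) (Improves-forᴺ {K} m imp)

  Improves-forᴺ-at : ∀ {K : ℕ → Y → Dist Y} {f} m i → i < m → 0ℚ ℚ.≤ f → (∀ i → Improves Inv Suc (K i) 1ℚ) →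
                     Improves Inv Suc (K i) f → Improves Inv Suc (forᴺ {λ _ → Y} K m) f
  Improves-forᴺ-at {K} (suc m) i i<1+m 0≤f imp impᵢ with i ℕ.≟ m
  ... | yes refl = Improves-then {K = K m} impᵢ (Improves-forᴺ {K} m imp)
  ... | no i≢m   = Improves-before {K = K m} 0≤f (imp m)
                     (Improves-forᴺ-at {K} m i (ℕ.≤∧≢⇒< (ℕ.≤-pred i<1+m) i≢m) 0≤f imp impᵢ)

  Improves-forᴸ : ∀ {X : Set} {K : X → Y → Dist Y} xs → (∀ x → Improves Inv Suc (K x) 1ℚ) → Improves Inv Suc (forᴸ K xs) 1ℚ
  Improves-forᴸ []       imp = Improves-pure
  Improves-forᴸ {K = K} (x ∷ xs) imp = Improves-then {K = K x} (imp x) (Improves-forᴸ {K = K} xs imp)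

  Improves-forᴸ-at : ∀ {X : Set} {K : X → Y → Dist Y} {f x} {xs : List X} → x ∈ xs → 0ℚ ℚ.≤ f →
                     (∀ x → Improves Inv Suc (K x) 1ℚ) → Improves Inv Suc (K x) f → Improves Inv Suc (forᴸ K xs) f
  Improves-forᴸ-at {K = K} {xs = x ∷ xs} (here refl) 0≤f imp impₓ = Improves-then {K = K x} impₓ (Improves-forᴸ {K = K} xs imp)
  Improves-forᴸ-at {K = K} {xs = x ∷ xs} (there x∈)  0≤f imp impₓ =
    Improves-before {K = K x} 0≤f (imp x) (Improves-forᴸ-at {K = K} x∈ 0≤f imp impₓ)

  Improves-candidate : ∀ {Z : Set} (d : Dist Z) (u : Y → Z → Y) (Good : Z → Set) p → Hits d Good p →
    (∀ {y} z → Inv y → Inv (u y z) ⊎ Suc (u y z)) → (∀ {y} z → Suc y → Suc (u y z)) → (∀ {y} z → Inv y → Good z → Suc (u y z)) →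
    ∀ K → (∀ φ y → E φ (K y) ≡ E (λ z → φ (u y z)) d) → Improves Inv Suc K (1ℚ - p)
  Improves-candidate d u Good p hits inv-u suc-u good-u K eqK .bounds φ c g 0≤g hᵢ hₛ =
    (λ y h → begin
      c - (1ℚ - p) ℚ.* g ≡⟨ ring₁ c p g ⟩
      -- `Hits` is applied to `φ - (c - g)` after the update, which is nonnegative on all outcomes
      -- and at least `g` on good ones.
      p ℚ.* g ℚ.+ (c - g) ≤⟨ ℚ.+-monoˡ-≤ (c - g) (hits (λ z → φ (u y z) - (c - g)) g 0≤g
        (λ z → p≤q⇒0≤q-p (above z (inv-u z h)))
        (λ z good → ℚ.≤-trans (ℚ.≤-reflexive (ring₂ c g)) (ℚ.+-monoˡ-≤ (- (c - g)) (hₛ (u y z) (good-u z h good))))) ⟩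
      E (λ z → φ (u y z) - (c - g)) d ℚ.+ (c - g) ≡⟨ cong (ℚ._+ (c - g)) (trans (E-+ (λ z → φ (u y z)) (λ _ → - (c - g)) d)
        (cong (E (λ z → φ (u y z)) d ℚ.+_) (E-const (- (c - g)) d))) ⟩
      E (λ z → φ (u y z)) d - (c - g) ℚ.+ (c - g) ≡⟨ ring₃ (E (λ z → φ (u y z)) d) (c - g) ⟩
      E (λ z → φ (u y z)) d ≡⟨ eqK φ y ⟨
      E φ (K y) ∎)
    , (λ y h → ℚ.≤-trans (E-≥ (λ z → hₛ (u y z) (suc-u z h)) d) (ℚ.≤-reflexive (sym (eqK φ y))))
    where
    open ℚ.≤-Reasoning
    above : ∀ {y} z → Inv (u y z) ⊎ Suc (u y z) → c - g ℚ.≤ φ (u y z)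
    above z (inj₁ h) = hᵢ _ h
    above z (inj₂ h) = ℚ.≤-trans (≤-from-diff g 0≤g (ring₄ c g)) (hₛ _ h)
      where
      ring₄ : ∀ c g → c - g ℚ.+ g ≡ c
      ring₄ = solve-∀ ringℚ
    ring₁ : ∀ c p g → c - (1ℚ - p) ℚ.* g ≡ p ℚ.* g ℚ.+ (c - g)
    ring₁ = solve-∀ ringℚ
    ring₂ : ∀ c g → g ≡ c - (c - g)
    ring₂ = solve-∀ ringℚ
    ring₃ : ∀ x y → x - y ℚ.+ y ≡ x
    ring₃ = solve-∀ ringℚ

module _ {n} (P : Params) (F : CNF n) (W : ℕ) (S : List (Assignment n)) where

  update-elim : ∀ (Q : Best n → Set) best z → Q best →
                (z ⊨ F → excess P W ∣ z ∣ ≡ 0 → proj₁ best < score z S → Q (score z S , z)) →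
                Q (update P F W S best z)
  update-elim Q best z old new with falsified z F in eqF
  ... | _ ∷ _ = old
  ... | [] with excess P W ∣ z ∣ in eqW
  ...   | suc _ = old
  ...   | zero with suc (proj₁ best) ∸ score z S in eqS
  ...     | zero  = new (falsified-[]⇒⊨ z F eqF) refl (ℕ.m∸n≡0⇒m≤n eqS)
  ...     | suc _ = old

  update-≥ : ∀ best z → z ⊨ F → excess P W ∣ z ∣ ≡ 0 → score z S ≤ proj₁ (update P F W S best z)
  update-≥ best z z⊨F ok rewrite ⊨⇒falsified-[] z F z⊨F | ok with suc (proj₁ best) ∸ score z S in eq
  ... | zero  = ℕ.≤-refl
  ... | suc _ = ℕ.≤-pred (ℕ.m∸n≢0⇒n<m (λ eq′ → ℕ.0≢1+n (trans (sym eq′) eq)))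

  Valid : Best n → Set
  Valid (a , z) = z ⊨ F × excess P W ∣ z ∣ ≡ 0 × a ≡ score z S

  module _ (Enough : ℕ → Set) (Enough-mono : ∀ {a a′} → a ≤ a′ → Enough a → Enough a′) where

    -- `Blank` admits the initial pair, whose assignment need not be a solution: its score 0 loses
    -- to any suitable candidate. The condition `1 ≤` keeps the new element outside `S` even when
    -- `Enough` is void.
    Blank Found : Best n → Set
    Blank best = proj₁ best ≡ 0 ⊎ Valid best
    Found best = Valid best × 1 ≤ proj₁ best × Enough (proj₁ best)

    Suitable : Assignment n → Set
    Suitable z = z ⊨ F × excess P W ∣ z ∣ ≡ 0 × 1 ≤ score z S × Enough (score z S)

    update-blank : ∀ {best} z → Blank best → Blank (update P F W S best z)
    update-blank {best} z h = update-elim Blank best z h (λ z⊨F ok _ → inj₂ (z⊨F , ok , refl))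

    update-found : ∀ {best} z → Found best → Found (update P F W S best z)
    update-found {best} z h@(_ , 1≤ , enough) = update-elim Found best z h λ z⊨F ok lt →
      (z⊨F , ok , refl) , ℕ.≤-trans 1≤ (ℕ.<⇒≤ lt) , Enough-mono (ℕ.<⇒≤ lt) enough

    update-suitable : ∀ {best} z → Blank best → Suitable z → Found (update P F W S best z)
    update-suitable {best} z h (z⊨F , ok , 1≤ , enough) with update-blank z h | update-≥ best z z⊨F ok
    ... | inj₁ eq    | le = contradiction (ℕ.≤-trans 1≤ (ℕ.≤-trans le (ℕ.≤-reflexive eq))) λ ()
    ... | inj₂ valid | le = valid , ℕ.≤-trans 1≤ le , Enough-mono le enough

    trial-improves : ∀ T c i p → Hits (candidate (Params.literal-range P) F T c i) Suitable p →
                     Improves Blank Found (trial P F W T S c i) (1ℚ - p)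
    trial-improves T c i p hits = Improves-candidate (candidate κ F T c i) (update P F W S) Suitable p hits
      (λ z h → inj₁ (update-blank z h)) update-found update-suitable (trial P F W T S c i) λ φ best →
        let after : Assignment n → ℚ
            after z = φ (update P F W S best z)
            choose-z : Assignment n → Dist (Best n)
            choose-z z = pure (update P F W S best z)
            from-y : Assignment n → Dist (Best n)
            from-y y = bind (walk κ F i T y) choose-z in
        trans (E-bind φ fair-coin (λ mode → bind (sample (flip-range mode) c i) from-y))
          (trans (E-cong (λ mode → trans (E-bind φ (sample (flip-range mode) c i) from-y)
                   (trans (E-cong (λ y → E-bind φ (walk κ F i T y) choose-z) (sample (flip-range mode) c i))
                          (sym (E-bind after (sample (flip-range mode) c i) (walk κ F i T)))))
                   fair-coin)
            (sym (E-bind after fair-coin (mode-candidate κ F T c i))))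
      where κ = Params.literal-range P

    trial-preserves : ∀ T c i → Improves Blank Found (trial P F W T S c i) 1ℚ
    trial-preserves T c i = Improves-weaken {K = trial P F W T S c i} (ℚ.≤-refl {1ℚ}) (trial-improves T c i 0ℚ λ φ g 0≤g 0≤φ _ →
      ℚ.≤-trans (ℚ.≤-reflexive (ℚ.*-zeroˡ g)) (E-≥ 0≤φ (candidate (Params.literal-range P) F T c i)))

    -- All trials but those of the centre c and the position i are wasted.
    search-finds : ∀ T M c i p f → c ∈ zeros n ∷ S → i ≤ n → 0ℚ ℚ.≤ 1ℚ - p → 0ℚ ℚ.≤ f → (1ℚ - p) ^ℚ M ℚ.≤ f →
      Hits (candidate (Params.literal-range P) F T c i) Suitable p →
      ∀ (φ : Best n → ℚ) v → 0ℚ ℚ.≤ v → (∀ best → 0ℚ ℚ.≤ φ best) → (∀ best → Found best → v ℚ.≤ φ best) →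
      v - f ^ℚ n ℚ.* v ℚ.≤ E φ (search P F W T M S)
    search-finds T M c i p f c∈ i≤n 0≤1-p 0≤f fail hits φ v 0≤v 0≤φ v≤φ =
      proj₁ (Improves-forᴸ-at {K = λ c → forᴺ {λ _ → Best n} (λ i → repeat (repeat (trial P F W T S c i) M) n) (suc n)}
        c∈ (0≤^ n 0≤f) (λ c → Improves-forᴺ {K = λ i → repeat (repeat (trial P F W T S c i) M) n} (suc n) (preserves c))
        (Improves-forᴺ-at {K = λ i → repeat (repeat (trial P F W T S c i) M) n} (suc n) i (s≤s i≤n) (0≤^ n 0≤f) (preserves c)
          (Improves-repeat {K = repeat (trial P F W T S c i) M} n 0≤f (Improves-weaken {K = repeat (trial P F W T S c i) M} fail
            (Improves-repeat {K = trial P F W T S c i} M 0≤1-p (trial-improves T c i p hits))))) .bounds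
        φ v v 0≤v (λ best _ → ℚ.≤-trans (ℚ.≤-reflexive (ℚ.+-inverseʳ v)) (0≤φ best)) v≤φ)
        (0 , zeros n) (inj₁ refl)
      where
      preserves : ∀ c i → Improves Blank Found (repeat (repeat (trial P F W T S c i) M) n) 1ℚ
      preserves c i = Improves-forᴺ {K = λ _ → repeat (trial P F W T S c i) M} n λ _ → Improves-forᴺ {K = λ _ → trial P F W T S c i} M λ _ → trial-preserves T c i

-- Greedy rounds

foldᴸ-min-elim : ∀ {X : Set} (Q : ℕ → Set) (f : X → ℕ) xs {a} → Q a → (∀ {x} → x ∈ xs → Q (f x)) →
                 Q (foldᴸ (λ x a → a ⊓ f x) xs a)
foldᴸ-min-elim Q f []       qa h = qa
foldᴸ-min-elim Q f (x ∷ xs) {a} qa h with ℕ.⊓-sel a (f x)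
... | inj₁ eq = foldᴸ-min-elim Q f xs (subst Q (sym eq) qa) (h ∘ there)
... | inj₂ eq = foldᴸ-min-elim Q f xs (subst Q (sym eq) (h (here refl))) (h ∘ there)

foldᴸ-min≤-∈ : ∀ {X : Set} (f : X → ℕ) {xs x} a → x ∈ xs → foldᴸ (λ x a → a ⊓ f x) xs a ≤ f x
foldᴸ-min≤-∈ f {x ∷ xs} a (here refl) = ℕ.≤-trans (foldᴸ-min≤ f xs (a ⊓ f x)) (ℕ.m⊓n≤n a (f x))
foldᴸ-min≤-∈ f {x ∷ xs} a (there x∈)  = foldᴸ-min≤-∈ f (a ⊓ f x) x∈

score≤dH : ∀ {n} (z : Assignment n) {S p} → p ∈ S → score z S ≤ dH z p
score≤dH {n} z = foldᴸ-min≤-∈ (dH z) n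

AllPairs-lookup : ∀ {X : Set} {R : X → X → Set} {xs : List X} → AllPairs R xs → ∀ {i j} → i Fin.< j →
                  R (List.lookup xs i) (List.lookup xs j)
AllPairs-lookup {xs = x ∷ xs} (r ∷ _)  {zero}  {suc j} _         = All.lookup r (∈-lookup j)
AllPairs-lookup {xs = x ∷ xs} (_ ∷ rs) {suc i} {suc j} (s≤s l) = AllPairs-lookup rs l

-- The first alternative makes an element that is not close new also for `D = 0`, where the second
-- alternative is impossible.
Close : ∀ {n} → ℕ → Assignment n → Assignment n → Set
Close D t p = t ≡ p ⊎ 2 * dH t p < D

close? : ∀ {n} D (t p : Assignment n) → Dec (Close D t p)
close? D t p = (t ≟ᴬ p) ⊎-dec (2 * dH t p ℕ.<? D)

find-far : ∀ {n} D (S T : List (Assignment n)) →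
           (∃ λ t → t ∈ T × ¬ Any (Close D t) S) ⊎ All (λ t → Any (Close D t) S) T
find-far D S []      = inj₂ []
find-far D S (t ∷ T) with Any.any? (close? D t) S | find-far D S T
... | no ¬c | _                   = inj₁ (t , here refl , ¬c)
... | yes _ | inj₁ (t′ , t′∈ , h) = inj₁ (t′ , there t′∈ , h)
... | yes c | inj₂ cs             = inj₂ (c ∷ cs)

Apart : ∀ {n} → ℕ → Assignment n → Assignment n → Set
Apart D t t′ = t ≢ t′ × D ≤ dH t t′

apart⇒not-close : ∀ {n D} {t t′ p : Assignment n} → Apart D t t′ → Close D t p → ¬ Close D t′ p
apart⇒not-close (t≢t′ , D≤) (inj₁ refl) (inj₁ refl) = t≢t′ refl
apart⇒not-close {t = t} {t′} (_ , D≤) (inj₁ refl) (inj₂ lt) =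
  ℕ.<⇒≱ lt (ℕ.≤-trans D≤ (ℕ.≤-trans (ℕ.≤-reflexive (dH-sym t t′)) (ℕ.m≤m+n (dH t′ t) _)))
apart⇒not-close {t = t} {t′} (_ , D≤) (inj₂ lt) (inj₁ refl) = ℕ.<⇒≱ lt (ℕ.≤-trans D≤ (ℕ.m≤m+n (dH t t′) _))
apart⇒not-close {D = D} {t} {t′} {p} (_ , D≤) (inj₂ lt) (inj₂ lt′) = ℕ.<⇒≱ (ℕ.+-mono-< lt lt′) (begin
  D + D ≤⟨ ℕ.+-mono-≤ D≤ D≤ ⟩
  dH t t′ + dH t t′ ≤⟨ ℕ.+-mono-≤ triangle triangle ⟩
  (dH t p + dH t′ p) + (dH t p + dH t′ p) ≡⟨ ring (dH t p) (dH t′ p) ⟩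
  2 * dH t p + 2 * dH t′ p ∎)
  where
  open ℕ.≤-Reasoning
  triangle : dH t t′ ≤ dH t p + dH t′ p
  triangle = ℕ.≤-trans (dH-triangle t p t′) (ℕ.≤-reflexive (cong (dH t p +_) (dH-sym p t′)))
  ring : ∀ a b → (a + b) + (a + b) ≡ 2 * a + 2 * b
  ring = ℕ-Solver.solve-∀

-- No element of S is close to two elements of T.
far-element : ∀ {n D} (T S : List (Assignment n)) → AllPairs (Apart D) T → length S < length T →
              ∃ λ t → t ∈ T × (∀ {p} → p ∈ S → t ≢ p × D ≤ 2 * dH t p)
far-element {n} {D} T S apart |S|<|T| with find-far D S T
... | inj₁ (t , t∈ , ¬close) = t , t∈ , λ p∈ →
  (λ t≡p → ¬close (Any.map (λ where refl → inj₁ t≡p) p∈)) ,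
  ℕ.≮⇒≥ (λ lt → ¬close (Any.map (λ where refl → inj₂ lt) p∈))
... | inj₂ close with pigeonhole |S|<|T| (λ i → Any.index (All.lookup close (∈-lookup i)))
...   | i , j , i<j , eq = contradiction
  (subst (λ m → Close D (List.lookup T j) (List.lookup S m)) (sym eq) (lookup-index (All.lookup close (∈-lookup j))))
  (apart⇒not-close {D = D} (AllPairs-lookup apart i<j) (lookup-index (All.lookup close (∈-lookup i))))

-- A walk has `half-μ * (3 * n)` steps. The ratio `growth / k` is `1 / h`, so that `M h ^ n` is at
-- least the initial count `48 k n`. As `success` is `h ^ n / (8 (Δ + 1) k)` and `Δ + 1 ≤ 2 n`, the
-- expected number of successes in `M` trials is at least 3.
schoening : (k′ α β γ ζ : ℕ) → Params
schoening k′ α β γ ζ = record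
  { literal-range = 2 + k′
  ; walk-rate  = 2 * ((3 + k′) * (3 + k′)) * 3
  ; trial-rate = 48 * (3 + k′)
  ; growth     = 2 * (2 + k′)
  ; α = α ; β = β ; γ = γ ; ζ = ζ
  }

module Greedy (k′ n : ℕ) (1≤n : 1 ≤ n) (α β γ ζ : ℕ) (F : CNF n) (F-k : IsKCNF (3 + k′) F)
              (W D : ℕ) (D≤n : D ≤ n) where

  open Success k′ n 1≤n

  P : Params
  P = schoening k′ α β γ ζ

  -- Here `δ = a / b`; comparisons with `δ` are multiplied by `b` to stay within the natural
  -- numbers.
  a b : ℕ
  a = 4 * κ
  b = suc k′ * suc k′

  -- m ≥ (1 - δ) D / 2.
  Enough : ℕ → Set
  Enough m = b * D ≤ 2 * (b * m) + a * D

  Enough-mono : ∀ {m m′} → m ≤ m′ → Enough m → Enough m′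
  Enough-mono m≤m′ h = ℕ.≤-trans h (ℕ.+-monoˡ-≤ (a * D) (ℕ.*-monoʳ-≤ 2 (ℕ.*-monoʳ-≤ b m≤m′)))

  half-enough : ∀ m → D ≤ 2 * m → Enough m
  half-enough m D≤ = ℕ.≤-trans (ℕ.≤-trans (ℕ.*-monoʳ-≤ b D≤) (ℕ.≤-reflexive (ring b m))) (ℕ.m≤m+n (2 * (b * m)) (a * D))
    where
    ring : ∀ b m → b * (2 * m) ≡ 2 * (b * m)
    ring = ℕ-Solver.solve-∀

  -- b Δ ≤ a e says that Δ ≤ δ e.
  approx-enough : ∀ e m → D ≤ 2 * e → b * Δ ≤ a * e → e ≤ Δ + m → Enough m
  approx-enough e m D≤2e bΔ≤ae e≤ with ℕ.≤-total b a
  ... | inj₁ b≤a = ℕ.≤-trans (ℕ.*-monoˡ-≤ D b≤a) (ℕ.m≤n+m (a * D) (2 * (b * m)))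
  -- If `δ ≥ 1`, the requirement is void. Otherwise `(1 - δ) D / 2 ≤ (1 - δ) e ≤ e - Δ ≤ m`, with
  -- `c` standing for `b (1 - δ)`.
  ... | inj₂ a≤b = begin
    b * D ≡⟨ cong (_* D) (ℕ.m∸n+n≡m a≤b) ⟨
    (c + a) * D ≡⟨ ℕ.*-distribʳ-+ D c a ⟩
    c * D + a * D ≤⟨ ℕ.+-monoˡ-≤ (a * D) (ℕ.≤-trans (ℕ.*-monoʳ-≤ c D≤2e)
      (ℕ.+-cancelˡ-≤ (2 * (a * e)) (c * (2 * e)) (2 * (b * m)) (begin
        2 * (a * e) + c * (2 * e) ≡⟨ ring₁ a c e ⟩
        2 * ((c + a) * e) ≡⟨ cong (λ x → 2 * (x * e)) (ℕ.m∸n+n≡m a≤b) ⟩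
        2 * (b * e) ≤⟨ ℕ.*-monoʳ-≤ 2 (ℕ.*-monoʳ-≤ b e≤) ⟩
        2 * (b * (Δ + m)) ≡⟨ ring₂ b Δ m ⟩
        2 * (b * Δ) + 2 * (b * m) ≤⟨ ℕ.+-monoˡ-≤ (2 * (b * m)) (ℕ.*-monoʳ-≤ 2 bΔ≤ae) ⟩
        2 * (a * e) + 2 * (b * m) ∎))) ⟩
    2 * (b * m) + a * D ∎
    where
    open ℕ.≤-Reasoning
    c = b ∸ a
    ring₁ : ∀ a c e → 2 * (a * e) + c * (2 * e) ≡ 2 * ((c + a) * e)
    ring₁ = ℕ-Solver.solve-∀
    ring₂ : ∀ b Δ m → 2 * (b * (Δ + m)) ≡ 2 * (b * Δ) + 2 * (b * m)
    ring₂ = ℕ-Solver.solve-∀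

  far⇒Δ≤δe : ∀ e → ¬ exponent k′ * e ≤ suc k′ * suc k′ * n → b * Δ ≤ a * e
  far⇒Δ≤δe e far = ℕ.*-cancelʳ-≤ (b * Δ) (a * e) k (begin
    b * Δ * k ≡⟨ ℕ.*-assoc b Δ k ⟩
    b * (Δ * k) ≤⟨ ℕ.*-monoʳ-≤ b Δ*k≤n ⟩
    b * n ≤⟨ ℕ.<⇒≤ (ℕ.≰⇒> far) ⟩
    exponent k′ * e ≡⟨ ring κ k e ⟩
    a * e * k ∎)
    where
    open ℕ.≤-Reasoning
    ring : ∀ κ k e → 4 * (κ * k) * e ≡ 4 * κ * e * k
    ring = ℕ-Solver.solve-∀

  -- The alternatives are the two ways to succeed: `z*` itself, with `e = 0`, or a solution at
  -- distance at most `e = Δ`, where `Δ` is at most `δ` times the weight `w*`.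
  Admissible : (ℕ → Set) → Set
  Admissible InW = ∀ {w* w e} → InW w* → w* ≤ w + e → w ≤ w* + e → e ≡ 0 ⊎ b * e ≤ a * w* → excess P W w ≡ 0

  module _ (InW : ℕ → Set) (admissible : Admissible InW) (S : List (Assignment n)) (z* : Assignment n) (z*⊨F : z* ⊨ F)
           (z*-in : InW ∣ z* ∣) (z*-far : ∀ {p} → p ∈ S → z* ≢ p × D ≤ 2 * dH z* p) where

    private
      positive-distance : ∀ {z p : Assignment n} → z ≢ p → 1 ≤ dH z p
      positive-distance {z} {p} z≢p = ℕ.n≢0⇒n>0 (z≢p ∘ dH≡0⇒≡ z p)

      enough-n : Enough n
      enough-n = half-enough n (ℕ.≤-trans D≤n (ℕ.m≤m+n n (n + 0)))

    Suits : Assignment n → Set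
    Suits = Suitable P F W S Enough Enough-mono

    z*-suits : Suits z*
    z*-suits = z*⊨F , admissible z*-in (ℕ.m≤m+n _ 0) (ℕ.m≤m+n _ 0) (inj₁ refl)
             , foldᴸ-min-elim (1 ≤_) (dH z*) S 1≤n (λ p∈ → positive-distance (proj₁ (z*-far p∈)))
             , foldᴸ-min-elim Enough (dH z*) S enough-n (λ {p} p∈ → half-enough (dH z* p) (proj₂ (z*-far p∈)))

    near-suits : (∀ {c} → c ∈ zeros n ∷ S → b * Δ ≤ a * dH c z*) → ∀ c i → (∀ {p} → p ∈ zeros n ∷ S → ¬ Cylinder c i p) →
                 ∀ z → z ⊨ F → Cylinder c i z → dH z z* ≤ Δ → Suits z
    near-suits far c i isolated z z⊨F z∈ close = z⊨F
      , admissible z*-in (ℕ.≤-trans (weight-≤ z* z) (ℕ.+-monoʳ-≤ ∣ z ∣ close))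
                         (ℕ.≤-trans (weight-≤ z z*) (ℕ.+-monoʳ-≤ ∣ z* ∣ (ℕ.≤-trans (ℕ.≤-reflexive (dH-sym z* z)) close)))
                         -- The head of the list of centres is the origin, whose distance from `z*`
                         -- is the weight of `z*`.
                         (inj₂ (subst (λ w → b * Δ ≤ a * w) (dH-zeros z*) (far (here refl))))
      , foldᴸ-min-elim (1 ≤_) (dH z) S 1≤n (λ p∈ → positive-distance λ z≡p → isolated (there p∈) (subst (Cylinder c i) z≡p z∈))
      , foldᴸ-min-elim Enough (dH z) S enough-n (λ {p} p∈ →
          approx-enough (dH z* p) (dH z p) (proj₂ (z*-far p∈)) (subst (λ e → b * Δ ≤ a * e) (dH-sym p z*) (far (there p∈)))
            (ℕ.≤-trans (dH-triangle z* z p) (ℕ.+-monoˡ-≤ (dH z p) (ℕ.≤-trans (ℕ.≤-reflexive (dH-sym z* z)) close))))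

    -- Close to some centre, sampling around that centre produces `z*`. Otherwise `z*` differs from
    -- all centres, the origin included, as `isolate` requires.
    suitable-centre : ∃ λ c → ∃ λ i → c ∈ zeros n ∷ S × i ≤ n × Hits (candidate κ F steps c i) Suits success
    suitable-centre with Any.any? (λ c → exponent k′ * dH c z* ℕ.≤? suc k′ * suc k′ * n) (zeros n ∷ S)
    ... | yes near with find near
    ...   | c , c∈ , close = c , lcp c z* , c∈ , lcp≤n c z* ,
      biased-hits F Suits z* z*⊨F c (lcp c z*) (Cylinder-lcp c z*) z*-suits close
    suitable-centre | no ¬near with isolate z* (zeros n) S z*∉
      where
      z*∉ : ¬ z* ∈ zeros n ∷ S
      z*∉ (here refl) = ¬near (here (subst (λ e → exponent k′ * e ≤ suc k′ * suc k′ * n) (sym (dH-refl z*))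
                                      (ℕ.≤-trans (ℕ.≤-reflexive (ℕ.*-zeroʳ (exponent k′))) z≤n)))
      z*∉ (there z*∈) = proj₁ (z*-far z*∈) refl
    ... | c , i , c∈ , i≤n , z*∈ , isolated = c , i , c∈ , i≤n ,
      uniform-hits F Suits z* z*⊨F c i z*∈ F-k (near-suits (λ {c} c∈ → far⇒Δ≤δe (dH c z*) λ le → ¬near (lose c∈ le)) c i isolated)

  M : ℕ
  M = trials P n

  trials-lower : ∀ m x → (2 * κ) ^ m * x ≤ k ^ m * foldᴺ (grow κ (2 * κ)) m x
  trials-lower zero    x = ℕ.≤-refl
  trials-lower (suc m) x = begin
    A * A ^ m * x ≡⟨ ring₁ A (A ^ m) x ⟩
    A ^ m * (A * x) ≤⟨ ℕ.*-monoʳ-≤ (A ^ m) (grow-lower κ A x) ⟩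
    A ^ m * (k * grow κ A x) ≡⟨ ring₂ (A ^ m) k (grow κ A x) ⟩
    k * (A ^ m * grow κ A x) ≤⟨ ℕ.*-monoʳ-≤ k (trials-lower m (grow κ A x)) ⟩
    k * (k ^ m * M′) ≡⟨ ℕ.*-assoc k (k ^ m) M′ ⟨
    k * k ^ m * M′ ∎
    where
    open ℕ.≤-Reasoning
    A = 2 * κ
    M′ = foldᴺ (grow κ A) m (grow κ A x)
    ring₁ : ∀ a b c → a * b * c ≡ b * (a * c)
    ring₁ = ℕ-Solver.solve-∀
    ring₂ : ∀ a b c → a * (b * c) ≡ b * (a * c)
    ring₂ = ℕ-Solver.solve-∀

  x₀ : ℕ
  x₀ = n * (48 * k) + 0

  x₀≤M*h^n : fromℕ x₀ ℚ.≤ fromℕ M ℚ.* h ^ℚ n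
  x₀≤M*h^n = *-cancelˡ-≤ (0<^ n (0<fromℕ (suc k′ + (κ + 0)))) (begin
    fromℕ A ^ℚ n ℚ.* fromℕ x₀ ≡⟨ cong (ℚ._* fromℕ x₀) (fromℕ-^ A n) ⟨
    fromℕ (A ^ n) ℚ.* fromℕ x₀ ≡⟨ fromℕ-* (A ^ n) x₀ ⟨
    fromℕ (A ^ n * x₀) ≤⟨ fromℕ-mono-≤ {A ^ n * x₀} {k ^ n * M} (trials-lower n x₀) ⟩
    fromℕ (k ^ n * M) ≡⟨ fromℕ-* (k ^ n) M ⟩
    fromℕ (k ^ n) ℚ.* fromℕ M ≡⟨ cong (ℚ._* fromℕ M) (trans (fromℕ-^ k n) (cong (_^ℚ n) (sym h*2κ))) ⟩
    (h ℚ.* fromℕ A) ^ℚ n ℚ.* fromℕ M ≡⟨ cong (ℚ._* fromℕ M) (^-distrib-* h (fromℕ A) n) ⟩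
    h ^ℚ n ℚ.* fromℕ A ^ℚ n ℚ.* fromℕ M ≡⟨ ring (h ^ℚ n) (fromℕ A ^ℚ n) (fromℕ M) ⟩
    fromℕ A ^ℚ n ℚ.* (fromℕ M ℚ.* h ^ℚ n) ∎)
    where
    open ℚ.≤-Reasoning
    A = 2 * κ
    ring : ∀ a b c → a ℚ.* b ℚ.* c ≡ b ℚ.* (c ℚ.* a)
    ring = solve-∀ ringℚ

  3≤M*success : fromℕ 3 ℚ.≤ fromℕ M ℚ.* success
  3≤M*success = begin
    fromℕ 3
      ≡⟨ ring₁ ⟩
    (½ ℚ.* (½ ℚ.* ½)) ℚ.* (1ℚ ℚ.* (1ℚ ℚ.* fromℕ 24))
      ≡⟨ cong₂ (λ x y → (½ ℚ.* (½ ℚ.* ½)) ℚ.* (x ℚ.* (y ℚ.* fromℕ 24))) (inv-* Δ) (inv-* κ) ⟨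
    (½ ℚ.* (½ ℚ.* ½)) ℚ.* ((inv Δ ℚ.* fromℕ (suc Δ)) ℚ.* ((p ℚ.* fromℕ k) ℚ.* fromℕ 24))
      ≡⟨ ring₂ (inv Δ) (fromℕ (suc Δ)) p (fromℕ k) ⟩
    (½ ℚ.* (½ ℚ.* ½)) ℚ.* inv Δ ℚ.* p ℚ.* (fromℕ (suc Δ) ℚ.* (fromℕ 24 ℚ.* fromℕ k))
      ≡⟨ cong ((½ ℚ.* (½ ℚ.* ½)) ℚ.* inv Δ ℚ.* p ℚ.*_) (trans (fromℕ-* (suc Δ) (24 * k)) (cong (fromℕ (suc Δ) ℚ.*_) (fromℕ-* 24 k))) ⟨
    (½ ℚ.* (½ ℚ.* ½)) ℚ.* inv Δ ℚ.* p ℚ.* fromℕ (suc Δ * (24 * k))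
      ≤⟨ *-monoˡ-≤ 0≤c (ℚ.≤-trans (fromℕ-mono-≤ {suc Δ * (24 * k)} {x₀} Δ≤x₀) x₀≤M*h^n) ⟩
    (½ ℚ.* (½ ℚ.* ½)) ℚ.* inv Δ ℚ.* p ℚ.* (fromℕ M ℚ.* h ^ℚ n)
      ≡⟨ ring₃ (inv Δ) p (fromℕ M) (h ^ℚ n) ⟩
    fromℕ M ℚ.* success ∎
    where
    open ℚ.≤-Reasoning
    0≤c : 0ℚ ℚ.≤ (½ ℚ.* (½ ℚ.* ½)) ℚ.* inv Δ ℚ.* p
    0≤c = 0≤* (0≤* (0≤* (0≤inv 1) 0≤¼) (0≤inv Δ)) 0≤p
    ring₁ : fromℕ 3 ≡ (½ ℚ.* (½ ℚ.* ½)) ℚ.* (1ℚ ℚ.* (1ℚ ℚ.* fromℕ 24))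
    ring₁ = refl
    ring₂ : ∀ a b c d → (½ ℚ.* (½ ℚ.* ½)) ℚ.* ((a ℚ.* b) ℚ.* ((c ℚ.* d) ℚ.* fromℕ 24)) ≡
            (½ ℚ.* (½ ℚ.* ½)) ℚ.* a ℚ.* c ℚ.* (b ℚ.* (fromℕ 24 ℚ.* d))
    ring₂ = solve-∀ ringℚ
    ring₃ : ∀ a c m h → (½ ℚ.* (½ ℚ.* ½)) ℚ.* a ℚ.* c ℚ.* (m ℚ.* h) ≡ m ℚ.* (½ ℚ.* ((½ ℚ.* ½) ℚ.* a ℚ.* (h ℚ.* c)))
    ring₃ = solve-∀ ringℚ
    Δ≤n : Δ ≤ n
    Δ≤n = ℕ.≤-trans (ℕ.m≤m*n Δ k) Δ*k≤n
    Δ≤x₀ : suc Δ * (24 * k) ≤ x₀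
    Δ≤x₀ = ℕ.≤-trans (ℕ.*-monoˡ-≤ (24 * k) (ℕ.+-mono-≤ 1≤n Δ≤n)) (ℕ.≤-reflexive (eq n k))
      where
      eq : ∀ n k → (n + n) * (24 * k) ≡ n * (48 * k) + 0
      eq = ℕ-Solver.solve-∀

  ¼ : ℚ
  ¼ = ½ ℚ.* ½

  success≤1 : success ℚ.≤ 1ℚ
  success≤1 = ℚ.≤-trans (*-mono-≤ {s = 1ℚ} (0≤inv 1) (0≤fromℕ 1) ½≤1 (ℚ.≤-trans uniform-rate≤h^n (^≤1 n 0≤h h≤1)))
                        (ℚ.≤-reflexive (ℚ.*-identityˡ 1ℚ))

  -- Bernoulli's inequality in the form `(1 - x) ^ M (1 + M x) ≤ 1` turns three expected successes
  -- into failure probability 1/4.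
  failure : (1ℚ - success) ^ℚ M ℚ.≤ ¼
  failure = begin
    X ≡⟨ ring X ⟩
    ¼ ℚ.* (X ℚ.* (1ℚ ℚ.+ fromℕ 3)) ≤⟨ *-monoˡ-≤ 0≤¼ (*-monoˡ-≤ (0≤^ M (p≤q⇒0≤q-p success≤1)) (ℚ.+-monoʳ-≤ 1ℚ 3≤M*success)) ⟩
    ¼ ℚ.* (X ℚ.* (1ℚ ℚ.+ fromℕ M ℚ.* success)) ≤⟨ *-monoˡ-≤ 0≤¼ (bernoulli M 0≤success success≤1) ⟩
    ¼ ℚ.* 1ℚ ≡⟨ ℚ.*-identityʳ ¼ ⟩
    ¼ ∎
    where
    open ℚ.≤-Reasoning
    X = (1ℚ - success) ^ℚ M
    ring : ∀ x → x ≡ (½ ℚ.* ½) ℚ.* (x ℚ.* (1ℚ ℚ.+ fromℕ 3))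
    ring = solve-∀ ringℚ

  walk-length≡steps : walk-length P n ≡ steps
  walk-length≡steps = eq (k * k) n
    where
    eq : ∀ x n → n * (2 * x * 3) + 0 ≡ 2 * x * (3 * n)
    eq = ℕ-Solver.solve-∀

  Spread : List (Assignment n) → Set
  Spread S = All (λ z → z ⊨ F × excess P W ∣ z ∣ ≡ 0) S × AllPairs (λ z z′ → 1 ≤ dH z z′ × Enough (dH z z′)) S

  η : ℚ
  η = ¼ ^ℚ n

  0≤1-η : 0ℚ ℚ.≤ 1ℚ - η
  0≤1-η = p≤q⇒0≤q-p (^≤1 n 0≤¼ (ℚ.≤ᵇ⇒≤ tt))

  module _ (InW : ℕ → Set) (admissible : Admissible InW) (T : List (Assignment n)) (T⊆ : All (λ z → z ⊨ F × InW ∣ z ∣) T)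
           (apart : AllPairs (Apart D) T) where

    private
      s = length T

    -- Whatever the earlier rounds chose, `S` is smaller than the fixed set `T`, so some element of
    -- `T` is far from `S`. The failure bound `η` is therefore uniform in `S`, and the rounds
    -- multiply.
    round-spreads : ∀ j (S : Partial n s (suc j)) → Spread (proj₁ S) → ∀ (φ : Partial n s j → ℚ) v → 0ℚ ℚ.≤ v →
                    (∀ S′ → 0ℚ ℚ.≤ φ S′) → (∀ S′ → Spread (proj₁ S′) → v ℚ.≤ φ S′) →
                    (1ℚ - η) ℚ.* v ℚ.≤ E φ (round P F W (walk-length P n) M j S)
    round-spreads j S (S⊆ , spread) φ v 0≤v 0≤φ v≤φ
      with far-element {D = D} T (proj₁ S) apart (subst (length (proj₁ S) <_) (proj₂ S) (ℕ.m<m+n (length (proj₁ S)) (s≤s z≤n)))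
    ... | z* , z*∈T , far with All.lookup T⊆ z*∈T
    ... | z*⊨F , z*-in with suitable-centre InW admissible (proj₁ S) z* z*⊨F z*-in far
    ... | c , i , c∈ , i≤n , hits = begin
      (1ℚ - η) ℚ.* v ≡⟨ ring v η ⟩
      v - η ℚ.* v ≤⟨ search-finds P F W (proj₁ S) Enough Enough-mono (walk-length P n) M c i success ¼ c∈ i≤n
        (p≤q⇒0≤q-p success≤1) 0≤¼ failure
        (subst (λ t → Hits (candidate κ F t c i) (Suitable P F W (proj₁ S) Enough Enough-mono) success) (sym walk-length≡steps) hits)
        (λ best → φ (extend S best)) v 0≤v (λ best → 0≤φ (extend S best)) (λ best found → v≤φ (extend S best) (extend-spread best found)) ⟩
      E (λ best → φ (extend S best)) (search P F W (walk-length P n) M (proj₁ S))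
        ≡⟨ E-bind φ (search P F W (walk-length P n) M (proj₁ S)) (λ best → pure (extend S best)) ⟨
      E φ (round P F W (walk-length P n) M j S) ∎
      where
      open ℚ.≤-Reasoning
      ring : ∀ v η → (1ℚ - η) ℚ.* v ≡ v - η ℚ.* v
      ring = solve-∀ ringℚ
      extend-spread : ∀ best → Found P F W (proj₁ S) Enough Enough-mono best → Spread (proj₁ (extend S best))
      extend-spread (a , z) ((z⊨F , ok , refl) , 1≤ , enough) = (z⊨F , ok) ∷ S⊆
        , All.tabulate (λ p∈ → ℕ.≤-trans 1≤ (score≤dH z p∈) , Enough-mono (score≤dH z p∈) enough) ∷ spread

    rounds-spread : ∀ j (S : Partial n s j) → Spread (proj₁ S) → ∀ (φ : Partial n s 0 → ℚ) → (∀ S′ → 0ℚ ℚ.≤ φ S′) →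
                    (∀ S′ → Spread (proj₁ S′) → 1ℚ ℚ.≤ φ S′) →
                    (1ℚ - η) ^ℚ j ℚ.≤ E φ (forᴺ (round P F W (walk-length P n) M) j S)
    rounds-spread zero    S spread φ 0≤φ 1≤φ = 1≤φ S spread
    rounds-spread (suc j) S spread φ 0≤φ 1≤φ = begin
      (1ℚ - η) ℚ.* (1ℚ - η) ^ℚ j
        ≤⟨ round-spreads j S spread (λ S′ → E φ (forᴺ (round P F W (walk-length P n) M) j S′)) _ (0≤^ j 0≤1-η)
            (λ S′ → E-≥ 0≤φ (forᴺ (round P F W (walk-length P n) M) j S′)) (λ S′ spread′ → rounds-spread j S′ spread′ φ 0≤φ 1≤φ) ⟩
      E (λ S′ → E φ (forᴺ (round P F W (walk-length P n) M) j S′)) (round P F W (walk-length P n) M j S)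
        ≡⟨ E-bind φ (round P F W (walk-length P n) M j S) (forᴺ (round P F W (walk-length P n) M) j) ⟨
      E φ (forᴺ (round P F W (walk-length P n) M) (suc j) S) ∎
      where open ℚ.≤-Reasoning

    disperse-spreads : ∀ (φ : Partial n s 0 → ℚ) → (∀ S → 0ℚ ℚ.≤ φ S) → (∀ S → Spread (proj₁ S) → 1ℚ ℚ.≤ φ S) →
                       (1ℚ - η) ^ℚ s ℚ.≤ E φ (disperse P F W s)
    disperse-spreads = rounds-spread s ([] , refl) ([] , [])
 

-- Optimal sets

∈-assignments : ∀ {n} (z : Assignment n) → z ∈ assignments n
∈-assignments []          = here refl
∈-assignments (true  ∷ z) = ∈-++⁺ˡ (∈-map⁺ (true ∷_) (∈-assignments z))
∈-assignments (false ∷ z) = ∈-++⁺ʳ _ (∈-map⁺ (false ∷_) (∈-assignments z))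

Unique-assignments : ∀ n → Unique (assignments n)
Unique-assignments zero    = [] ∷ []
Unique-assignments (suc n) = Unique.++⁺ (Unique.map⁺ tail-≡ (Unique-assignments n)) (Unique.map⁺ tail-≡ (Unique-assignments n))
  λ (p , p′) → disjoint (∈-map⁻ (true ∷_) p) (∈-map⁻ (false ∷_) p′)
  where
  tail-≡ : ∀ {b} {y z : Assignment n} → b ∷ y ≡ b ∷ z → y ≡ z
  tail-≡ refl = refl
  disjoint : ∀ {v : Assignment (suc n)} → (∃ λ y → y ∈ assignments n × v ≡ true ∷ y) → ¬ (∃ λ y → y ∈ assignments n × v ≡ false ∷ y)
  disjoint (_ , _ , refl) (_ , _ , ())

length-assignments : ∀ n → length (assignments n) ≡ 2 ^ n
length-assignments zero    = refl
length-assignments (suc n) = begin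
  length (List.map (true ∷_) (assignments n) List.++ List.map (false ∷_) (assignments n))
    ≡⟨ length-++ (List.map (true ∷_) (assignments n)) ⟩
  length (List.map (true ∷_) (assignments n)) + length (List.map (false ∷_) (assignments n))
    ≡⟨ cong₂ _+_ (trans (length-map (true ∷_) (assignments n)) (length-assignments n))
                   (trans (length-map (false ∷_) (assignments n)) (trans (length-assignments n) (sym (ℕ.+-identityʳ _)))) ⟩
  2 ^ suc n ∎
  where open ≡-Reasoning

∈-subsets⁻ : ∀ {X : Set} (xs : List X) {T} → T ∈ subsets xs → All (_∈ xs) T × (Unique xs → Unique T)
∈-subsets⁻ []       (here refl) = [] , λ _ → []
∈-subsets⁻ (x ∷ xs) T∈ with ∈-++⁻ (List.map (x ∷_) (subsets xs)) T∈
... | inj₂ T∈′ with ∈-subsets⁻ xs T∈′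
...   | T⊆ , u = All.map there T⊆ , λ where (_ ∷ uxs) → u uxs
∈-subsets⁻ (x ∷ xs) T∈ | inj₁ T∈′ with ∈-map⁻ (x ∷_) T∈′
... | T′ , T′∈ , refl with ∈-subsets⁻ xs T′∈
...   | T′⊆ , u = here refl ∷ All.map there T′⊆ , λ where (x∉ ∷ uxs) → All.map (All.lookup x∉) T′⊆ ∷ u uxs

take-∈-subsets : ∀ {X : Set} (xs : List X) s → List.take s xs ∈ subsets xs
take-∈-subsets []       zero    = here refl
take-∈-subsets []       (suc s) = here refl
take-∈-subsets (x ∷ xs) zero    = ∈-++⁺ʳ (List.map (x ∷_) (subsets xs)) (take-∈-subsets xs zero)
take-∈-subsets (x ∷ xs) (suc s) = ∈-++⁺ˡ (∈-map⁺ (x ∷_) (take-∈-subsets xs s))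

module _ {n : ℕ} where

  distances : List (Assignment n) → List ℕ
  distances S = List.map (uncurry dH) (List.filter (λ (z , z′) → ¬? (z ≟ᴬ z′)) (List.cartesianProduct S S))

  minPD≤dH : ∀ {S} {z z′ : Assignment n} → z ∈ S → z′ ∈ S → z ≢ z′ → minPD S ≤ dH z z′
  minPD≤dH {S} z∈ z′∈ z≢z′ = All.lookup (min≤xs n (distances S))
    (∈-map⁺ (uncurry dH) (∈-filter⁺ (λ (z , z′) → ¬? (z ≟ᴬ z′)) (∈-cartesianProduct⁺ z∈ z′∈) z≢z′))

  minPD-elim : ∀ (Q : ℕ → Set) S → Q n → (∀ {z z′ : Assignment n} → z ∈ S → z′ ∈ S → z ≢ z′ → Q (dH z z′)) → Q (minPD S)
  minPD-elim Q S qn qd with argmin-sel id n (distances S)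
  ... | inj₁ eq = subst Q (sym eq) qn
  ... | inj₂ m∈ with ∈-map⁻ (uncurry dH) m∈
  ...   | (z , z′) , zz′∈ , eq with ∈-filter⁻ (λ (z , z′) → ¬? (z ≟ᴬ z′)) zz′∈
  ...     | zz′∈SS , z≢z′ = let z∈ , z′∈ = ∈-cartesianProduct⁻ S S zz′∈SS in subst Q (sym eq) (qd z∈ z′∈ z≢z′)

  optimal-set : ∀ (Ω : List (Assignment n)) s → s ≤ length Ω → Unique Ω →
                ∃ λ T → length T ≡ s × All (_∈ Ω) T × Unique T × OptMin Ω s ≤ minPD T
  optimal-set Ω s s≤ uΩ with argmax-sel id 0 (List.map minPD (List.filter (λ S → length S ℕ.≟ s) (subsets Ω)))
  -- The maximum is its starting value 0, so any `s` elements serve.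
  ... | inj₁ eq = List.take s Ω , trans (length-take s Ω) (ℕ.m≤n⇒m⊓n≡m s≤)
    , proj₁ (∈-subsets⁻ Ω (take-∈-subsets Ω s)) , Unique.take⁺ s uΩ , ℕ.≤-trans (ℕ.≤-reflexive eq) z≤n
  ... | inj₂ m∈ with ∈-map⁻ minPD m∈
  ...   | T , T∈ , eq with ∈-filter⁻ (λ S → length S ℕ.≟ s) {xs = subsets Ω} T∈
  ...     | T∈′ , len = T , len , proj₁ (∈-subsets⁻ Ω T∈′) , proj₂ (∈-subsets⁻ Ω T∈′) uΩ , ℕ.≤-reflexive eq

  minPD-apart : ∀ {D} (T : List (Assignment n)) → Unique T → D ≤ minPD T → AllPairs (Apart D) T
  minPD-apart {D} T uT D≤ = go T id uT
    where
    go : ∀ T′ → (∀ {z} → z ∈ T′ → z ∈ T) → Unique T′ → AllPairs (Apart D) T′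
    go []       sub []       = []
    go (t ∷ T′) sub (t∉ ∷ u) =
      All.tabulate (λ t′∈ → let t≢t′ = All.lookup t∉ t′∈ in
        t≢t′ , ℕ.≤-trans D≤ (minPD≤dH (sub (here refl)) (sub (there t′∈)) t≢t′))
      ∷ go T′ (sub ∘ there) u

toAssignment-toList : ∀ {n} (z : Assignment n) → toAssignment n (toList z) ≡ just z
toAssignment-toList []      = refl
toAssignment-toList (b ∷ z) = cong (Maybe.map (b ∷_)) (toAssignment-toList z)

toAssignments-toList : ∀ {n} (S : List (Assignment n)) → toAssignments n (List.map toList S) ≡ just S
toAssignments-toList []      = refl
toAssignments-toList (z ∷ S) rewrite toAssignment-toList z | toAssignments-toList S = refl

1-sη≤ : ∀ s {η} → 0ℚ ℚ.≤ η → η ℚ.≤ 1ℚ → 1ℚ - fromℕ s ℚ.* η ℚ.≤ (1ℚ - η) ^ℚ s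
1-sη≤ zero    {η} 0≤η η≤1 = ℚ.≤-reflexive (ring η)
  where
  ring : ∀ η → 1ℚ - 0ℚ ℚ.* η ≡ 1ℚ
  ring = solve-∀ ringℚ
1-sη≤ (suc s) {η} 0≤η η≤1 = begin
  1ℚ - fromℕ (suc s) ℚ.* η ≡⟨ cong (λ x → 1ℚ - x ℚ.* η) (fromℕ-+ 1 s) ⟩
  1ℚ - (1ℚ ℚ.+ fromℕ s) ℚ.* η ≤⟨ ≤-from-diff (fromℕ s ℚ.* (η ℚ.* η)) (0≤* (0≤fromℕ s) (0≤* 0≤η 0≤η)) (ring (fromℕ s) η) ⟩
  (1ℚ - η) ℚ.* (1ℚ - fromℕ s ℚ.* η) ≤⟨ *-monoˡ-≤ (p≤q⇒0≤q-p η≤1) (1-sη≤ s 0≤η η≤1) ⟩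
  (1ℚ - η) ℚ.* (1ℚ - η) ^ℚ s ∎
  where
  open ℚ.≤-Reasoning
  ring : ∀ S η → 1ℚ - (1ℚ ℚ.+ S) ℚ.* η ℚ.+ S ℚ.* (η ℚ.* η) ≡ (1ℚ - η) ℚ.* (1ℚ - S ℚ.* η)
  ring = solve-∀ ringℚ

n<2^n : ∀ n → n < 2 ^ n
n<2^n zero    = ℕ.≤-refl
n<2^n (suc n) = ℕ.≤-trans (ℕ.+-mono-≤ (ℕ.≤-trans (s≤s z≤n) (n<2^n n)) (n<2^n n)) (ℕ.≤-reflexive (cong (2 ^ n +_) (sym (ℕ.+-identityʳ _))))

-- A positive `ε` is at least the reciprocal of its denominator `N`, and `N < 2 ^ N`.
eventually-small : ∀ ε → 0ℚ ℚ.< ε → ∃ λ N → ∀ n → N ≤ n → ½ ^ℚ n ℚ.≤ ε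
eventually-small ε 0<ε = N , λ n N≤n → ℚ.≤-trans (^-anti-≤ (0≤inv 1) (ℚ.≤ᵇ⇒≤ tt) N≤n) small
  where
  N = ℚ.↧ₙ ε
  numerator≥1 : ∀ ε → 0ℚ ℚ.< ε → 1ℚ ℚ.≤ ε ℚ.* fromℕ (ℚ.↧ₙ ε)
  numerator≥1 ε@(ℚ.mkℚ (ℤ.+ suc m) d-1 _) 0<ε = begin
    1ℚ ≤⟨ fromℕ-mono-≤ {1} {suc m} (s≤s z≤n) ⟩
    fromℕ (suc m) ≡⟨ /-*-fromℕ (suc m) (suc d-1) ⟨
    ((ℤ.+ suc m) ℚ./ suc d-1) ℚ.* fromℕ (suc d-1) ≡⟨ cong (ℚ._* fromℕ (suc d-1)) (ℚ.↥p/↧p≡p ε) ⟩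
    ε ℚ.* fromℕ (suc d-1) ∎
    where open ℚ.≤-Reasoning
  numerator≥1 ε@(ℚ.mkℚ (ℤ.+ 0) d-1 _) (ℚ.*<* (ℤ.+<+ ()))
  numerator≥1 (ℚ.mkℚ ℤ.-[1+ m ] d-1 _) (ℚ.*<* ())
  small : ½ ^ℚ N ℚ.≤ ε
  small = begin
    ½ ^ℚ N ≡⟨ ℚ.*-identityʳ (½ ^ℚ N) ⟨
    ½ ^ℚ N ℚ.* 1ℚ ≤⟨ *-monoˡ-≤ (0≤^ N (0≤inv 1)) (numerator≥1 ε 0<ε) ⟩
    ½ ^ℚ N ℚ.* (ε ℚ.* fromℕ N) ≤⟨ *-monoˡ-≤ (0≤^ N (0≤inv 1)) (*-monoˡ-≤ (ℚ.<⇒≤ 0<ε) (fromℕ-mono-≤ {N} {2 ^ N} (ℕ.<⇒≤ (n<2^n N)))) ⟩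
    ½ ^ℚ N ℚ.* (ε ℚ.* fromℕ (2 ^ N)) ≡⟨ cong (λ x → ½ ^ℚ N ℚ.* (ε ℚ.* x)) (fromℕ-^ 2 N) ⟩
    ½ ^ℚ N ℚ.* (ε ℚ.* fromℕ 2 ^ℚ N) ≡⟨ ring (½ ^ℚ N) ε (fromℕ 2 ^ℚ N) ⟩
    (½ ^ℚ N ℚ.* fromℕ 2 ^ℚ N) ℚ.* ε ≡⟨ cong (ℚ._* ε) (trans (sym (^-distrib-* ½ (fromℕ 2) N)) (1^ N)) ⟩
    1ℚ ℚ.* ε ≡⟨ ℚ.*-identityˡ ε ⟩
    ε ∎
    where
    open ℚ.≤-Reasoning
    ring : ∀ a b c → a ℚ.* (b ℚ.* c) ≡ (a ℚ.* c) ℚ.* b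
    ring = solve-∀ ringℚ

-- 2ⁿ rounds fail with probability at most 4⁻ⁿ each.
union-bound : ∀ n s → s ≤ 2 ^ n → 1ℚ - ½ ^ℚ n ℚ.≤ (1ℚ - (½ ℚ.* ½) ^ℚ n) ^ℚ s
union-bound n s s≤ = ℚ.≤-trans (ℚ.+-monoʳ-≤ 1ℚ (ℚ.neg-antimono-≤ (begin
  fromℕ s ℚ.* (½ ℚ.* ½) ^ℚ n ≤⟨ *-monoʳ-≤ 0≤η (fromℕ-mono-≤ {s} {2 ^ n} s≤) ⟩
  fromℕ (2 ^ n) ℚ.* (½ ℚ.* ½) ^ℚ n ≡⟨ cong₂ ℚ._*_ (fromℕ-^ 2 n) (^-distrib-* ½ ½ n) ⟩
  fromℕ 2 ^ℚ n ℚ.* (½ ^ℚ n ℚ.* ½ ^ℚ n) ≡⟨ ℚ.*-assoc (fromℕ 2 ^ℚ n) (½ ^ℚ n) (½ ^ℚ n) ⟨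
  fromℕ 2 ^ℚ n ℚ.* ½ ^ℚ n ℚ.* ½ ^ℚ n ≡⟨ cong (ℚ._* ½ ^ℚ n) (trans (sym (^-distrib-* (fromℕ 2) ½ n)) (1^ n)) ⟩
  1ℚ ℚ.* ½ ^ℚ n ≡⟨ ℚ.*-identityˡ (½ ^ℚ n) ⟩
  ½ ^ℚ n ∎)))
  (1-sη≤ s 0≤η (^≤1 n (0≤* (0≤inv 1) (0≤inv 1)) (ℚ.≤ᵇ⇒≤ tt)))
  where
  open ℚ.≤-Reasoning
  0≤η : 0ℚ ℚ.≤ (½ ℚ.* ½) ^ℚ n
  0≤η = 0≤^ n (0≤* (0≤inv 1) (0≤inv 1))

-- The running time

Polynomial : (ℕ → ℕ) → Set
Polynomial f = ∃ λ c → ∀ n → 1 ≤ n → f n ≤ c * n ^ c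

1≤^ : ∀ {n} m → 1 ≤ n → 1 ≤ n ^ m
1≤^ {n} m 1≤n = ℕ.≤-trans (ℕ.≤-reflexive (sym (ℕ.^-zeroˡ m))) (ℕ.^-monoˡ-≤ m 1≤n)

^-mono-exponent : ∀ {n a b} → 1 ≤ n → a ≤ b → n ^ a ≤ n ^ b
^-mono-exponent {n} 1≤n = ℕ.^-monoʳ-≤ n {{ℕ.>-nonZero 1≤n}}

poly-const : ∀ c → Polynomial (λ _ → c)
poly-const c = c , λ n 1≤n → ℕ.≤-trans (ℕ.≤-reflexive (sym (ℕ.*-identityʳ c))) (ℕ.*-monoʳ-≤ c (1≤^ c 1≤n))

poly-id : Polynomial id
poly-id = 1 , λ n _ → ℕ.≤-reflexive (sym (trans (ℕ.*-identityˡ (n * 1)) (ℕ.*-identityʳ n)))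

poly-+ : ∀ {f g} → Polynomial f → Polynomial g → Polynomial (λ n → f n + g n)
poly-+ {f} {g} (a , f≤) (b , g≤) = a + b , λ n 1≤n → begin
  f n + g n ≤⟨ ℕ.+-mono-≤ (f≤ n 1≤n) (g≤ n 1≤n) ⟩
  a * n ^ a + b * n ^ b ≤⟨ ℕ.+-mono-≤ (ℕ.*-monoʳ-≤ a (^-mono-exponent 1≤n (ℕ.m≤m+n a b))) (ℕ.*-monoʳ-≤ b (^-mono-exponent 1≤n (ℕ.m≤n+m b a))) ⟩
  a * n ^ (a + b) + b * n ^ (a + b) ≡⟨ ℕ.*-distribʳ-+ (n ^ (a + b)) a b ⟨
  (a + b) * n ^ (a + b) ∎
  where open ℕ.≤-Reasoning

poly-* : ∀ {f g} → Polynomial f → Polynomial g → Polynomial (λ n → f n * g n)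
poly-* {f} {g} (a , f≤) (b , g≤) = c , λ n 1≤n → begin
  f n * g n ≤⟨ ℕ.*-mono-≤ (f≤ n 1≤n) (g≤ n 1≤n) ⟩
  (a * n ^ a) * (b * n ^ b) ≡⟨ eq a b (n ^ a) (n ^ b) ⟩
  (a * b) * (n ^ a * n ^ b) ≡⟨ cong (a * b *_) (ℕ.^-distribˡ-+-* n a b) ⟨
  (a * b) * n ^ (a + b) ≤⟨ ℕ.*-mono-≤ (ℕ.m≤m+n (a * b) (a + b)) (^-mono-exponent 1≤n (ℕ.m≤n+m (a + b) (a * b))) ⟩
  c * n ^ c ∎
  where
  open ℕ.≤-Reasoning
  c = a * b + (a + b)
  eq : ∀ a b x y → (a * x) * (b * y) ≡ (a * b) * (x * y)
  eq = ℕ-Solver.solve-∀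

poly-^ : ∀ {f} e → Polynomial f → Polynomial (λ n → f n ^ e)
poly-^ zero    p = poly-const 1
poly-^ (suc e) p = poly-* p (poly-^ e p)

-- Partial sums of the exponential series

0≤expTerm : ∀ {x} j → 0ℚ ℚ.≤ x → 0ℚ ℚ.≤ expTerm x j
0≤expTerm zero    0≤x = 0≤fromℕ 1
0≤expTerm (suc j) 0≤x = 0≤* (0≤* (0≤expTerm j 0≤x) 0≤x) (0≤inv j)

-- The j-th term is increasing with derivative the (j-1)-st.
expTerm-step : ∀ a b j → 0ℚ ℚ.≤ a → a ℚ.≤ b → expTerm b (suc j) ℚ.≤ expTerm a (suc j) ℚ.+ (b - a) ℚ.* expTerm b j
expTerm-step a b zero    0≤a a≤b = ℚ.≤-reflexive (ring a b)
  where
  ring : ∀ a b → 1ℚ ℚ.* b ℚ.* 1ℚ ≡ 1ℚ ℚ.* a ℚ.* 1ℚ ℚ.+ (b - a) ℚ.* 1ℚ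
  ring = solve-∀ ringℚ
expTerm-step a b (suc j) 0≤a a≤b = begin
  T₂ ℚ.* b ℚ.* i
    ≡⟨ ring₁ T₂ a b i ⟩
  i ℚ.* ((b - a) ℚ.* T₂ ℚ.+ a ℚ.* T₂)
    ≤⟨ *-monoˡ-≤ (0≤inv (suc j)) (ℚ.+-monoʳ-≤ ((b - a) ℚ.* T₂) (*-monoˡ-≤ 0≤a (expTerm-step a b j 0≤a a≤b))) ⟩
  i ℚ.* ((b - a) ℚ.* T₂ ℚ.+ a ℚ.* (A₂ ℚ.+ (b - a) ℚ.* T₁))
    ≡⟨ ring₂ T₁ T₂ A₂ a b i ⟩
  i ℚ.* ((b - a) ℚ.* T₂ ℚ.+ a ℚ.* A₂ ℚ.+ (b - a) ℚ.* (a ℚ.* T₁))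
    ≤⟨ *-monoˡ-≤ (0≤inv (suc j)) (ℚ.+-monoʳ-≤ ((b - a) ℚ.* T₂ ℚ.+ a ℚ.* A₂) (*-monoˡ-≤ (p≤q⇒0≤q-p a≤b)
        (ℚ.≤-trans (*-monoʳ-≤ (0≤expTerm j 0≤b) a≤b) (ℚ.≤-reflexive scale)))) ⟩
  i ℚ.* ((b - a) ℚ.* T₂ ℚ.+ a ℚ.* A₂ ℚ.+ (b - a) ℚ.* (J ℚ.* T₂))
    ≡⟨ ring₃ T₂ A₂ J a b i ⟩
  A₂ ℚ.* a ℚ.* i ℚ.+ (i ℚ.* (1ℚ ℚ.+ J)) ℚ.* ((b - a) ℚ.* T₂)
    ≡⟨ cong (A₂ ℚ.* a ℚ.* i ℚ.+_) (trans (cong (ℚ._* ((b - a) ℚ.* T₂)) (trans (cong (i ℚ.*_) (sym (fromℕ-+ 1 (suc j)))) (inv-* (suc j)))) (ℚ.*-identityˡ _)) ⟩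
  A₂ ℚ.* a ℚ.* i ℚ.+ (b - a) ℚ.* T₂ ∎
  where
  open ℚ.≤-Reasoning
  0≤b = ℚ.≤-trans 0≤a a≤b
  i = inv (suc j)
  J = fromℕ (suc j)
  T₁ = expTerm b j
  T₂ = expTerm b (suc j)
  A₂ = expTerm a (suc j)
  scale : b ℚ.* T₁ ≡ J ℚ.* T₂
  scale = trans (sym (ℚ.*-identityʳ (b ℚ.* T₁))) (trans (cong (b ℚ.* T₁ ℚ.*_) (sym (inv-* j))) (ring (inv j) J b T₁))
    where
    ring : ∀ i J b T → b ℚ.* T ℚ.* (i ℚ.* J) ≡ J ℚ.* (T ℚ.* b ℚ.* i)
    ring = solve-∀ ringℚ
  ring₁ : ∀ T a b i → T ℚ.* b ℚ.* i ≡ i ℚ.* ((b - a) ℚ.* T ℚ.+ a ℚ.* T)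
  ring₁ = solve-∀ ringℚ
  ring₂ : ∀ T₁ T₂ A a b i → i ℚ.* ((b - a) ℚ.* T₂ ℚ.+ a ℚ.* (A ℚ.+ (b - a) ℚ.* T₁)) ≡ i ℚ.* ((b - a) ℚ.* T₂ ℚ.+ a ℚ.* A ℚ.+ (b - a) ℚ.* (a ℚ.* T₁))
  ring₂ = solve-∀ ringℚ
  ring₃ : ∀ T A J a b i → i ℚ.* ((b - a) ℚ.* T ℚ.+ a ℚ.* A ℚ.+ (b - a) ℚ.* (J ℚ.* T)) ≡ A ℚ.* a ℚ.* i ℚ.+ (i ℚ.* (1ℚ ℚ.+ J)) ℚ.* ((b - a) ℚ.* T)
  ring₃ = solve-∀ ringℚ

expSum-step : ∀ a b m → 0ℚ ℚ.≤ a → a ℚ.≤ b → expSum b (suc m) ℚ.≤ expSum a (suc m) ℚ.+ (b - a) ℚ.* expSum b m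
expSum-step a b zero    0≤a a≤b = ℚ.≤-reflexive (ring a b)
  where
  ring : ∀ a b → 0ℚ ℚ.+ 1ℚ ≡ 0ℚ ℚ.+ 1ℚ ℚ.+ (b - a) ℚ.* 0ℚ
  ring = solve-∀ ringℚ
expSum-step a b (suc m) 0≤a a≤b = ℚ.≤-trans
  (ℚ.+-mono-≤ (expSum-step a b m 0≤a a≤b) (expTerm-step a b m 0≤a a≤b))
  (ℚ.≤-reflexive (ring (expSum a (suc m)) (b - a) (expSum b m) (expTerm a (suc m)) (expTerm b m)))
  where
  ring : ∀ x d s t u → x ℚ.+ d ℚ.* s ℚ.+ (t ℚ.+ d ℚ.* u) ≡ x ℚ.+ t ℚ.+ d ℚ.* (s ℚ.+ u)
  ring = solve-∀ ringℚ

-- The version of `1 - d ≤ e⁻ᵈ` for partial sums, with `d = b - a`; it lets the exponent be lowered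
-- by small amounts without multiplying series.
expSum-≤ : ∀ a b m → 0ℚ ℚ.≤ a → a ℚ.≤ b → expSum b m ℚ.* (1ℚ - (b - a)) ℚ.≤ expSum a m
expSum-≤ a b zero    0≤a a≤b = ℚ.≤-reflexive (ℚ.*-zeroˡ (1ℚ - (b - a)))
expSum-≤ a b (suc m) 0≤a a≤b = begin
  S ℚ.* (1ℚ - d) ≡⟨ ring₁ S d ⟩
  S - d ℚ.* S ≤⟨ ℚ.+-monoˡ-≤ (- (d ℚ.* S)) (ℚ.≤-trans (expSum-step a b m 0≤a a≤b)
    (ℚ.+-monoʳ-≤ (expSum a (suc m)) (*-monoˡ-≤ (p≤q⇒0≤q-p a≤b) (p≤p+r (expSum b m) (0≤expTerm m (ℚ.≤-trans 0≤a a≤b)))))) ⟩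
  expSum a (suc m) ℚ.+ d ℚ.* S - d ℚ.* S ≡⟨ ring₂ (expSum a (suc m)) (d ℚ.* S) ⟩
  expSum a (suc m) ∎
  where
  open ℚ.≤-Reasoning
  d = b - a
  S = expSum b (suc m)
  ring₁ : ∀ s d → s ℚ.* (1ℚ - d) ≡ s - d ℚ.* s
  ring₁ = solve-∀ ringℚ
  ring₂ : ∀ x y → x ℚ.+ y - y ≡ x
  ring₂ = solve-∀ ringℚ

expTerm-0 : ∀ j → expTerm 0ℚ (suc j) ≡ 0ℚ
expTerm-0 j = trans (cong (ℚ._* inv j) (ℚ.*-zeroʳ (expTerm 0ℚ j))) (ℚ.*-zeroˡ (inv j))

expSum-0 : ∀ m → expSum 0ℚ m ℚ.≤ 1ℚ
expSum-0 zero          = 0≤fromℕ 1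
expSum-0 (suc zero)    = ℚ.≤-refl
expSum-0 (suc (suc m)) = ℚ.≤-trans (ℚ.≤-reflexive (trans (cong (expSum 0ℚ (suc m) ℚ.+_) (expTerm-0 m)) (ℚ.+-identityʳ _))) (expSum-0 (suc m))

-- This expresses `(1 - x)ⁿ ≤ e^(-n x)`: each of the `n` factors `1 - x` lowers the exponent by `x`.
expSum-multiple : ∀ x n m → 0ℚ ℚ.≤ x → x ℚ.≤ 1ℚ → expSum (fromℕ n ℚ.* x) m ℚ.* (1ℚ - x) ^ℚ n ℚ.≤ 1ℚ
expSum-multiple x zero    m 0≤x x≤1 = ℚ.≤-trans (ℚ.≤-reflexive (trans (ℚ.*-identityʳ _) (cong (λ y → expSum y m) (ℚ.*-zeroˡ x)))) (expSum-0 m)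
expSum-multiple x (suc n) m 0≤x x≤1 = begin
  S ℚ.* ((1ℚ - x) ℚ.* X) ≡⟨ ℚ.*-assoc S (1ℚ - x) X ⟨
  S ℚ.* (1ℚ - x) ℚ.* X ≡⟨ cong (λ y → S ℚ.* (1ℚ - y) ℚ.* X) difference ⟩
  S ℚ.* (1ℚ - (fromℕ (suc n) ℚ.* x - fromℕ n ℚ.* x)) ℚ.* X ≤⟨ *-monoʳ-≤ (0≤^ n (p≤q⇒0≤q-p x≤1))
    (expSum-≤ (fromℕ n ℚ.* x) (fromℕ (suc n) ℚ.* x) m (0≤* (0≤fromℕ n) 0≤x) (*-monoʳ-≤ 0≤x (fromℕ-mono-≤ {n} {suc n} (ℕ.n≤1+n n)))) ⟩
  expSum (fromℕ n ℚ.* x) m ℚ.* X ≤⟨ expSum-multiple x n m 0≤x x≤1 ⟩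
  1ℚ ∎
  where
  open ℚ.≤-Reasoning
  S = expSum (fromℕ (suc n) ℚ.* x) m
  X = (1ℚ - x) ^ℚ n
  difference : x ≡ fromℕ (suc n) ℚ.* x - fromℕ n ℚ.* x
  difference = trans (ring x (fromℕ n)) (cong (λ y → y ℚ.* x - fromℕ n ℚ.* x) (sym (fromℕ-+ 1 n)))
    where
    ring : ∀ x N → x ≡ (1ℚ ℚ.+ N) ℚ.* x - N ℚ.* x
    ring = solve-∀ ringℚ

0≤expSum : ∀ {x} m → 0ℚ ℚ.≤ x → 0ℚ ℚ.≤ expSum x m
0≤expSum zero    0≤x = ℚ.≤-refl
0≤expSum (suc m) 0≤x = 0≤+ (0≤expSum m 0≤x) (0≤expTerm m 0≤x)

module Schoening (k′ α β γ ζ : ℕ) where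

  open Potential k′ 0

  P : Params
  P = schoening k′ α β γ ζ

  κ<growth : Params.literal-range P < Params.growth P
  κ<growth = ℕ.m<m+n κ (s≤s z≤n)

  -- All quantities that the specification of the program wants bounded by `B`; their sum is taken
  -- as `B`.
  sizes : ℕ → ℕ → List ℕ
  sizes d n = suc n ∷ k ∷ α ∷ β ∷ γ ∷ ζ ∷ d * n ^ d ∷ walk-length P n ∷ n * ζ + (n * γ + 0) ∷
              Params.walk-rate P ∷ Params.trial-rate P ∷ Params.growth P ∷ []

  ∈⇒≤sum : ∀ {x xs} → x ∈ xs → x ≤ sum xs
  ∈⇒≤sum {xs = x ∷ xs} (here refl) = ℕ.m≤m+n x (sum xs)
  ∈⇒≤sum {xs = y ∷ xs} (there x∈)  = ℕ.≤-trans (∈⇒≤sum x∈) (ℕ.m≤n+m (sum xs) y)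

  abstract
    size : ℕ → ℕ → ℕ
    size d n = sum (sizes d n)

    ≤size : ∀ {x} d n → x ∈ sizes d n → x ≤ size d n
    ≤size d n = ∈⇒≤sum

    size-polynomial : ∀ d → Polynomial (size d)
    size-polynomial d =
      poly-+ (poly-+ (poly-const 1) poly-id) (poly-+ (poly-const k) (poly-+ (poly-const α) (poly-+ (poly-const β)
      (poly-+ (poly-const γ) (poly-+ (poly-const ζ) (poly-+ (poly-* (poly-const d) (poly-^ d poly-id))
      (poly-+ (poly-+ (poly-* poly-id (poly-const (Params.walk-rate P))) (poly-const 0))
      (poly-+ (poly-+ (poly-* poly-id (poly-const ζ)) (poly-+ (poly-* poly-id (poly-const γ)) (poly-const 0)))
      (poly-+ (poly-const (Params.walk-rate P)) (poly-+ (poly-const (Params.trial-rate P)) (poly-+ (poly-const (Params.growth P)) (poly-const 0))))))))))))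

  module _ {d n : ℕ} (I : Input k d n) where

    open Input I

    1≤n : 1 ≤ n
    1≤n = ℕ.≤-trans 1≤W W≤n

    input-bounds : Bounds (size d n) P F W (walk-length P n)
    input-bounds = record
      { 1+n≤ = ≤size d n #0
      ; κ≤   = ℕ.≤-trans (ℕ.n≤1+n κ) (≤size d n #1)
      ; α≤   = ≤size d n #2
      ; β≤   = ≤size d n #3
      ; γ≤   = ≤size d n #4
      ; ζ≤   = ≤size d n #5
      ; W≤   = ℕ.≤-trans W≤n (ℕ.≤-trans (ℕ.n≤1+n n) (≤size d n #0))
      ; T≤   = ≤size d n #7
      ; F≤   = ℕ.≤-trans clauses (≤size d n #6)
      ; C≤   = λ C∈ → ℕ.≤-trans (All.lookup isKCNF C∈) (≤size d n #1)
      ; lin≤ = λ w≤n → ℕ.≤-trans (ℕ.+-mono-≤ (ℕ.*-monoˡ-≤ ζ W≤n) (ℕ.+-monoˡ-≤ 0 (ℕ.*-monoˡ-≤ γ w≤n))) (≤size d n (there #7))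
      }

    time : ℕ
    time = suc (program-σ s (trials P n)) * (8 + size d n) ^ time-exponent

    simulation : Sim partial-rep time (execute time (algorithm P) I) (disperse P F W s)
    simulation = algorithm-spec input-bounds (≤size d n (there (there #7))) (≤size d n (there (there (there #7))))
      (≤size d n (there (there (there (there #7))))) κ<growth s .run time ℕ.≤-refl

  -- Rounding up in a growth step acts like an increase of `x` by at most `k`. Since growth exceeds
  -- `k`, later steps keep these contributions within the polynomial summand `m * k`.
  trials-upper : ∀ m x → k ^ m * foldᴺ (grow κ (2 * κ)) m x ≤ (2 * κ) ^ m * (x + m * k)
  trials-upper zero    x = ℕ.*-monoʳ-≤ 1 (ℕ.m≤m+n x 0)
  trials-upper (suc m) x = begin
    k * k ^ m * M′ ≡⟨ ℕ.*-assoc k (k ^ m) M′ ⟩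
    k * (k ^ m * M′) ≤⟨ ℕ.*-monoʳ-≤ k (trials-upper m (grow κ A x)) ⟩
    k * (A ^ m * (grow κ A x + m * k)) ≡⟨ ring₁ k (A ^ m) (grow κ A x) (m * k) ⟩
    A ^ m * (k * grow κ A x + k * (m * k)) ≤⟨ ℕ.*-monoʳ-≤ (A ^ m) (ℕ.+-mono-≤ (grow-upper κ A x) (ℕ.*-monoˡ-≤ (m * k) κ<growth)) ⟩
    A ^ m * (A * (x + k) + A * (m * k)) ≡⟨ ring₂ A (A ^ m) x k m ⟩
    A * A ^ m * (x + suc m * k) ∎
    where
    open ℕ.≤-Reasoning
    A = 2 * κ
    M′ = foldᴺ (grow κ A) m (grow κ A x)
    ring₁ : ∀ k a g m → k * (a * (g + m)) ≡ a * (k * g + k * m)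
    ring₁ = ℕ-Solver.solve-∀
    ring₂ : ∀ A a x k m → a * (A * (x + k) + A * (m * k)) ≡ A * a * (x + suc m * k)
    ring₂ = ℕ-Solver.solve-∀

  prefactor : ℕ → ℕ
  prefactor n = (n * Params.trial-rate P + 0) + n * k

  0<fromℕ-^ : ∀ m → 0ℚ ℚ.< fromℕ (k ^ m)
  0<fromℕ-^ m = ℚ.positive⁻¹ (fromℕ (k ^ m)) {{ℚ.normalize-pos (k ^ m) 1 {{_}} {{ℕ.m^n≢0 k m}}}}

  κ^n*expSum≤k^n : ∀ n m → fromℕ (κ ^ n) ℚ.* expSum (fromℕ n ℚ.* p) m ℚ.≤ fromℕ (k ^ n)
  κ^n*expSum≤k^n n m = begin
    fromℕ (κ ^ n) ℚ.* S
      ≡⟨ cong (ℚ._* S) κ^n ⟩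
    (1ℚ - p) ^ℚ n ℚ.* fromℕ (k ^ n) ℚ.* S
      ≡⟨ ring ((1ℚ - p) ^ℚ n) (fromℕ (k ^ n)) S ⟩
    S ℚ.* (1ℚ - p) ^ℚ n ℚ.* fromℕ (k ^ n)
      ≤⟨ *-monoʳ-≤ (0≤fromℕ (k ^ n)) (expSum-multiple p n m 0≤p (inv-≤ κ)) ⟩
    1ℚ ℚ.* fromℕ (k ^ n)
      ≡⟨ ℚ.*-identityˡ _ ⟩
    fromℕ (k ^ n) ∎
    where
    open ℚ.≤-Reasoning
    S = expSum (fromℕ n ℚ.* p) m
    ring : ∀ a b c → a ℚ.* b ℚ.* c ≡ c ℚ.* a ℚ.* b
    ring = solve-∀ ringℚ
    κ≡ : fromℕ κ ≡ (1ℚ - p) ℚ.* fromℕ k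
    κ≡ = sym (trans (ring′ p (fromℕ k)) (trans (cong₂ _-_ (fromℕ-+ 1 κ) (inv-* κ)) (ring″ (fromℕ κ))))
      where
      ring′ : ∀ p K → (1ℚ - p) ℚ.* K ≡ K - p ℚ.* K
      ring′ = solve-∀ ringℚ
      ring″ : ∀ x → 1ℚ ℚ.+ x - 1ℚ ≡ x
      ring″ = solve-∀ ringℚ
    κ^n : fromℕ (κ ^ n) ≡ (1ℚ - p) ^ℚ n ℚ.* fromℕ (k ^ n)
    κ^n = trans (fromℕ-^ κ n) (trans (cong (_^ℚ n) κ≡) (trans (^-distrib-* (1ℚ - p) (fromℕ k) n) (cong ((1ℚ - p) ^ℚ n ℚ.*_) (sym (fromℕ-^ k n)))))

  trials*expSum : ∀ n m → fromℕ (trials P n) ℚ.* expSum (fromℕ n ℚ.* p) m ℚ.≤ fromℕ (2 ^ n * prefactor n)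
  trials*expSum n m = *-cancelˡ-≤ (0<fromℕ-^ n) (begin
    fromℕ (k ^ n) ℚ.* (fromℕ M ℚ.* S)
      ≡⟨ trans (cong (ℚ._* S) (fromℕ-* (k ^ n) M)) (ℚ.*-assoc (fromℕ (k ^ n)) (fromℕ M) S) ⟨
    fromℕ (k ^ n * M) ℚ.* S
      ≤⟨ *-monoʳ-≤ 0≤S (fromℕ-mono-≤ {k ^ n * M} {(2 * κ) ^ n * prefactor n} (trials-upper n (n * Params.trial-rate P + 0))) ⟩
    fromℕ ((2 * κ) ^ n * prefactor n) ℚ.* S
      ≡⟨ cong (λ x → fromℕ x ℚ.* S) (trans (cong (_* prefactor n) (*-^ 2 κ n)) (ring₁ (2 ^ n) (κ ^ n) (prefactor n))) ⟩
    fromℕ (2 ^ n * prefactor n * κ ^ n) ℚ.* S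
      ≡⟨ trans (cong (ℚ._* S) (fromℕ-* (2 ^ n * prefactor n) (κ ^ n))) (ℚ.*-assoc G (fromℕ (κ ^ n)) S) ⟩
    G ℚ.* (fromℕ (κ ^ n) ℚ.* S)
      ≤⟨ *-monoˡ-≤ (0≤fromℕ (2 ^ n * prefactor n)) (κ^n*expSum≤k^n n m) ⟩
    G ℚ.* fromℕ (k ^ n)
      ≡⟨ ℚ.*-comm G (fromℕ (k ^ n)) ⟩
    fromℕ (k ^ n) ℚ.* G ∎)
    where
    open ℚ.≤-Reasoning
    M = trials P n
    S = expSum (fromℕ n ℚ.* p) m
    G = fromℕ (2 ^ n * prefactor n)
    0≤S : 0ℚ ℚ.≤ S
    0≤S = 0≤expSum m (0≤* (0≤fromℕ n) 0≤p)
    ring₁ : ∀ a b c → a * b * c ≡ a * c * b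
    ring₁ = ℕ-Solver.solve-∀

  program-σ≤ : ∀ s M → 1 ≤ s → 1 ≤ M → suc (program-σ s M) ≤ 24 * s ^ 3 * M
  program-σ≤ s M 1≤s 1≤M = begin
    suc (program-σ s M)
      ≡⟨ eq₁ s M ⟩
    (1 + s) * ((2 + s) * ((1 + M) * (1 + s)))
      ≤⟨ ℕ.*-mono-≤ 1+s≤ (ℕ.*-mono-≤ (ℕ.+-monoˡ-≤ s (ℕ.+-mono-≤ 1≤s 1≤s)) (ℕ.*-mono-≤ (ℕ.+-monoˡ-≤ M 1≤M) 1+s≤)) ⟩
    (s + s) * ((s + s + s) * ((M + M) * (s + s)))
      ≡⟨ eq₂ s M ⟩
    24 * s ^ 3 * M ∎
    where
    open ℕ.≤-Reasoning
    1+s≤ : 1 + s ≤ s + s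
    1+s≤ = ℕ.+-monoˡ-≤ s 1≤s
    eq₁ : ∀ s M → suc (s + M * suc s + suc s * suc (s + M * suc s) + s * suc (s + M * suc s + suc s * suc (s + M * suc s)))
          ≡ (1 + s) * ((2 + s) * ((1 + M) * (1 + s)))
    eq₁ = ℕ-Solver.solve-∀
    eq₂ : ∀ s M → (s + s) * ((s + s + s) * ((M + M) * (s + s))) ≡ 24 * (s * (s * (s * 1))) * M
    eq₂ = ℕ-Solver.solve-∀

  time-bound : ℕ → ℕ → ℕ
  time-bound d n = 24 * prefactor n * (8 + size d n) ^ time-exponent

  time-bound-polynomial : ∀ d → Polynomial (time-bound d)
  time-bound-polynomial d = poly-* (poly-* (poly-const 24) (poly-+ (poly-+ (poly-* poly-id (poly-const (Params.trial-rate P))) (poly-const 0)) (poly-* poly-id (poly-const k))))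
    (poly-^ time-exponent (poly-+ (poly-const 8) (size-polynomial d)))

  1≤trials : ∀ n → 1 ≤ n → 1 ≤ trials P n
  1≤trials n 1≤n = ℕ.≤-trans (ℕ.≤-trans (ℕ.*-mono-≤ {1} {n} {1} {48 * k} 1≤n (ℕ.*-mono-≤ {1} {48} {1} {k} (s≤s z≤n) (s≤s z≤n))) (ℕ.≤-reflexive (ring n k)))
                             (foldᴺ-grow-≥ κ (2 * κ) n _ κ<growth)
    where
    ring : ∀ n k → n * (48 * k) ≡ n * (48 * k) + 0
    ring = ℕ-Solver.solve-∀

  time*expSum : ∀ n s Q m → 1 ≤ n → 1 ≤ s →
    fromℕ (suc (program-σ s (trials P n)) * Q) ℚ.* expSum (fromℕ n ℚ.* p) m ℚ.≤
    fromℕ (24 * prefactor n * Q * (s ^ 3 * 2 ^ n))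
  time*expSum n s Q m 1≤n 1≤s = begin
    fromℕ (suc (program-σ s M) * Q) ℚ.* S
      ≤⟨ *-monoʳ-≤ (0≤expSum m (0≤* (0≤fromℕ n) 0≤p)) (fromℕ-mono-≤ {suc (program-σ s M) * Q} {24 * s ^ 3 * M * Q}
          (ℕ.*-monoˡ-≤ Q (program-σ≤ s M 1≤s (1≤trials n 1≤n)))) ⟩
    fromℕ (24 * s ^ 3 * M * Q) ℚ.* S
      ≡⟨ cong (λ x → fromℕ x ℚ.* S) (ring₁ (s ^ 3) M Q) ⟩
    fromℕ (24 * s ^ 3 * Q * M) ℚ.* S
      ≡⟨ trans (cong (ℚ._* S) (fromℕ-* (24 * s ^ 3 * Q) M)) (ℚ.*-assoc (fromℕ (24 * s ^ 3 * Q)) (fromℕ M) S) ⟩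
    fromℕ (24 * s ^ 3 * Q) ℚ.* (fromℕ M ℚ.* S)
      ≤⟨ *-monoˡ-≤ (0≤fromℕ (24 * s ^ 3 * Q)) (trials*expSum n m) ⟩
    fromℕ (24 * s ^ 3 * Q) ℚ.* fromℕ (2 ^ n * prefactor n)
      ≡⟨ fromℕ-* (24 * s ^ 3 * Q) (2 ^ n * prefactor n) ⟨
    fromℕ (24 * s ^ 3 * Q * (2 ^ n * prefactor n))
      ≡⟨ cong fromℕ (ring₂ (s ^ 3) Q (2 ^ n) (prefactor n)) ⟩
    fromℕ (24 * prefactor n * Q * (s ^ 3 * 2 ^ n)) ∎
    where
    open ℚ.≤-Reasoning
    M = trials P n
    S = expSum (fromℕ n ℚ.* p) m
    ring₁ : ∀ a M Q → 24 * a * M * Q ≡ 24 * a * Q * M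
    ring₁ = ℕ-Solver.solve-∀
    ring₂ : ∀ a Q t p → 24 * a * Q * (t * p) ≡ 24 * p * Q * (a * t)
    ring₂ = ℕ-Solver.solve-∀

  module _ .{{_ : ℕ.NonZero k}} where

    n/k : ∀ n → (ℤ.+ n) ℚ./ k ≡ fromℕ n ℚ.* p
    n/k n = *-cancelʳ-≡ (ℚ.positive⁻¹ (fromℕ k) {{ℚ.normalize-pos k 1}}) (trans (/-*-fromℕ n k)
      (sym (trans (ℚ.*-assoc (fromℕ n) p (fromℕ k)) (trans (cong (fromℕ n ℚ.*_) (inv-* κ)) (ℚ.*-identityʳ (fromℕ n))))))

    runs-in-time : RunsInTime k (algorithm P)
    runs-in-time d = proj₁ poly , λ n I → time I , time I , Sim-halts (simulation I) , λ m → begin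
      fromℕ (time I) ℚ.* expSum ((ℤ.+ n) ℚ./ k) m
        ≡⟨ cong (λ x → fromℕ (time I) ℚ.* expSum x m) (n/k n) ⟩
      fromℕ (time I) ℚ.* expSum (fromℕ n ℚ.* p) m
        ≤⟨ time*expSum n (Input.s I) ((8 + size d n) ^ time-exponent) m (1≤n I) (Input.1≤s I) ⟩
      fromℕ (time-bound d n * (Input.s I ^ 3 * 2 ^ n))
        ≤⟨ fromℕ-mono-≤ {time-bound d n * (Input.s I ^ 3 * 2 ^ n)} {proj₁ poly * n ^ proj₁ poly * (Input.s I ^ 3 * 2 ^ n)}
            (ℕ.*-monoˡ-≤ (Input.s I ^ 3 * 2 ^ n) (proj₂ poly n (1≤n I))) ⟩
      fromℕ (proj₁ poly * n ^ proj₁ poly * (Input.s I ^ 3 * 2 ^ n)) ∎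
      where
      open ℚ.≤-Reasoning
      poly = time-bound-polynomial d

-- The two weight constraints

-- What the analysis needs about Ω F (W): a constraint on the weight that is
-- decided up to a factor 1 ± δ by the test of P.
record Direction (k′ : ℕ) (P : Params) (Ω : ∀ {n} → CNF n → ℚ → List (Assignment n)) (w : ℚ) : Set₁ where
  field
    InW        : ℕ → ℕ → Set
    members    : ∀ {n} {F : CNF n} W {z} → z ∈ Ω F (fromℕ W) → z ⊨ F × InW W ∣ z ∣
    target     : ∀ {n} {F : CNF n} W {z} → z ⊨ F → excess P W ∣ z ∣ ≡ 0 → z ∈ Ω F (w ℚ.* fromℕ W)
    unique     : ∀ {n} (F : CNF n) x → Unique (Ω F x)
    length≤2^n : ∀ {n} (F : CNF n) x → length (Ω F x) ≤ 2 ^ n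
    admissible : ∀ {W w* w e} → InW W w* → w* ≤ w + e → w ≤ w* + e →
                 e ≡ 0 ⊎ suc k′ * suc k′ * e ≤ 4 * (2 + k′) * w* → excess P W w ≡ 0

module _ (k′ : ℕ) (3≤k : 3 ≤ 3 + k′) where

  private
    a b : ℕ
    a = 4 * (2 + k′)
    b = suc k′ * suc k′

    d : ℚ
    d = δ (3 + k′) 3≤k

    0<b : 0ℚ ℚ.< fromℕ b
    0<b = ℚ.positive⁻¹ (fromℕ b) {{ℚ.normalize-pos b 1}}

  δ*b : d ℚ.* fromℕ b ≡ fromℕ a
  δ*b = trans (cong (λ x → d ℚ.* fromℕ (suc k′ * x)) (sym (ℕ.*-identityʳ (suc k′))))
              (/-*-fromℕ a (suc k′ ^ 2) {{ℕ.m^n≢0 (suc k′) 2}})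

  [1-δ]*b : ∀ x → (1ℚ - d) ℚ.* x ℚ.* fromℕ b ≡ fromℕ b ℚ.* x - fromℕ a ℚ.* x
  [1-δ]*b x = trans (ring d x (fromℕ b)) (cong (λ y → fromℕ b ℚ.* x - y ℚ.* x) δ*b)
    where
    ring : ∀ d x b → (1ℚ - d) ℚ.* x ℚ.* b ≡ b ℚ.* x - d ℚ.* b ℚ.* x
    ring = solve-∀ ringℚ

  [1+δ]*b : ∀ x → (1ℚ ℚ.+ d) ℚ.* x ℚ.* fromℕ b ≡ fromℕ b ℚ.* x ℚ.+ fromℕ a ℚ.* x
  [1+δ]*b x = trans (ring d x (fromℕ b)) (cong (λ y → fromℕ b ℚ.* x ℚ.+ y ℚ.* x) δ*b)
    where
    ring : ∀ d x b → (1ℚ ℚ.+ d) ℚ.* x ℚ.* b ≡ b ℚ.* x ℚ.+ d ℚ.* b ℚ.* x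
    ring = solve-∀ ringℚ

  private
    fromℕ-≤-+ : ∀ x y u v w z → x * y ≤ u * v + w * z →
                fromℕ x ℚ.* fromℕ y ℚ.≤ fromℕ u ℚ.* fromℕ v ℚ.+ fromℕ w ℚ.* fromℕ z
    fromℕ-≤-+ x y u v w z le = begin
      fromℕ x ℚ.* fromℕ y ≡⟨ fromℕ-* x y ⟨
      fromℕ (x * y) ≤⟨ fromℕ-mono-≤ {x * y} {u * v + w * z} le ⟩
      fromℕ (u * v + w * z) ≡⟨ fromℕ-+ (u * v) (w * z) ⟩
      fromℕ (u * v) ℚ.+ fromℕ (w * z) ≡⟨ cong₂ ℚ._+_ (fromℕ-* u v) (fromℕ-* w z) ⟩
      fromℕ u ℚ.* fromℕ v ℚ.+ fromℕ w ℚ.* fromℕ z ∎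
      where open ℚ.≤-Reasoning

    x-y≤z : ∀ x y z → x ℚ.≤ z ℚ.+ y → x - y ℚ.≤ z
    x-y≤z x y z le = ℚ.≤-trans (ℚ.+-monoˡ-≤ (- y) le) (ℚ.≤-reflexive (ring z y))
      where
      ring : ∀ z y → z ℚ.+ y - y ≡ z
      ring = solve-∀ ringℚ

  half-[1-δ] : ∀ D m → b * D ≤ 2 * (b * m) + a * D → ½ ℚ.* (1ℚ - d) ℚ.* fromℕ D ℚ.≤ fromℕ m
  half-[1-δ] D m le = *-cancelʳ-≤ 0<b (begin
    ½ ℚ.* (1ℚ - d) ℚ.* fromℕ D ℚ.* fromℕ b ≡⟨ ring₁ (1ℚ - d) (fromℕ D) (fromℕ b) ⟩
    ½ ℚ.* ((1ℚ - d) ℚ.* fromℕ D ℚ.* fromℕ b) ≡⟨ cong (½ ℚ.*_) ([1-δ]*b (fromℕ D)) ⟩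
    ½ ℚ.* (fromℕ b ℚ.* fromℕ D - fromℕ a ℚ.* fromℕ D)
      ≤⟨ *-monoˡ-≤ (0≤inv 1) (x-y≤z (fromℕ b ℚ.* fromℕ D) (fromℕ a ℚ.* fromℕ D) (fromℕ 2 ℚ.* (fromℕ b ℚ.* fromℕ m)) (ℚ.≤-trans (fromℕ-≤-+ b D 2 (b * m) a D le)
           (ℚ.≤-reflexive (cong (λ x → fromℕ 2 ℚ.* x ℚ.+ fromℕ a ℚ.* fromℕ D) (fromℕ-* b m))))) ⟩
    ½ ℚ.* (fromℕ 2 ℚ.* (fromℕ b ℚ.* fromℕ m)) ≡⟨ ring₂ (fromℕ b) (fromℕ m) ⟩
    fromℕ m ℚ.* fromℕ b ∎)
    where
    open ℚ.≤-Reasoning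
    ring₁ : ∀ x y z → ½ ℚ.* x ℚ.* y ℚ.* z ≡ ½ ℚ.* (x ℚ.* y ℚ.* z)
    ring₁ = solve-∀ ringℚ
    ring₂ : ∀ x y → ½ ℚ.* (fromℕ 2 ℚ.* (x ℚ.* y)) ≡ y ℚ.* x
    ring₂ = solve-∀ ringℚ

  -- The parameters encode the test `b W ≤ a W + b w`, that is `w ≥ (1 - δ) W` written without
  -- subtraction, so that it also makes sense for `δ > 1`.
  at-least : Direction k′ (schoening k′ 0 b b a) Ω≥ (1ℚ - d)
  at-least = record
    { InW        = λ W w → W ≤ w
    ; members    = λ {n} {F} W z∈ → let _ , z⊨F , W≤ = ∈-filter⁻ (λ z → (z ⊨? F) ×-dec (fromℕ W ℚ.≤? fromℕ ∣ z ∣)) {xs = assignments n} z∈ in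
                                    z⊨F , fromℕ-cancel-≤ W≤
    ; target     = λ {n} {F} W {z} z⊨F ok →
        ∈-filter⁺ (λ z → (z ⊨? F) ×-dec ((1ℚ - d) ℚ.* fromℕ W ℚ.≤? fromℕ ∣ z ∣)) (∈-assignments z) (z⊨F , weight W ∣ z ∣ ok)
    ; unique     = λ {n} F x → Unique.filter⁺ (λ z → (z ⊨? F) ×-dec (x ℚ.≤? fromℕ ∣ z ∣)) (Unique-assignments n)
    ; length≤2^n = λ {n} F x → ℕ.≤-trans (length-filter (λ z → (z ⊨? F) ×-dec (x ℚ.≤? fromℕ ∣ z ∣)) (assignments n)) (ℕ.≤-reflexive (length-assignments n))
    ; admissible = λ {W} {w*} {w} {e} W≤ w*≤ _ small → ℕ.m≤n⇒m∸n≡0 (begin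
        W * b + (w * 0 + 0) ≡⟨ eq₁ W b w ⟩
        b * W ≤⟨ lower W w* w e W≤ w*≤ small ⟩
        b * w + a * W ≡⟨ eq₂ b w a W ⟩
        W * a + (w * b + 0) ∎)
    }
    where
    open ℕ.≤-Reasoning
    eq₁ : ∀ W b w → W * b + (w * 0 + 0) ≡ b * W
    eq₁ = ℕ-Solver.solve-∀
    eq₂ : ∀ b w a W → b * w + a * W ≡ W * a + (w * b + 0)
    eq₂ = ℕ-Solver.solve-∀
    weight : ∀ W w → (W * b + (w * 0 + 0)) ∸ (W * a + (w * b + 0)) ≡ 0 → (1ℚ - d) ℚ.* fromℕ W ℚ.≤ fromℕ w
    weight W w ok = *-cancelʳ-≤ 0<b (ℚ.≤-trans (ℚ.≤-reflexive ([1-δ]*b (fromℕ W)))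
      (ℚ.≤-trans (x-y≤z (fromℕ b ℚ.* fromℕ W) (fromℕ a ℚ.* fromℕ W) (fromℕ b ℚ.* fromℕ w) (fromℕ-≤-+ b W b w a W
        (ℕ.≤-trans (ℕ.≤-reflexive (sym (eq₁ W b w))) (ℕ.≤-trans (ℕ.m∸n≡0⇒m≤n ok) (ℕ.≤-reflexive (sym (eq₂ b w a W)))))))
        (ℚ.≤-reflexive (ℚ.*-comm (fromℕ b) (fromℕ w)))))
    lower : ∀ W w* w e → W ≤ w* → w* ≤ w + e → e ≡ 0 ⊎ b * e ≤ a * w* → b * W ≤ b * w + a * W
    lower W w* w e W≤ w*≤ (inj₁ refl) = ℕ.≤-trans (ℕ.*-monoʳ-≤ b (ℕ.≤-trans W≤ (ℕ.≤-trans w*≤ (ℕ.≤-reflexive (ℕ.+-identityʳ w))))) (ℕ.m≤m+n (b * w) (a * W))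
    lower W w* w e W≤ w*≤ (inj₂ be≤aw*) with ℕ.≤-total b a
    ... | inj₁ b≤a = ℕ.≤-trans (ℕ.*-monoˡ-≤ W b≤a) (ℕ.m≤n+m (a * W) (b * w))
    -- This is `w ≥ w* - e ≥ (1 - δ) w* ≥ (1 - δ) W`, whose last inequality relies on `δ ≤ 1`; in
    -- the case before, the constraint is void.
    ... | inj₂ a≤b = begin
      b * W ≡⟨ cong (_* W) (ℕ.m∸n+n≡m a≤b) ⟨
      (c + a) * W ≡⟨ ℕ.*-distribʳ-+ W c a ⟩
      c * W + a * W ≤⟨ ℕ.+-monoˡ-≤ (a * W) (ℕ.≤-trans (ℕ.*-monoʳ-≤ c W≤)
        (ℕ.+-cancelʳ-≤ (a * w*) (c * w*) (b * w) (begin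
          c * w* + a * w* ≡⟨ ℕ.*-distribʳ-+ w* c a ⟨
          (c + a) * w* ≡⟨ cong (_* w*) (ℕ.m∸n+n≡m a≤b) ⟩
          b * w* ≤⟨ ℕ.*-monoʳ-≤ b w*≤ ⟩
          b * (w + e) ≡⟨ ℕ.*-distribˡ-+ b w e ⟩
          b * w + b * e ≤⟨ ℕ.+-monoʳ-≤ (b * w) be≤aw* ⟩
          b * w + a * w* ∎))) ⟩
      b * w + a * W ∎
      where c = b ∸ a

  -- The parameters encode the test `b w ≤ (b + a) W`, that is `w ≤ (1 + δ) W`. It follows from
  -- `w ≤ w* + e ≤ (1 + δ) w*`, for `δ` of any size.
  at-most : Direction k′ (schoening k′ b 0 0 (b + a)) Ω≤ (1ℚ ℚ.+ d)
  at-most = record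
    { InW        = λ W w → w ≤ W
    ; members    = λ {n} {F} W z∈ → let _ , z⊨F , ≤W = ∈-filter⁻ (λ z → (z ⊨? F) ×-dec (fromℕ ∣ z ∣ ℚ.≤? fromℕ W)) {xs = assignments n} z∈ in
                                    z⊨F , fromℕ-cancel-≤ ≤W
    ; target     = λ {n} {F} W {z} z⊨F ok →
        ∈-filter⁺ (λ z → (z ⊨? F) ×-dec (fromℕ ∣ z ∣ ℚ.≤? (1ℚ ℚ.+ d) ℚ.* fromℕ W)) (∈-assignments z) (z⊨F , weight W ∣ z ∣ ok)
    ; unique     = λ {n} F x → Unique.filter⁺ (λ z → (z ⊨? F) ×-dec (fromℕ ∣ z ∣ ℚ.≤? x)) (Unique-assignments n)
    ; length≤2^n = λ {n} F x → ℕ.≤-trans (length-filter (λ z → (z ⊨? F) ×-dec (fromℕ ∣ z ∣ ℚ.≤? x)) (assignments n)) (ℕ.≤-reflexive (length-assignments n))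
    ; admissible = λ {W} {w*} {w} {e} ≤W _ w≤ small → ℕ.m≤n⇒m∸n≡0 (begin
        W * 0 + (w * b + 0) ≡⟨ eq₁ W b w ⟩
        b * w ≤⟨ upper W w* w e ≤W w≤ small ⟩
        b * W + a * W ≡⟨ eq₂ b w a W ⟩
        W * (b + a) + (w * 0 + 0) ∎)
    }
    where
    open ℕ.≤-Reasoning
    eq₁ : ∀ W b w → W * 0 + (w * b + 0) ≡ b * w
    eq₁ = ℕ-Solver.solve-∀
    eq₂ : ∀ b w a W → b * W + a * W ≡ W * (b + a) + (w * 0 + 0)
    eq₂ = ℕ-Solver.solve-∀
    weight : ∀ W w → (W * 0 + (w * b + 0)) ∸ (W * (b + a) + (w * 0 + 0)) ≡ 0 → fromℕ w ℚ.≤ (1ℚ ℚ.+ d) ℚ.* fromℕ W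
    weight W w ok = *-cancelʳ-≤ 0<b (ℚ.≤-trans (ℚ.≤-reflexive (ℚ.*-comm (fromℕ w) (fromℕ b)))
      (ℚ.≤-trans (fromℕ-≤-+ b w b W a W
        (ℕ.≤-trans (ℕ.≤-reflexive (sym (eq₁ W b w))) (ℕ.≤-trans (ℕ.m∸n≡0⇒m≤n ok) (ℕ.≤-reflexive (sym (eq₂ b w a W))))))
        (ℚ.≤-reflexive (sym ([1+δ]*b (fromℕ W))))))
    upper : ∀ W w* w e → w* ≤ W → w ≤ w* + e → e ≡ 0 ⊎ b * e ≤ a * w* → b * w ≤ b * W + a * W
    upper W w* w e ≤W w≤ (inj₁ refl) = ℕ.≤-trans (ℕ.*-monoʳ-≤ b (ℕ.≤-trans w≤ (ℕ.≤-trans (ℕ.≤-reflexive (ℕ.+-identityʳ w*)) ≤W))) (ℕ.m≤m+n (b * W) (a * W))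
    upper W w* w e ≤W w≤ (inj₂ be≤aw*) = begin
      b * w ≤⟨ ℕ.*-monoʳ-≤ b w≤ ⟩
      b * (w* + e) ≡⟨ ℕ.*-distribˡ-+ b w* e ⟩
      b * w* + b * e ≤⟨ ℕ.+-monoʳ-≤ (b * w*) be≤aw* ⟩
      b * w* + a * w* ≤⟨ ℕ.+-mono-≤ (ℕ.*-monoʳ-≤ b ≤W) (ℕ.*-monoʳ-≤ a ≤W) ⟩
      b * W + a * W ∎

  module _ {α β γ ζ : ℕ} {Ω : ∀ {n} → CNF n → ℚ → List (Assignment n)} {w : ℚ}
           (direction : Direction k′ (schoening k′ α β γ ζ) Ω w) where

    open Direction direction
    open Schoening k′ α β γ ζ using (P; time; simulation; 1≤n)

    module _ {n D : ℕ} (1≤n : 1 ≤ n) (F : CNF n) (F-k : IsKCNF (3 + k′) F) (W : ℕ) (D≤n : D ≤ n) where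

      open Greedy k′ n 1≤n α β γ ζ F F-k W D D≤n using (Spread; Enough; half-enough; disperse-spreads)

      spread⇒dispersed : ∀ {s} (S : Partial n s 0) → Spread (proj₁ S) →
                         Dispersed (Ω F (w ℚ.* fromℕ W)) s (½ ℚ.* (1ℚ - d) ℚ.* fromℕ D) (proj₁ S)
      spread⇒dispersed (S , len) (S⊆ , spread) = dispersed
        (AllPairs.map (λ {z} {z′} (1≤ , _) z≡z′ → ℕ.<⇒≢ 1≤ (sym (trans (cong (dH z) (sym z≡z′)) (dH-refl z)))) spread)
        (trans (sym (ℕ.+-identityʳ (length S))) len)
        (All.map (λ (z⊨F , ok) → target W z⊨F ok) S⊆)
        -- With fewer than two elements, `minPD` takes its starting value `n`, which is enough as
        -- `D ≤ n`.
        (half-[1-δ] D (minPD S) (minPD-elim Enough S (half-enough n (ℕ.≤-trans D≤n (ℕ.m≤m+n n (n + 0)))) (pairwise S spread)))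
        where
        pairwise : ∀ S → AllPairs (λ z z′ → 1 ≤ dH z z′ × Enough (dH z z′)) S → ∀ {z z′} → z ∈ S → z′ ∈ S → z ≢ z′ → Enough (dH z z′)
        pairwise (z ∷ S) (h ∷ hs) (here refl) (here refl) z≢z′ = contradiction refl z≢z′
        pairwise (z ∷ S) (h ∷ hs) (here refl) (there z′∈) z≢z′ = proj₂ (All.lookup h z′∈)
        pairwise (z ∷ S) (h ∷ hs) {y} (there y∈) (here refl) z≢z′ = subst Enough (dH-sym z y) (proj₂ (All.lookup h y∈))
        pairwise (z ∷ S) (h ∷ hs) (there z∈)  (there z′∈) z≢z′ = pairwise S hs z∈ z′∈ z≢z′

      succeeds : ∀ {s} T → length T ≡ s → All (_∈ Ω F (fromℕ W)) T → Unique T → D ≤ minPD T →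
                 ∀ (φ : Partial n s 0 → ℚ) → (∀ S → 0ℚ ℚ.≤ φ S) → (∀ S → Spread (proj₁ S) → 1ℚ ℚ.≤ φ S) →
                 (1ℚ - (½ ℚ.* ½) ^ℚ n) ^ℚ s ℚ.≤ E φ (disperse P F W s)
      succeeds T refl T⊆ uT D≤ φ 0≤φ 1≤φ =
        disperse-spreads (InW W) admissible T (All.map (members W) T⊆) (minPD-apart T uT D≤) φ 0≤φ 1≤φ

    run-succeeds : ∀ {n D s t} (1≤n : 1 ≤ n) (F : CNF n) → IsKCNF (3 + k′) F → ∀ W T → length T ≡ s → All (_∈ Ω F (fromℕ W)) T →
      Unique T → D ≤ minPD T → s ≤ length (Ω F (fromℕ W)) → ∀ {r} → Sim partial-rep t r (disperse P F W s) →
      1ℚ - ½ ^ℚ n ℚ.≤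
        Pr (λ out → MaybeAny.dec (dispersed? (Ω F (w ℚ.* fromℕ W)) s (½ ℚ.* (1ℚ - d) ℚ.* fromℕ D)) (toAssignments n out)) r
    run-succeeds {n} {D} {s} 1≤n F F-k W T |T|≡s T⊆ uT D≤ s≤ {r} sim = begin
      1ℚ - ½ ^ℚ n ≤⟨ union-bound n s (ℕ.≤-trans s≤ (length≤2^n F (fromℕ W))) ⟩
      (1ℚ - (½ ℚ.* ½) ^ℚ n) ^ℚ s ≤⟨ succeeds 1≤n F F-k W D≤n T |T|≡s T⊆ uT D≤ (λ S → indicator (test (partial-rep S)))
        (λ S → 0≤indicator (test (partial-rep S))) spread⇒1 ⟩
      E (λ S → indicator (test (partial-rep S))) (disperse P F W s)
                                                ≡⟨ Sim-Pr test sim ⟨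
      Pr test r ∎
      where
      open ℚ.≤-Reasoning
      Success : List (List Bool) → Set
      Success out = MaybeAny.Any (Dispersed (Ω F (w ℚ.* fromℕ W)) s (½ ℚ.* (1ℚ - d) ℚ.* fromℕ D)) (toAssignments n out)
      D≤n : D ≤ n
      D≤n = ℕ.≤-trans D≤ (min≤⊤ n (distances T))
      test : ∀ out → Dec (Success out)
      test out = MaybeAny.dec (dispersed? (Ω F (w ℚ.* fromℕ W)) s (½ ℚ.* (1ℚ - d) ℚ.* fromℕ D)) (toAssignments n out)
      spread⇒1 : ∀ S → Greedy.Spread k′ n 1≤n α β γ ζ F F-k W D D≤n (proj₁ S) → 1ℚ ℚ.≤ indicator (test (partial-rep {j = 0} S))
      spread⇒1 S spread = ℚ.≤-reflexive (sym (indicator-yes (test (partial-rep S))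
        (subst (MaybeAny.Any (Dispersed (Ω F (w ℚ.* fromℕ W)) s (½ ℚ.* (1ℚ - d) ℚ.* fromℕ D))) (sym (toAssignments-toList (proj₁ S)))
          (MaybeAny.just (spread⇒dispersed 1≤n F F-k W D≤n S spread)))))

    approximates : Approximates (3 + k′) Ω w (½ ℚ.* (1ℚ - d)) (algorithm P)
    approximates _ ε 0<ε = let N , small = eventually-small ε 0<ε in N , λ n N≤n I _ s≤ →
      let open Input I
          T , |T|≡s , T⊆ , uT , D≤ = optimal-set (Ω F (fromℕ W)) s s≤ (unique F (fromℕ W)) in
      time I , ℚ.≤-trans (ℚ.+-monoʳ-≤ 1ℚ (ℚ.neg-antimono-≤ (small n N≤n)))
                         (run-succeeds (1≤n I) F isKCNF W T |T|≡s T⊆ uT D≤ s≤ (simulation I))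

theorem8 : (k : ℕ) .{{_ : ℕ.NonZero k}} (3≤k : 3 ≤ k) →
    (∃ λ 𝒜 → RunsInTime k 𝒜 ×
    Approximates k Ω≥ (1ℚ - δ k 3≤k) (½ ℚ.* (1ℚ - δ k 3≤k)) 𝒜) ×
    (∃ λ 𝒜 → RunsInTime k 𝒜 ×
    Approximates k Ω≤ (1ℚ ℚ.+ δ k 3≤k) (½ ℚ.* (1ℚ - δ k 3≤k)) 𝒜)
theorem8 (suc zero)          (s≤s ())
theorem8 (suc (suc zero))    (s≤s (s≤s ()))
theorem8 (suc (suc (suc k′))) 3≤k =
  (algorithm _ , Schoening.runs-in-time k′ _ _ _ _ , approximates k′ 3≤k (at-least k′ 3≤k)) ,
  (algorithm _ , Schoening.runs-in-time k′ _ _ _ _ , approximates k′ 3≤k (at-most k′ 3≤k))
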